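{- Let $n\ge 4$ be an integer and $K_n$ the complete graph on $n$ vertices. (i) If $n$ is even and $v\in V(K_n)$, then the inequality $$x(\delta(\{v\}))-x(E(K_n-v))\le \frac{n-2}{2}$$ defines a facet of $\mathrm{TECSP}(K_n)$. (ii) If $n$ is odd, $v\in V(K_n)$, $h=\{w_1,w_2\}\in E(K_n-v)$, and $f:=\{v,w_1\}$, then the inequality $$x(\delta(\{v\})\setminus\{f\})-x(E(K_n-v)\setminus\{h\})-x_f\le\frac{n-3}{2}$$ defines a facet of $\mathrm{TECSP}(K_n)$.
   Context: All graphs are finite, simple and undirected. $\delta(\{v\})$ is the set of edges incident to $v$; $K_n-v$ is the graph obtained by deleting vertex $v$ and its incident edges. A graph is $2$-edge-connected if it is connected and has no bridges (edges whose removal increases the number of connected components); the empty graph and a single vertex are $2$-edge-connected. For $F\subseteq E$, $x(F)=\sum_{e\in F}x_e$. $\chi^H$ is the incidence vector of $E(H)$ in $\{0,1\}^{E(K_n)}$, and $\mathrm{TECSP}(K_n)=\mathrm{conv}\{\chi^H : H\subseteq K_n\text{ is }2\text{ -edge-connected}\}\subseteq\mathbb{R}^{E(K_n)}$. A facet is a face of dimension $\dim(\mathrm{TECSP}(K_n))-1$. -}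

module Defs where

open import Level using (_⊔_) renaming (suc to lsuc)
open import Algebra.Apartness.Structures using (IsHeytingField)
open import Algebra.Bundles using (CommutativeRing)
open import Data.Bool.Base using (Bool; true; T; not; _∧_; _∨_; if_then_else_)
open import Data.Bool.Properties using (T-∧)
open import Data.Fin.Base as Fin using (Fin)
open import Data.Fin.Properties using (_≟_; _<?_)
open import Data.Fin.Subset using (Subset; _∈_)
open import Data.Integer.Base as ℤ using (ℤ; +_)
open import Data.Nat.Base as ℕ using (ℕ)
open import Data.Product.Base using (Σ-syntax; ∃-syntax; _×_; _,_; proj₁)
open import Data.Sum.Base using (_⊎_)
open import Function.Base using (_∘_)
open import Function.Bundles using (_⇔_; Equivalence)
open import Relation.Binary.Construct.Closure.ReflexiveTransitive using (Star)
open import Relation.Binary.Core using (Rel)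
open import Relation.Binary.PropositionalEquality.Core using (_≡_)
open import Relation.Binary.Structures using (IsStrictPartialOrder)
open import Relation.Nullary.Decidable.Core using (Dec; yes; no; does)
open import Relation.Nullary.Negation.Core using (¬_)
open import Relation.Unary using (Pred)
import Algebra.Properties.Semiring.Mult as SemiringMult
import Algebra.Properties.Semiring.Sum as SemiringSum

------------------------------------------------------------------------
-- Real numbers

-- Ordered fields in the constructive sense: apartness is x < y ⊎ y < x, and
-- x ≤ y is ¬ (y < x).  Decidability of the order is not assumed, so that
-- constructions of ℝ in plain Agda are instances.  Nontriviality and the
-- cotransitivity of _<_ follow from IsHeytingField.
record OrderedField c ℓ₁ ℓ₂ : Set (lsuc (c ⊔ ℓ₁ ⊔ ℓ₂)) where
  infix  8 -_
  infixl 7 _*_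
  infixl 6 _+_
  infix  4 _≈_ _<_ _≤_
  field
    Carrier : Set c
    _≈_     : Rel Carrier ℓ₁
    _<_     : Rel Carrier ℓ₂
    _+_ _*_ : Carrier → Carrier → Carrier
    -_      : Carrier → Carrier
    0# 1#   : Carrier

    isHeytingField       : IsHeytingField _≈_ (λ x y → (x < y) ⊎ (y < x)) _+_ _*_ -_ 0# 1#
    isStrictPartialOrder : IsStrictPartialOrder _≈_ _<_
    +-monoˡ-<            : ∀ z {x y} → x < y → (x + z) < (y + z)
    *-pos                : ∀ {x y} → 0# < x → 0# < y → 0# < (x * y)

  _≤_ : Rel Carrier ℓ₂
  x ≤ y = ¬ (y < x)

  commutativeRing : CommutativeRing c ℓ₁
  commutativeRing = record
    { isCommutativeRing = IsHeytingField.isCommutativeRing isHeytingField }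

  open CommutativeRing commutativeRing public using (_-_; semiring)
  open SemiringSum semiring public using (sum)
  open SemiringMult semiring public using () renaming (_×_ to _·_)

  fromℕ : ℕ → Carrier
  fromℕ k = k · 1#

-- An Archimedean, Cauchy complete ordered field; these axioms determine ℝ up
-- to isomorphism.  Quantifying the Cauchy condition over all pairs m, k makes
-- the one-sided bound equivalent to a bound on the absolute value.
record RealField c ℓ₁ ℓ₂ : Set (lsuc (c ⊔ ℓ₁ ⊔ ℓ₂)) where
  field
    orderedField : OrderedField c ℓ₁ ℓ₂
  open OrderedField orderedField public
  field
    archimedean : ∀ x → ∃[ k ] (x < fromℕ k)
    complete    : (s : ℕ → Carrier) →
                  (∀ ε → 0# < ε →
                     ∃[ N ] (∀ m k → N ℕ.≤ m → N ℕ.≤ k → s m < (s k + ε))) →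
                  ∃[ l ] (∀ ε → 0# < ε →
                     ∃[ N ] (∀ m → N ℕ.≤ m → (s m < (l + ε)) × (l < (s m + ε))))

------------------------------------------------------------------------
-- Edges of the complete graph

-- The unordered pair {i,j} with i ≢ j is stored in increasing order.  The
-- proof field is irrelevant, so edges with equal endpoints are equal.
record Edge (n : ℕ) : Set where
  constructor mkEdge
  field
    lo hi  : Fin n
    .lo<hi : lo Fin.< hi

open Edge public

-- e = {u,w}
_Joins_,_ : ∀ {n} → Edge n → Fin n → Fin n → Set
e Joins u , w = (lo e ≡ u × hi e ≡ w) ⊎ (lo e ≡ w × hi e ≡ u)

EdgeSet : ℕ → Set
EdgeSet n = Edge n → Bool

infix 4 _∈ᴱ_

_∈ᴱ_ : ∀ {n} → Edge n → EdgeSet n → Set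
e ∈ᴱ F = T (F e)

infixl 6 _∖_

_∖_ : ∀ {n} → EdgeSet n → EdgeSet n → EdgeSet n
(F ∖ G) e = F e ∧ not (G e)

⁅_⁆ᴱ : ∀ {n} → Edge n → EdgeSet n
⁅ e ⁆ᴱ e′ = does (lo e ≟ lo e′) ∧ does (hi e ≟ hi e′)

δ : ∀ {n} → Fin n → EdgeSet n
δ v e = does (lo e ≟ v) ∨ does (hi e ≟ v)

E[K] : ∀ {n} → EdgeSet n
E[K] _ = true

E[K-_] : ∀ {n} → Fin n → EdgeSet n
E[K- v ] = E[K] ∖ δ v

------------------------------------------------------------------------
-- Subgraphs of the complete graph

record Subgraph (n : ℕ) : Set where
  field
    vertices  : Subset n
    edges     : EdgeSet n
    endpoints : ∀ {e} → e ∈ᴱ edges → lo e ∈ vertices × hi e ∈ vertices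

open Subgraph public

Adjacent : ∀ {n} → Subgraph n → Rel (Fin n) _
Adjacent H u w = ∃[ e ] (e ∈ᴱ edges H × e Joins u , w)

Reachable : ∀ {n} → Subgraph n → Rel (Fin n) _
Reachable H = Star (Adjacent H)

-- The graph without vertices counts as connected.
Connected : ∀ {n} → Subgraph n → Set
Connected H = ∀ {u w} → u ∈ vertices H → w ∈ vertices H → Reachable H u w

-- H has exactly k connected components: its vertices can be labelled
-- surjectively by Fin k with equal labels exactly on joined vertices.
HasComponents : ∀ {n} → Subgraph n → ℕ → Set
HasComponents {n} H k = Σ[ label ∈ (∀ (v : Fin n) → v ∈ vertices H → Fin k) ]
  (∀ i → ∃[ v ] ∃[ v∈H ] label v v∈H ≡ i) ×
  (∀ {u w} (u∈H : u ∈ vertices H) (w∈H : w ∈ vertices H) →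
     label u u∈H ≡ label w w∈H ⇔ Reachable H u w)

deleteEdge : ∀ {n} → Subgraph n → Edge n → Subgraph n
deleteEdge H e = record
  { vertices  = vertices H
  ; edges     = edges H ∖ ⁅ e ⁆ᴱ
  ; endpoints = endpoints H ∘ proj₁ ∘ Equivalence.to T-∧
  }

IsBridge : ∀ {n} → Subgraph n → Edge n → Set
IsBridge H e = e ∈ᴱ edges H ×
  ∃[ k ] ∃[ k′ ] (HasComponents H k × HasComponents (deleteEdge H e) k′ × k ℕ.< k′)

TwoEdgeConnected : ∀ {n} → Subgraph n → Set
TwoEdgeConnected H = Connected H × (∀ e → ¬ IsBridge H e)

------------------------------------------------------------------------
-- Polytopes in the coordinate space I → Carrier

module Polytope {c ℓ₁ ℓ₂} (F : OrderedField c ℓ₁ ℓ₂) where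
  open OrderedField F

  module _ {I : Set} where

    conv : ∀ {p} → Pred (I → Carrier) p → Pred (I → Carrier) _
    conv S x = ∃[ m ] Σ[ s ∈ (Fin m → I → Carrier) ] Σ[ λs ∈ (Fin m → Carrier) ]
      (∀ i → S (s i)) ×
      (∀ i → 0# ≤ λs i) ×
      sum λs ≈ 1# ×
      (∀ e → x e ≈ sum (λ i → λs i * s i e))

    AffinelyIndependent : ∀ {m} → (Fin m → I → Carrier) → Set _
    AffinelyIndependent {m} s = ∀ (μ : Fin m → Carrier) →
      sum μ ≈ 0# → (∀ e → sum (λ i → μ i * s i e) ≈ 0#) → ∀ i → μ i ≈ 0#

    HasIndependent : ∀ {p} → Pred (I → Carrier) p → ℕ → Set _
    HasIndependent S m = Σ[ s ∈ (Fin m → I → Carrier) ] ((∀ i → S (s i)) × AffinelyIndependent s)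

    -- The dimension is one less than the largest number of affinely
    -- independent points; it is -1 for the empty set.
    HasDimension : ∀ {p} → Pred (I → Carrier) p → ℤ → Set _
    HasDimension S d = ∃[ r ]
      (d ≡ + r ℤ.- + 1 × HasIndependent S r × (∀ m → HasIndependent S m → m ℕ.≤ r))

    -- The inequality f x ≤ β, for a linear form f.
    IsValid : ∀ {p} → Pred (I → Carrier) p → ((I → Carrier) → Carrier) → Carrier → Set _
    IsValid P f β = ∀ x → P x → f x ≤ β

    Face : ∀ {p} → Pred (I → Carrier) p → ((I → Carrier) → Carrier) → Carrier →
           Pred (I → Carrier) _
    Face P f β x = P x × f x ≈ β

    DefinesFacet : ∀ {p} → Pred (I → Carrier) p → ((I → Carrier) → Carrier) → Carrier → Set _
    DefinesFacet P f β = IsValid P f β ×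
      ∃[ d ] (HasDimension P d × HasDimension (Face P f β) (d ℤ.- + 1))

  χ : ∀ {n} → Subgraph n → Edge n → Carrier
  χ H e = if edges H e then 1# else 0#

  TECSP : ∀ n → Pred (Edge n → Carrier) _
  TECSP n = conv (λ y → ∃[ H ] (TwoEdgeConnected H × (∀ e → y e ≈ χ H e)))

  infix 9 _⟨_⟩

  -- x(F) = Σ_{e ∈ F} x_e, summing over the pairs i < j.
  _⟨_⟩ : ∀ {n} → (Edge n → Carrier) → EdgeSet n → Carrier
  _⟨_⟩ {n} x F = sum (λ i → sum (λ j → term i j (i <? j)))
    where
    term : ∀ (i j : Fin n) → Dec (i Fin.< j) → Carrier
    term i j (yes i<j) = if F (mkEdge i j i<j) then x (mkEdge i j i<j) else 0#
    term i j (no _)    = 0#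

{-# OPTIONS --safe #-}

-- Validity is local.  Twice the left-hand side is a sum over the vertices
-- u ≢ v of 2 [uv ∈ H] − deg(u in H − v); since an edge at a vertex of degree one
-- would be a bridge, each term is at most 1, and parity gives the last unit.
-- In the odd case w₁ and w₂ together contribute at most 1.
--
-- For the dimensions, a homogeneous linear system with more unknowns than
-- equations has a nonzero solution.  Over an ordered field without decidable
-- equality this holds under a double negation, which suffices because the
-- conclusions (m ≤ r, x ≈ 0) are stable.  It bounds the ranks from above, and
-- it reduces the independence of |E| points to the statement that no nonzero
-- linear form vanishes on all of them.  The points used come from bouquets of
-- triangles through v, with one block replaced by K₄ minus an edge, by a
-- 4-cycle or by K₂,₃; comparing two that differ in one block determines the
-- form, by induction on the number of triangles.
module Submission where

open import Defs
open import Level using (_⊔_)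
open import Algebra.Apartness.Structures using (IsHeytingField)
open import Algebra.Bundles using (CommutativeMonoid; CommutativeRing)
open import Data.Bool.Base using (Bool; true; false; T; not; if_then_else_)
open import Data.Bool.Properties using (T-∧)
open import Data.Empty using (⊥-elim; ⊥-elim-irr)
open import Data.Fin.Base as Fin using (Fin; zero; suc; punchIn; splitAt; _↑ˡ_; _↑ʳ_)
open import Data.Fin.Properties
  using ( _≟_; _<?_; <-cmp; punchIn-punchOut; punchInᵢ≢i; cast-involutive
        ; splitAt-↑ˡ; splitAt-↑ʳ; join-splitAt)
open import Data.Fin.Subset as Subset using ()
import Data.Integer.Base as ℤ
open import Data.List.Base using (List; []; _∷_; _++_; map; length; lookup; allFin)
open import Data.List.Membership.Propositional using (_∈_; find)
open import Data.List.Membership.Propositional.Properties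
  using (∈-++⁺ˡ; ∈-++⁺ʳ; ∈-++⁻; ∈-map⁺; ∈-∃++; ∈-allFin; ∈-lookup)
open import Data.List.Properties using (length-++; length-map; length-tabulate)
open import Data.List.Relation.Binary.Permutation.Propositional as Perm
  using (_↭_; ↭-refl; ↭-sym; ↭-trans; ↭⇒↭ₛ; prep; swap)
open import Data.List.Relation.Binary.Permutation.Propositional.Properties
  using (shift; ↭-length; All-resp-↭; Any-resp-↭; ∈-resp-↭; ++-comm; ++⁺ˡ)
  renaming (++-identityʳ to ↭-++-identityʳ)
open import Data.List.Relation.Unary.All as All using (All; []; _∷_)
open import Data.List.Relation.Unary.AllPairs as AllPairs using (AllPairs; []; _∷_)
open import Data.List.Relation.Unary.Any as Any using (Any; here; there; any?)
open import Data.List.Relation.Unary.Any.Properties using (lookup-index)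
open import Data.List.Relation.Unary.Unique.Propositional using (Unique)
open import Data.List.Relation.Unary.Unique.Propositional.Properties using (allFin⁺)
open import Data.Nat.Base as ℕ using (ℕ; zero; suc; z≤n; s≤s; z<s; s<s; s<s⁻¹)
open import Data.Nat.Divisibility using (_∣_; divides)
open import Data.Nat.DivMod using (m≡m%n+[m/n]*n; m%n<n; m*n/n≡m)
open import Data.Nat.Solver using (module +-*-Solver)
open import Data.Product.Base using (∃-syntax; Σ-syntax; _×_; _,_; proj₁; proj₂)
open import Data.Sum.Base using (_⊎_; inj₁; inj₂; [_,_]′)
open import Data.Vec.Base using (tabulate)
open import Data.Vec.Functional using (insertAt; removeAt)
open import Data.Vec.Functional.Properties using (insertAt-lookup; insertAt-punchIn)
open import Data.Vec.Properties using (lookup∘tabulate; []=⇒lookup; lookup⇒[]=)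
open import Function.Base using (_∘_; _$_; id)
open import Function.Bundles using (Equivalence; mk⇔)
open import Relation.Binary.Construct.Closure.ReflexiveTransitive as Star
  using (Star; ε; _◅_; _◅◅_)
open import Relation.Binary.Definitions using (tri<; tri≈; tri>)
open import Relation.Binary.PropositionalEquality as ≡ using (_≡_; _≢_)
open import Relation.Binary.Structures using (IsStrictPartialOrder)
open import Relation.Nullary.Decidable
  using (Dec; yes; no; does; _×-dec_; _⊎-dec_; dec-true; dec-false; T?)
open import Relation.Nullary.Negation using (¬_; contradiction)
open import Relation.Unary using (Pred)
import Algebra.Properties.CommutativeMonoid.Sum as CommutativeMonoidSum
import Algebra.Properties.CommutativeSemigroup as CommutativeSemigroupProperties
import Algebra.Properties.Ring as RingProperties
import Algebra.Properties.Semiring.Mult as SemiringMult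
import Algebra.Properties.Semiring.Sum as SemiringSum
import Algebra.Solver.CommutativeMonoid as CommutativeMonoidSolver
import Data.Fin.Properties as Fin
import Data.List.Relation.Binary.Permutation.Setoid.Properties as PermSetoid
import Data.List.Relation.Unary.All.Properties as All
import Data.List.Relation.Unary.AllPairs.Properties as AllPairs
import Data.List.Relation.Unary.Any.Properties as Any
import Data.Nat.Properties as ℕ
import Relation.Binary.Reasoning.Setoid as SetoidReasoning

-- Both right-hand sides are positive, so the hyperplane misses the origin, which is the vertex of
-- the empty graph. Hence |E| linearly independent points on the face settle its dimension and, with
-- the origin added, that of the polytope; only homogeneous forms have to be excluded. The induction
-- nevertheless treats forms with an arbitrary constant value γ, because stripping a common triangle
-- off a block of graphs shifts that value. For graphs that miss w₁, the odd inequality on n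
-- vertices is the even inequality on n - 1 vertices, with the same right-hand side. So the odd case
-- reuses the even points of Kₙ - w₁ and adds one point for each of the n - 1 edges at w₁. Tightness
-- of the points and exclusion of other forms are both statements about symmetric edge weights, read
-- once for the facet form and once for an unknown form. The definition of a bridge counts
-- components. For the points this is handled through ears: an ear that loses one edge still hangs
-- on one of its two ends at every vertex.

module SumSupport {a ℓ} (M : CommutativeMonoid a ℓ) where
  open CommutativeMonoid M renaming (ε to 0#)
  open CommutativeMonoidSum M

  sum-zero : ∀ {m} {t : Fin m → Carrier} → (∀ i → t i ≈ 0#) → sum t ≈ 0#
  sum-zero {m} t≈0 = trans (sum-cong-≋ t≈0) (sum-replicate-zero m)

  sum-single : ∀ {m} (t : Fin m → Carrier) k → (∀ i → i ≢ k → t i ≈ 0#) → sum t ≈ t k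
  sum-single {suc m} t k t≈0 = trans (sum-remove {i = k} t)
    (trans (∙-congˡ (sum-zero λ i → t≈0 (punchIn k i) (punchInᵢ≢i k i))) (identityʳ (t k)))

-- Order and arithmetic in a constructive ordered field

module OrderedFieldProperties {c ℓ₁ ℓ₂} (F : OrderedField c ℓ₁ ℓ₂) where
  open OrderedField F public
  open CommutativeRing commutativeRing public
    using ( setoid; refl; sym; trans; +-cong; +-congˡ; +-congʳ; *-congˡ; *-congʳ
          ; +-assoc; +-comm; *-assoc; *-comm; +-identityˡ; +-identityʳ; *-identityˡ; *-identityʳ
          ; distribˡ; distribʳ; zeroˡ; zeroʳ; -‿cong; -‿inverseˡ; -‿inverseʳ; ring
          ; reflexive)
  open RingProperties ring public
    using (-‿distribˡ-*; -‿distribʳ-*; -‿involutive; -0#≈0#; -‿+-comm; +-cancelˡ; +-cancelʳ)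
  open SemiringSum semiring public
    using ( sum-cong-≋; sum-cong-≗; sum-remove; sum-replicate-zero; ∑-distrib-+; ∑-comm
          ; *-distribˡ-sum; *-distribʳ-sum)
  open SemiringMult semiring public using () renaming (×-homo-+ to ·-homo-+)
  open CommutativeRing commutativeRing public using (+-commutativeMonoid)
  open CommutativeMonoid +-commutativeMonoid using ()
    renaming (commutativeSemigroup to +-commutativeSemigroup)
  open SumSupport +-commutativeMonoid public
  open IsHeytingField isHeytingField using (#-cotrans; #⇒invertible; invertible⇒#; tight)
  open IsStrictPartialOrder isStrictPartialOrder public
    using (<-respˡ-≈; <-respʳ-≈) renaming (irrefl to <-irrefl; trans to <-trans; asym to <-asym)
  open CommutativeSemigroupProperties +-commutativeSemigroup public using (interchange)
  open SetoidReasoning setoid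

  infix 4 _#_

  _#_ : Carrier → Carrier → Set ℓ₂
  x # y = (x < y) ⊎ (y < x)

  -- Cotransitivity of the apartness does not say on which side `z` lies; in the two unwanted
  -- orientations transitivity with `x < y` gives one of the wanted ones.
  <-cotrans : ∀ {x y} → x < y → ∀ z → (x < z) ⊎ (z < y)
  <-cotrans x<y z with #-cotrans (inj₁ x<y) z
  ... | inj₁ (inj₁ x<z) = inj₁ x<z
  ... | inj₁ (inj₂ z<x) = inj₂ (<-trans z<x x<y)
  ... | inj₂ (inj₁ z<y) = inj₂ z<y
  ... | inj₂ (inj₂ y<z) = inj₁ (<-trans x<y y<z)

  ¬#⇒≈ : ∀ {x y} → ¬ (x # y) → x ≈ y
  ¬#⇒≈ = proj₁ (tight _ _)

  x-0≈x : ∀ x → x - 0# ≈ x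
  x-0≈x x = trans (+-congˡ -0#≈0#) (+-identityʳ x)

  x#0⇒inverse : ∀ {x} → x # 0# → ∃[ y ] y * x ≈ 1#
  x#0⇒inverse {x} x#0 with #⇒invertible x#0
  ... | y , yx≈1 , _ = y , trans (*-congˡ (sym (x-0≈x x))) yx≈1

  inverse⇒#0 : ∀ {x y} → y * x ≈ 1# → x # 0#
  inverse⇒#0 {x} {y} yx≈1 = invertible⇒# (y , yx′ , trans (*-comm _ _) yx′)
    where yx′ = trans (*-congˡ (x-0≈x x)) yx≈1

  *-cancelˡ-0 : ∀ {x y} → x # 0# → x * y ≈ 0# → y ≈ 0#
  *-cancelˡ-0 {x} {y} x#0 xy≈0 with x#0⇒inverse x#0
  ... | z , zx≈1 = begin
    y           ≈⟨ *-identityˡ y ⟨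
    1# * y      ≈⟨ *-congʳ zx≈1 ⟨
    z * x * y   ≈⟨ *-assoc z x y ⟩
    z * (x * y) ≈⟨ *-congˡ xy≈0 ⟩
    z * 0#      ≈⟨ zeroʳ z ⟩
    0#          ∎

  +-monoʳ-< : ∀ z {x y} → x < y → (z + x) < (z + y)
  +-monoʳ-< z x<y = <-respˡ-≈ (+-comm _ z) (<-respʳ-≈ (+-comm _ z) (+-monoˡ-< z x<y))

  x<0⇒0<-x : ∀ {x} → x < 0# → 0# < - x
  x<0⇒0<-x {x} x<0 =
    <-respˡ-≈ (-‿inverseʳ x) (<-respʳ-≈ (+-identityˡ (- x)) (+-monoˡ-< (- x) x<0))

  1#0 : 1# # 0#
  1#0 = inverse⇒#0 (*-identityˡ 1#)

  0<1 : 0# < 1#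
  0<1 with 1#0
  ... | inj₂ 0<1 = 0<1
  ... | inj₁ 1<0 = <-respʳ-≈ -1*-1≈1 (*-pos (x<0⇒0<-x 1<0) (x<0⇒0<-x 1<0))
    where
    -1*-1≈1 : - 1# * - 1# ≈ 1#
    -1*-1≈1 = begin
      - 1# * - 1#   ≈⟨ -‿distribˡ-* 1# (- 1#) ⟨
      - (1# * - 1#) ≈⟨ -‿cong (*-identityˡ (- 1#)) ⟩
      - - 1#        ≈⟨ -‿involutive 1# ⟩
      1#            ∎

  ≤-refl : ∀ {x} → x ≤ x
  ≤-refl = <-irrefl refl

  -- If the sum were negative, cotransitivity would place `y` above the sum or below 0; the first
  -- makes `x` negative, the second `y`.
  +-nonneg : ∀ {x y} → 0# ≤ x → 0# ≤ y → 0# ≤ x + y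
  +-nonneg {x} {y} 0≤x 0≤y x+y<0 with <-cotrans x+y<0 y
  ... | inj₂ y<0   = 0≤y y<0
  ... | inj₁ x+y<y = 0≤x (<-respˡ-≈ (cancel x)
                           (<-respʳ-≈ (-‿inverseʳ y) (+-monoˡ-< (- y) x+y<y)))
    where
    cancel : ∀ x → (x + y) - y ≈ x
    cancel x = trans (+-assoc x y (- y)) (trans (+-congˡ (-‿inverseʳ y)) (+-identityʳ x))

  0≤1 : 0# ≤ 1#
  0≤1 = <-asym 0<1

  -- A negative product is invertible, hence so are both factors. Being nonnegative and apart from 0
  -- they are positive, and so is their product.
  *-nonneg : ∀ {x y} → 0# ≤ x → 0# ≤ y → 0# ≤ x * y
  *-nonneg {x} {y} 0≤x 0≤y xy<0 with x#0⇒inverse (inj₁ xy<0)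
  ... | z , z[xy]≈1 = <-asym xy<0 (*-pos (pos 0≤x x#0) (pos 0≤y y#0))
    where
    pos : ∀ {x} → 0# ≤ x → x # 0# → 0# < x
    pos 0≤x (inj₁ x<0) = contradiction x<0 0≤x
    pos 0≤x (inj₂ 0<x) = 0<x

    y#0 : y # 0#
    y#0 = inverse⇒#0 (trans (*-assoc z x y) z[xy]≈1)

    x#0 : x # 0#
    x#0 = inverse⇒#0 (trans (trans (*-assoc z y x) (*-congˡ (*-comm y x))) z[xy]≈1)

  sum-nonneg : ∀ {m} (t : Fin m → Carrier) → (∀ i → 0# ≤ t i) → 0# ≤ sum t
  sum-nonneg {zero}  t 0≤t = ≤-refl
  sum-nonneg {suc m} t 0≤t = +-nonneg (0≤t zero) (sum-nonneg (t ∘ suc) (0≤t ∘ suc))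

  fromℕ-nonneg : ∀ k → 0# ≤ fromℕ k
  fromℕ-nonneg zero    = ≤-refl
  fromℕ-nonneg (suc k) = +-nonneg 0≤1 (fromℕ-nonneg k)

  -- Characteristic 0: by cotransitivity the alternative to being positive is to lie below 1, and
  -- then `fromℕ k` would be negative.
  fromℕ[1+k]#0 : ∀ k → fromℕ (suc k) # 0#
  fromℕ[1+k]#0 k with <-cotrans 0<1 (fromℕ (suc k))
  ... | inj₁ 0<s = inj₂ 0<s
  ... | inj₂ s<1 = contradiction (<-respˡ-≈ (cancel′ (fromℕ k)) (<-respʳ-≈ (-‿inverseˡ 1#) (+-monoʳ-< (- 1#) s<1)))
                     (fromℕ-nonneg k)
    where
    cancel′ : ∀ x → - 1# + (1# + x) ≈ x
    cancel′ x = trans (sym (+-assoc _ _ x)) (trans (+-congʳ (-‿inverseˡ 1#)) (+-identityˡ x))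

  +-nonneg⇒≤ : ∀ {x y z} → 0# ≤ y → x + y ≈ z → x ≤ z
  +-nonneg⇒≤ {x} {y} {z} 0≤y x+y≈z z<x = 0≤y
    (<-respˡ-≈ (cancel y) (<-respʳ-≈ (-‿inverseˡ x)
      (+-monoʳ-< (- x) (<-respˡ-≈ (sym x+y≈z) z<x))))
    where
    cancel : ∀ y → - x + (x + y) ≈ y
    cancel y = trans (sym (+-assoc _ _ y)) (trans (+-congʳ (-‿inverseˡ x)) (+-identityˡ y))

  +-solve : ∀ {x y z} → x + y ≈ z → y ≈ z - x
  +-solve {x} {y} {z} x+y≈z = begin
    y           ≈⟨ +-identityʳ y ⟨
    y + 0#      ≈⟨ +-congˡ (-‿inverseʳ x) ⟨
    y + (x - x) ≈⟨ +-assoc y x (- x) ⟨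
    y + x - x   ≈⟨ +-congʳ (trans (+-comm y x) x+y≈z) ⟩
    z - x       ∎

  -- The apartness is tight, so refuting the first alternative already proves the second.
  ¬¬#-dec : ∀ x → ¬ ¬ (x # 0# ⊎ x ≈ 0#)
  ¬¬#-dec x ¬d = ¬d (inj₂ (¬#⇒≈ (¬d ∘ inj₁)))

  #0⇒≉0 : ∀ {x} → x # 0# → ¬ (x ≈ 0#)
  #0⇒≉0 (inj₁ x<0) x≈0 = <-irrefl x≈0 x<0
  #0⇒≉0 (inj₂ 0<x) x≈0 = <-irrefl (sym x≈0) 0<x

  ≤⇒0≤- : ∀ {x y} → x ≤ y → 0# ≤ y - x
  ≤⇒0≤- {x} {y} x≤y y-x<0 = x≤y (<-respˡ-≈ y-x+x≈y (<-respʳ-≈ (+-identityˡ x) (+-monoˡ-< x y-x<0)))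
    where
    y-x+x≈y : y - x + x ≈ y
    y-x+x≈y = trans (+-assoc y (- x) x) (trans (+-congˡ (-‿inverseˡ x)) (+-identityʳ y))

  ·-zero : ∀ k {σ} → σ ≈ 0# → k · σ ≈ 0#
  ·-zero zero    σ≈0 = refl
  ·-zero (suc k) σ≈0 = trans (+-cong σ≈0 (·-zero k σ≈0)) (+-identityˡ 0#)

  fromℕ-* : ∀ k x → fromℕ k * x ≈ k · x
  fromℕ-* zero    x = zeroˡ x
  fromℕ-* (suc k) x = trans (distribʳ x 1# (fromℕ k)) (+-cong (*-identityˡ x) (fromℕ-* k x))

-- Homogeneous linear systems without decidable equality

module LinearAlgebra {c ℓ₁ ℓ₂} (F : OrderedField c ℓ₁ ℓ₂) where
  open OrderedFieldProperties F
  open SetoidReasoning setoid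

  ¬¬-pivot : ∀ {m} (a : Fin m → Carrier) → ¬ ¬ ((∃[ p ] a p # 0#) ⊎ (∀ p → a p ≈ 0#))
  ¬¬-pivot {zero}  a ¬d = ¬d (inj₂ λ ())
  ¬¬-pivot {suc m} a ¬d = ¬¬#-dec (a zero) λ
    { (inj₁ a₀#0) → ¬d (inj₁ (zero , a₀#0))
    ; (inj₂ a₀≈0) → ¬¬-pivot (a ∘ suc) λ
      { (inj₁ (p , aₚ#0)) → ¬d (inj₁ (suc p , aₚ#0))
      ; (inj₂ a≈0)        → ¬d (inj₂ λ { zero → a₀≈0 ; (suc p) → a≈0 p })
      }
    }

  -- Substituting the solution μ p = - y Σ bᵢ μᵢ (with y the inverse of b p) of
  -- the equation b into the equation a.
  eliminate : ∀ {m} (a b : Fin (suc m) → Carrier) (p : Fin (suc m)) (y : Carrier)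
              (μ : Fin m → Carrier) →
              let a′ = removeAt a p ; b′ = removeAt b p in
              sum (λ i → a i * insertAt μ p (- (y * sum (λ i → b′ i * μ i))) i) ≈
              sum (λ i → (a′ i - (a p * y) * b′ i) * μ i)
  eliminate a b p y μ = begin
    sum (λ i → a i * ν i)
      ≈⟨ sum-remove {i = p} (λ i → a i * ν i) ⟩
    a p * ν p + sum (λ i → a′ i * ν (punchIn p i))
      ≡⟨ ≡.cong₂ _+_ (≡.cong (a p *_) (insertAt-lookup μ p _))
           (sum-cong-≗ λ i → ≡.cong (a′ i *_) (insertAt-punchIn μ p _ i)) ⟩
    a p * - (y * S) + sum (λ i → a′ i * μ i)
      ≈⟨ +-comm _ _ ⟩
    sum (λ i → a′ i * μ i) + a p * - (y * S)
      ≈⟨ +-congˡ (-‿distribʳ-* (a p) (y * S)) ⟨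
    sum (λ i → a′ i * μ i) + - (a p * (y * S))
      ≈⟨ +-congˡ (-‿cong (*-assoc (a p) y S)) ⟨
    sum (λ i → a′ i * μ i) + - (a p * y * S)
      ≈⟨ +-congˡ (-‿distribˡ-* (a p * y) S) ⟩
    sum (λ i → a′ i * μ i) + - (a p * y) * S
      ≈⟨ +-congˡ (*-distribˡ-sum (- (a p * y)) (λ i → b′ i * μ i)) ⟩
    sum (λ i → a′ i * μ i) + sum (λ i → - (a p * y) * (b′ i * μ i))
      ≈⟨ ∑-distrib-+ (λ i → a′ i * μ i) (λ i → - (a p * y) * (b′ i * μ i)) ⟨
    sum (λ i → a′ i * μ i + - (a p * y) * (b′ i * μ i))
      ≈⟨ sum-cong-≋ (λ i → +-congˡ (sym (*-assoc (- (a p * y)) (b′ i) (μ i)))) ⟩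
    sum (λ i → a′ i * μ i + - (a p * y) * b′ i * μ i)
      ≈⟨ sum-cong-≋ (λ i → +-congˡ (*-congʳ (sym (-‿distribˡ-* (a p * y) (b′ i))))) ⟩
    sum (λ i → a′ i * μ i + - (a p * y * b′ i) * μ i)
      ≈⟨ sum-cong-≋ (λ i → sym (distribʳ (μ i) (a′ i) (- (a p * y * b′ i)))) ⟩
    sum (λ i → (a′ i - (a p * y) * b′ i) * μ i) ∎
    where
    a′ = removeAt a p
    b′ = removeAt b p
    S  = sum (λ i → b′ i * μ i)
    ν  = insertAt μ p (- (y * S))

  -- Gaussian elimination. A first row without a pivot is dropped; otherwise its pivot unknown is
  -- eliminated, leaving one equation and one unknown fewer. Searching for the pivot costs the
  -- double negation. Nontriviality is kept as a coordinate apart from 0, which survives the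
  -- re-insertion of the pivot unknown.
  ¬¬-nontrivial-solution : ∀ {r m} → r ℕ.< m → (A : Fin r → Fin m → Carrier) →
    ¬ ¬ (Σ[ μ ∈ (Fin m → Carrier) ] (∃[ i ] μ i # 0#) × (∀ k → sum (λ i → A k i * μ i) ≈ 0#))
  ¬¬-nontrivial-solution {zero}  z<s       A none = none ((λ _ → 1#) , (zero , 1#0) , λ ())
  ¬¬-nontrivial-solution {suc r} (s<s r<m) A none = ¬¬-pivot (A zero) λ
    { (inj₂ A₀≈0) → ¬¬-nontrivial-solution (ℕ.m<n⇒m<1+n r<m) (A ∘ suc) λ
      { (μ , μ#0 , eqs) → none (μ , μ#0 , λ
        { zero    → sum-zero (λ i → trans (*-congʳ (A₀≈0 i)) (zeroˡ (μ i)))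
        ; (suc k) → eqs k }) }
    ; (inj₁ (p , A₀ₚ#0)) →
        let (y , yA₀ₚ≈1) = x#0⇒inverse A₀ₚ#0
            B = λ k i → A (suc k) (punchIn p i) - (A (suc k) p * y) * A zero (punchIn p i)
        in ¬¬-nontrivial-solution r<m B λ
      { (μ , (i , μᵢ#0) , eqs) → none
        ( insertAt μ p (- (y * sum (λ i → A zero (punchIn p i) * μ i)))
        , (punchIn p i , ≡.subst (_# 0#) (≡.sym (insertAt-punchIn μ p _ i)) μᵢ#0)
        , λ { zero    → trans (eliminate (A zero) (A zero) p y μ) (sum-zero λ i →
                          trans (*-congʳ (cancel (trans (*-comm _ _) yA₀ₚ≈1) _)) (zeroˡ (μ i)))
            ; (suc k) → trans (eliminate (A (suc k)) (A zero) p y μ) (eqs k) }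
        ) }
    }
    where
    cancel : ∀ {u} → u ≈ 1# → ∀ x → x - u * x ≈ 0#
    cancel {u} u≈1 x = begin
      x - u * x  ≈⟨ +-congˡ (-‿cong (*-congʳ u≈1)) ⟩
      x - 1# * x ≈⟨ +-congˡ (-‿cong (*-identityˡ x)) ⟩
      x - x      ≈⟨ -‿inverseʳ x ⟩
      0#         ∎

  trivial-kernel⇒independent-rows : ∀ {m} (A : Fin m → Fin m → Carrier) →
    (∀ (κ : Fin m → Carrier) → (∀ i → sum (λ j → A i j * κ j) ≈ 0#) → ∀ j → κ j ≈ 0#) →
    ∀ (μ : Fin m → Carrier) → (∀ j → sum (λ i → μ i * A i j) ≈ 0#) → ∀ i → μ i ≈ 0#
  trivial-kernel⇒independent-rows {suc m} A trivial μ μA≈0 i = ¬#⇒≈ λ μᵢ#0 →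
    -- Since μ i # 0, row i depends on the other rows, so the system A κ = 0
    -- has at most m equations in suc m unknowns.
    ¬¬-nontrivial-solution (ℕ.n<1+n m) (removeAt A i) λ
      { (κ , (j , κⱼ#0) , eqs) →
        let Aκ = λ k → sum (λ j → A k j * κ j)
            -- The double sum vanishes when evaluated by columns. Evaluated by rows, only row `i` is
            -- left, and `μ i` can be cancelled: the omitted equation holds too.
            μAκ≈0 : sum (λ k → μ k * Aκ k) ≈ 0#
            μAκ≈0 = begin
              sum (λ k → μ k * Aκ k)
                ≈⟨ sum-cong-≋ (λ k → *-distribˡ-sum (μ k) (λ j → A k j * κ j)) ⟩
              sum (λ k → sum (λ j → μ k * (A k j * κ j)))
                ≈⟨ ∑-comm (λ k j → μ k * (A k j * κ j)) ⟩
              sum (λ j → sum (λ k → μ k * (A k j * κ j)))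
                ≈⟨ sum-cong-≋ (λ j → sum-cong-≋ (λ k → *-assoc (μ k) (A k j) (κ j))) ⟨
              sum (λ j → sum (λ k → μ k * A k j * κ j))
                ≈⟨ sum-cong-≋ (λ j → *-distribʳ-sum (κ j) (λ k → μ k * A k j)) ⟨
              sum (λ j → sum (λ k → μ k * A k j) * κ j)
                ≈⟨ sum-zero (λ j → trans (*-congʳ (μA≈0 j)) (zeroˡ (κ j))) ⟩
              0# ∎
            Aκᵢ≈0 : Aκ i ≈ 0#
            Aκᵢ≈0 = *-cancelˡ-0 μᵢ#0 (begin
              μ i * Aκ i
                ≈⟨ +-identityʳ _ ⟨
              μ i * Aκ i + 0#
                ≈⟨ +-congˡ (sum-zero λ k → trans (*-congˡ (eqs k)) (zeroʳ (μ (punchIn i k)))) ⟨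
              μ i * Aκ i + sum (λ k → μ (punchIn i k) * Aκ (punchIn i k))
                ≈⟨ sum-remove {i = i} (λ k → μ k * Aκ k) ⟨
              sum (λ k → μ k * Aκ k)
                ≈⟨ μAκ≈0 ⟩
              0# ∎)
        in #0⇒≉0 κⱼ#0 (trivial κ (all-rows Aκ Aκᵢ≈0 eqs) j) }
    where
    all-rows : ∀ (t : Fin (suc m) → Carrier) → t i ≈ 0# → (∀ k → t (punchIn i k) ≈ 0#) →
               ∀ k → t k ≈ 0#
    all-rows t tᵢ≈0 t≈0 k with i ≟ k
    ... | yes ≡.refl = tᵢ≈0
    ... | no i≢k     = ≡.subst (λ k → t k ≈ 0#) (punchIn-punchOut i≢k) (t≈0 _)

-- Linear forms, convex hulls and the dimension of a face

module LinearForms {c ℓ₁ ℓ₂} (F : OrderedField c ℓ₁ ℓ₂) (I : Set) where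
  open OrderedFieldProperties F
  open LinearAlgebra F
  open Polytope F
  open SetoidReasoning setoid

  record IsLinear (f : (I → Carrier) → Carrier) : Set (c ⊔ ℓ₁) where
    field
      cong   : ∀ {x y} → (∀ e → x e ≈ y e) → f x ≈ f y
      +-homo : ∀ x y → f (λ e → x e + y e) ≈ f x + f y
      *-homo : ∀ k x → f (λ e → k * x e) ≈ k * f x

    0-homo : f (λ _ → 0#) ≈ 0#
    0-homo = begin
      f (λ _ → 0#)      ≈⟨ cong (λ _ → zeroˡ 0#) ⟨
      f (λ _ → 0# * 0#) ≈⟨ *-homo 0# (λ _ → 0#) ⟩
      0# * f (λ _ → 0#) ≈⟨ zeroˡ _ ⟩
      0#                ∎

    sum-homo : ∀ {m} (μ : Fin m → Carrier) (s : Fin m → I → Carrier) →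
               f (λ e → sum (λ i → μ i * s i e)) ≈ sum (λ i → μ i * f (s i))
    sum-homo {zero}  μ s = 0-homo
    sum-homo {suc m} μ s = trans (+-homo _ _)
      (+-cong (*-homo (μ zero) (s zero)) (sum-homo (μ ∘ suc) (s ∘ suc)))

  open IsLinear

  respects : ∀ {f g} → (∀ x → f x ≈ g x) → IsLinear f → IsLinear g
  respects f≈g F = record
    { cong   = λ x≈y → trans (sym (f≈g _)) (trans (cong F x≈y) (f≈g _))
    ; +-homo = λ x y → trans (sym (f≈g _)) (trans (+-homo F x y) (+-cong (f≈g x) (f≈g y)))
    ; *-homo = λ k x → trans (sym (f≈g _)) (trans (*-homo F k x) (*-congˡ (f≈g x)))
    }

  coordinate-linear : ∀ e → IsLinear (λ x → x e)
  coordinate-linear e = record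
    { cong = λ x≈y → x≈y e ; +-homo = λ _ _ → refl ; *-homo = λ _ _ → refl }

  zero-linear : IsLinear (λ _ → 0#)
  zero-linear = record
    { cong = λ _ → refl ; +-homo = λ _ _ → sym (+-identityˡ 0#) ; *-homo = λ k _ → sym (zeroʳ k) }

  +-linear : ∀ {f g} → IsLinear f → IsLinear g → IsLinear (λ x → f x + g x)
  +-linear {f} {g} F G = record
    { cong   = λ x≈y → +-cong (cong F x≈y) (cong G x≈y)
    ; +-homo = λ x y → trans (+-cong (+-homo F x y) (+-homo G x y)) (interchange (f x) (f y) (g x) (g y))
    ; *-homo = λ k x → trans (+-cong (*-homo F k x) (*-homo G k x)) (sym (distribˡ k (f x) (g x)))
    }

  neg-linear : ∀ {f} → IsLinear f → IsLinear (λ x → - f x)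
  neg-linear {f} F = record
    { cong   = λ x≈y → -‿cong (cong F x≈y)
    ; +-homo = λ x y → trans (-‿cong (+-homo F x y)) (sym (-‿+-comm (f x) (f y)))
    ; *-homo = λ k x → trans (-‿cong (*-homo F k x)) (-‿distribʳ-* k (f x))
    }

  sum-linear : ∀ {m} {f : Fin m → (I → Carrier) → Carrier} → (∀ i → IsLinear (f i)) →
               IsLinear (λ x → sum (λ i → f i x))
  sum-linear {zero}  _ = zero-linear
  sum-linear {suc m} F = +-linear (F zero) (sum-linear (F ∘ suc))

  scale-linear : ∀ k {f} → IsLinear f → IsLinear (λ x → k * f x)
  scale-linear k {f} F = record
    { cong   = λ x≈y → *-congˡ (cong F x≈y)
    ; +-homo = λ x y → trans (*-congˡ (+-homo F x y)) (distribˡ k (f x) (f y))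
    ; *-homo = λ l x → trans (*-congˡ (*-homo F l x))
        (trans (sym (*-assoc k l (f x))) (trans (*-congʳ (*-comm k l)) (*-assoc l k (f x))))
    }

  ⊆conv : ∀ {p} (S : Pred (I → Carrier) p) {x} → S x → conv S x
  ⊆conv _ {x} x∈S = 1 , (λ _ → x) , (λ _ → 1#) , (λ _ → x∈S) , (λ _ → 0≤1) , +-identityʳ 1# ,
    λ e → sym (trans (+-identityʳ _) (*-identityˡ (x e)))

  -- Since `≤` is a negated `<`, the bound is proved by exhibiting the slack: the convex combination
  -- of the slacks `β - f (s i)` is nonnegative and fills `f x` up to `β`.
  conv-valid : ∀ {p} {S : Pred (I → Carrier) p} {f β} → IsLinear f →
               (∀ x → S x → f x ≤ β) → IsValid (conv S) f β
  conv-valid {f = f} {β} F S≤β x (m , s , λs , s∈S , 0≤λs , ∑λs≈1 , x≈) = +-nonneg⇒≤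
    (sum-nonneg _ λ i → *-nonneg (0≤λs i) (≤⇒0≤- (S≤β (s i) (s∈S i))))
    (begin
      f x + sum (λ i → λs i * (β - f (s i)))
        ≈⟨ +-congʳ (trans (cong F x≈) (sum-homo F λs s)) ⟩
      sum (λ i → λs i * f (s i)) + sum (λ i → λs i * (β - f (s i)))
        ≈⟨ ∑-distrib-+ (λ i → λs i * f (s i)) (λ i → λs i * (β - f (s i))) ⟨
      sum (λ i → λs i * f (s i) + λs i * (β - f (s i)))
        ≈⟨ sum-cong-≋ (λ i → trans (sym (distribˡ (λs i) _ _)) (*-congˡ (cancel (f (s i))))) ⟩
      sum (λ i → λs i * β)
        ≈⟨ *-distribʳ-sum β λs ⟨
      sum λs * β
        ≈⟨ trans (*-congʳ ∑λs≈1) (*-identityˡ β) ⟩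
      β ∎)
    where
    cancel : ∀ y → y + (β - y) ≈ β
    cancel y = trans (+-comm y _) (trans (+-assoc β _ y) (trans (+-congˡ (-‿inverseˡ y)) (+-identityʳ β)))

  -- An affinely independent family of m points gives a nonsingular homogeneous
  -- system of linear conditions in m unknowns.
  module Facet
    {N} (enum : Fin N → I) (index : I → Fin N)
    (enum-index : ∀ e → enum (index e) ≡ e) (index-enum : ∀ j → index (enum j) ≡ j)
    where

    private
      every : ∀ {ℓ} {P : I → Set ℓ} → (∀ j → P (enum j)) → ∀ e → P e
      every {P = P} Pj e = ≡.subst P (enum-index e) (Pj (index e))

    -- An affine dependence solves N + 1 equations, one for the sum of the coefficients and one for
    -- each coordinate.
    conv-rank : ∀ {p} (P : Pred (I → Carrier) p) m → HasIndependent P m → m ℕ.≤ suc N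
    conv-rank _ m (s , _ , independent) = ℕ.≮⇒≥ λ N<m →
      ¬¬-nontrivial-solution N<m (λ { zero i → 1# ; (suc j) i → s i (enum j) }) λ
        { (μ , (i , μᵢ#0) , eqs) → #0⇒≉0 μᵢ#0 (independent μ
            (trans (sum-cong-≋ λ i → sym (*-identityˡ (μ i))) (eqs zero))
            (every λ j → trans (sum-cong-≋ λ i → *-comm (μ i) _) (eqs (suc j))) i) }

    -- Applying `f` to a vanishing combination gives `β` times the sum of its coefficients. As
    -- `β # 0`, the equation for that sum follows from the N coordinate equations, which saves one
    -- point.
    face-rank : ∀ {p} (P : Pred (I → Carrier) p) {f β} → IsLinear f → β # 0# →
                ∀ m → HasIndependent (Face P f β) m → m ℕ.≤ N
    face-rank _ {f} {β} F β#0 m (s , s∈face , independent) = ℕ.≮⇒≥ λ N<m →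
      ¬¬-nontrivial-solution N<m (λ j i → s i (enum j)) λ
        { (μ , (i , μᵢ#0) , eqs) →
            let combination≈0 = every λ j → trans (sum-cong-≋ λ i → *-comm (μ i) _) (eqs j)
            in #0⇒≉0 μᵢ#0 (independent μ (∑μ≈0 μ combination≈0) combination≈0 i) }
      where
      ∑μ≈0 : ∀ μ → (∀ e → sum (λ i → μ i * s i e) ≈ 0#) → sum μ ≈ 0#
      ∑μ≈0 μ combination≈0 = *-cancelˡ-0 β#0 (begin
        β * sum μ                             ≈⟨ *-comm β (sum μ) ⟩
        sum μ * β                             ≈⟨ *-distribʳ-sum β μ ⟩
        sum (λ i → μ i * β)                   ≈⟨ sum-cong-≋ (λ i → *-congˡ (proj₂ (s∈face i))) ⟨
        sum (λ i → μ i * f (s i))             ≈⟨ sum-homo F μ s ⟨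
        f (λ e → sum (λ i → μ i * s i e))     ≈⟨ cong F combination≈0 ⟩
        f (λ _ → 0#)                          ≈⟨ 0-homo F ⟩
        0#                                    ∎)

    -- A square matrix with trivial kernel has independent rows, so the points are even linearly
    -- independent. This gives rank N on the face, and adjoining the origin gives rank N + 1 on the
    -- polytope.
    definesFacet : ∀ {p} {S : Pred (I → Carrier) p} {f β} → IsLinear f → β # 0# →
      (∀ x → S x → f x ≤ β) → S (λ _ → 0#) →
      (pts : Fin N → I → Carrier) → (∀ i → S (pts i)) → (∀ i → f (pts i) ≈ β) →
      (∀ (κ : I → Carrier) → (∀ i → sum (λ j → κ (enum j) * pts i (enum j)) ≈ 0#) → ∀ e → κ e ≈ 0#) →
      DefinesFacet (conv S) f β
    definesFacet {S = S} {f} {β} F β#0 valid 0∈S pts pts∈S tight trivial =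
      conv-valid F valid , ℤ.+ suc N ℤ.- ℤ.+ 1 ,
      (suc N , ≡.refl , (pts₀ , pts₀∈P , pts₀-independent) , conv-rank (conv S)) ,
      (N , ≡.refl , (pts , (λ i → ⊆conv S (pts∈S i) , tight i) , λ μ _ → pts-independent μ) , face-rank (conv S) F β#0)
      where
      pts-independent : ∀ μ → (∀ e → sum (λ i → μ i * pts i e) ≈ 0#) → ∀ i → μ i ≈ 0#
      pts-independent μ combination≈0 =
        trivial-kernel⇒independent-rows (λ i j → pts i (enum j))
          (λ κ eqs j → ≡.subst (λ j → κ j ≈ 0#) (index-enum j)
            (trivial (κ ∘ index) (λ i → trans
              (sum-cong-≋ λ j → trans (*-comm _ _) (*-congˡ (reflexive (≡.cong κ (index-enum j)))))
              (eqs i)) (enum j)))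
          μ (λ j → combination≈0 (enum j))

      pts₀ : Fin (suc N) → I → Carrier
      pts₀ zero    = λ _ → 0#
      pts₀ (suc i) = pts i

      pts₀∈P : ∀ i → conv S (pts₀ i)
      pts₀∈P zero    = ⊆conv S 0∈S
      pts₀∈P (suc i) = ⊆conv S (pts∈S i)

      pts₀-independent : AffinelyIndependent pts₀
      pts₀-independent μ ∑μ≈0 combination≈0 = λ
        { zero    → begin
            μ zero                       ≈⟨ +-identityʳ (μ zero) ⟨
            μ zero + 0#                  ≈⟨ +-congˡ (sum-zero μ⁺≈0) ⟨
            μ zero + sum (λ i → μ (suc i)) ≈⟨ ∑μ≈0 ⟩
            0#                           ∎
        ; (suc i) → μ⁺≈0 i }
        where
        μ⁺≈0 : ∀ i → μ (suc i) ≈ 0#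
        μ⁺≈0 = pts-independent (μ ∘ suc) λ e → begin
          sum (λ i → μ (suc i) * pts i e)               ≈⟨ +-identityˡ _ ⟨
          0# + sum (λ i → μ (suc i) * pts i e)          ≈⟨ +-congʳ (zeroʳ (μ zero)) ⟨
          μ zero * 0# + sum (λ i → μ (suc i) * pts i e) ≈⟨ combination≈0 e ⟩
          0#                                            ∎

-- Edges of the complete graph and their enumeration

-- The field `lo<hi` is irrelevant and can only be refuted by an absurd pattern, whence the
-- recursion on both endpoints.
lo≢hi : ∀ {n} (e : Edge n) → lo e ≢ hi e
lo≢hi (mkEdge zero    zero    ())
lo≢hi (mkEdge (suc i) (suc j) i<j) ≡.refl = lo≢hi (mkEdge i i (s<s⁻¹ i<j)) ≡.refl

joins? : ∀ {n} (e : Edge n) a b → Dec (e Joins a , b)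
joins? e a b = (lo e ≟ a ×-dec hi e ≟ b) ⊎-dec (lo e ≟ b ×-dec hi e ≟ a)

Joins-sym : ∀ {n} {e : Edge n} {a b} → e Joins a , b → e Joins b , a
Joins-sym = [ inj₂ , inj₁ ]′

Joins-self : ∀ {n} (e : Edge n) → e Joins lo e , hi e
Joins-self e = inj₁ (≡.refl , ≡.refl)

Joins-unique : ∀ {n} {e e′ : Edge n} {a b} → e Joins a , b → e′ Joins a , b → e ≡ e′
Joins-unique (inj₁ (≡.refl , ≡.refl)) (inj₁ (≡.refl , ≡.refl)) = ≡.refl
Joins-unique (inj₂ (≡.refl , ≡.refl)) (inj₂ (≡.refl , ≡.refl)) = ≡.refl
Joins-unique {e = mkEdge _ _ p} {mkEdge _ _ q} (inj₁ (≡.refl , ≡.refl)) (inj₂ (≡.refl , ≡.refl)) =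
  ⊥-elim-irr (Fin.<-asym p q)
Joins-unique {e = mkEdge _ _ p} {mkEdge _ _ q} (inj₂ (≡.refl , ≡.refl)) (inj₁ (≡.refl , ≡.refl)) =
  ⊥-elim-irr (Fin.<-asym p q)

joining : ∀ {n} {a b : Fin n} → a ≢ b → ∃[ e ] e Joins a , b
joining {a = a} {b} a≢b with <-cmp a b
... | tri< a<b _ _ = mkEdge a b a<b , inj₁ (≡.refl , ≡.refl)
... | tri≈ _ a≡b _ = contradiction a≡b a≢b
... | tri> _ _ b<a = mkEdge b a b<a , inj₂ (≡.refl , ≡.refl)

-- The binomial coefficient of n over 2, in the form obtained by splitting off the edges at vertex
-- `zero`.
edgeCount : ℕ → ℕ
edgeCount zero    = 0
edgeCount (suc n) = n ℕ.+ edgeCount n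

sucᴱ : ∀ {n} → Edge n → Edge (suc n)
sucᴱ (mkEdge i j i<j) = mkEdge (suc i) (suc j) (s<s i<j)

private
  step : ∀ {n m} → (Fin m → Edge n) → Fin n ⊎ Fin m → Edge (suc n)
  step enum = [ (λ j → mkEdge zero (suc j) z<s) , sucᴱ ∘ enum ]′

enumᴱ : ∀ n → Fin (edgeCount n) → Edge n
enumᴱ (suc n) k = step (enumᴱ n) (splitAt n k)

indexᴱ : ∀ n → Edge n → Fin (edgeCount n)
indexᴱ (suc n) (mkEdge zero    zero    ())
indexᴱ (suc n) (mkEdge zero    (suc j) _)  = j ↑ˡ edgeCount n
indexᴱ (suc n) (mkEdge (suc i) zero    ())
indexᴱ (suc n) (mkEdge (suc i) (suc j) p)  = n ↑ʳ indexᴱ n (mkEdge i j (s<s⁻¹ p))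

enum-indexᴱ : ∀ n e → enumᴱ n (indexᴱ n e) ≡ e
enum-indexᴱ (suc n) (mkEdge zero    zero    ())
enum-indexᴱ (suc n) (mkEdge zero    (suc j) p) =
  ≡.cong (step (enumᴱ n)) (splitAt-↑ˡ n j (edgeCount n))
enum-indexᴱ (suc n) (mkEdge (suc i) zero    ())
enum-indexᴱ (suc n) (mkEdge (suc i) (suc j) p) = ≡.trans
  (≡.cong (step (enumᴱ n)) (splitAt-↑ʳ n (edgeCount n) (indexᴱ n (mkEdge i j (s<s⁻¹ p)))))
  (≡.cong sucᴱ (enum-indexᴱ n (mkEdge i j (s<s⁻¹ p))))

index-enumᴱ : ∀ n k → indexᴱ n (enumᴱ n k) ≡ k
index-enumᴱ (suc n) k with splitAt n k | join-splitAt n (edgeCount n) k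
... | inj₁ j | eq = eq
... | inj₂ l | eq = ≡.trans (≡.cong (n ↑ʳ_) (index-enumᴱ n l)) eq

-- A global version of the local function behind `_⟨_⟩`, so that lemmas can refer to it. The value
-- type is arbitrary because the same triangle of entries is summed in the field and in ℕ.
upper : ∀ {a} {A : Set a} {n} → A → (Edge n → A) → (i j : Fin n) → Dec (i Fin.< j) → A
upper z g i j (yes i<j) = g (mkEdge i j i<j)
upper z g i j (no _)    = z

-- Linear forms on edge vectors

module EdgeForms {c ℓ₁ ℓ₂} (F : OrderedField c ℓ₁ ℓ₂) (n : ℕ) where
  open OrderedFieldProperties F
  open LinearForms F (Edge n)
  open Polytope F

  restrict : EdgeSet n → (Edge n → Carrier) → Edge n → Carrier
  restrict G x e = if G e then x e else 0#

  mutual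
    ⟨⟩-upper : ∀ x G → x ⟨ G ⟩ ≡ sum (λ i → sum (λ j → upper 0# (restrict G x) i j (i <? j)))
    ⟨⟩-upper x G = sum-cong-≗ λ i → sum-cong-≗ λ j → ⟨⟩-term x G i j

    -- The left-hand side is the local function of the definition of _⟨_⟩.
    ⟨⟩-term : ∀ x G i j → _ ≡ upper 0# (restrict G x) i j (i <? j)
    ⟨⟩-term x G i j with i <? j
    ... | yes _ = ≡.refl
    ... | no _  = ≡.refl

  restrict-linear : ∀ G e → IsLinear (λ x → restrict G x e)
  restrict-linear G e with G e
  ... | true  = coordinate-linear e
  ... | false = zero-linear

  upper-linear : ∀ G i j → IsLinear (λ x → upper 0# (restrict G x) i j (i <? j))
  upper-linear G i j with i <? j
  ... | yes i<j = restrict-linear G (mkEdge i j i<j)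
  ... | no _    = zero-linear

  ⟨⟩-linear : ∀ G → IsLinear (λ x → x ⟨ G ⟩)
  ⟨⟩-linear G = respects (λ x → reflexive (≡.sym (⟨⟩-upper x G)))
    (sum-linear λ i → sum-linear λ j → upper-linear G i j)

  dot : (Edge n → Carrier) → (Edge n → Carrier) → Carrier
  dot κ x = sum (λ j → κ (enumᴱ n j) * x (enumᴱ n j))

  dot-linear : ∀ κ → IsLinear (dot κ)
  dot-linear κ = sum-linear λ j → scale-linear (κ (enumᴱ n j)) (coordinate-linear (enumᴱ n j))

  -- The unit vector of the edge {a,b}, free of any choice of orientation; it is the zero vector
  -- when `a ≡ b`.
  ind : Fin n → Fin n → Edge n → Carrier
  ind a b e = if does (joins? e a b) then 1# else 0#

  ind-on : ∀ {a b e} → e Joins a , b → ind a b e ≈ 1#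
  ind-on {a} {b} {e} p = reflexive (≡.cong (if_then 1# else 0#) (dec-true (joins? e a b) p))

  ind-off : ∀ {a b e} → ¬ (e Joins a , b) → ind a b e ≈ 0#
  ind-off {a} {b} {e} ¬p = reflexive (≡.cong (if_then 1# else 0#) (dec-false (joins? e a b) ¬p))

  ind-sym : ∀ a b e → ind a b e ≈ ind b a e
  ind-sym a b e = by (joins? e a b)
    where
    by : Dec (e Joins a , b) → ind a b e ≈ ind b a e
    by (yes p) = trans (ind-on {e = e} p) (sym (ind-on {e = e} (Joins-sym {e = e} p)))
    by (no ¬p) = trans (ind-off {e = e} ¬p) (sym (ind-off {e = e} (¬p ∘ Joins-sym {e = e})))

  dot-ind : ∀ κ {e a b} → e Joins a , b → dot κ (ind a b) ≈ κ e
  dot-ind κ {e} {a} {b} p = trans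
    (sum-single _ (indexᴱ n e) λ j j≢ → trans
      (*-congˡ (ind-off {e = enumᴱ n j} λ q → j≢ (≡.trans (≡.sym (index-enumᴱ n j))
        (≡.cong (indexᴱ n) (Joins-unique {e = enumᴱ n j} q p)))))
      (zeroʳ _))
    (≡.subst (λ e′ → κ e′ * ind a b e′ ≈ κ e) (≡.sym (enum-indexᴱ n e))
      (trans (*-congˡ (ind-on {e = e} p)) (*-identityʳ (κ e))))

  ⟨⟩-ind : ∀ G {e a b} → e Joins a , b → ind a b ⟨ G ⟩ ≈ (if G e then 1# else 0#)
  ⟨⟩-ind G {e} {a} {b} p = trans (reflexive (⟨⟩-upper (ind a b) G)) (trans
    (sum-single _ (lo e) λ i i≢ → sum-zero λ j → off i j (i≢ ∘ proj₁))
    (trans (sum-single _ (hi e) λ j j≢ → off (lo e) j (j≢ ∘ proj₂)) (on e p)))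
    where
    off : ∀ i j → ¬ (i ≡ lo e × j ≡ hi e) → upper 0# (restrict G (ind a b)) i j (i <? j) ≈ 0#
    off i j ≢e with i <? j
    ... | no _ = refl
    ... | yes i<j with G (mkEdge i j i<j)
    ...   | false = refl
    ...   | true  = ind-off {e = mkEdge i j i<j} λ q → ≢e (ends (Joins-unique {e = mkEdge i j i<j} {e} q p))
      where
      ends : ∀ {e′ : Edge n} → e′ ≡ e → lo e′ ≡ lo e × hi e′ ≡ hi e
      ends ≡.refl = ≡.refl , ≡.refl

    on : ∀ e → e Joins a , b →
         upper 0# (restrict G (ind a b)) (lo e) (hi e) (lo e <? hi e) ≈ (if G e then 1# else 0#)
    on e@(mkEdge i j i<j) p with i <? j
    ... | no i≮j = ⊥-elim-irr (i≮j i<j)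
    ... | yes _ with G e
    ...   | true  = ind-on {e = e} p
    ...   | false = refl

-- Edge sets, bridges and leaves

T-does⁻ : ∀ {a} {A : Set a} (a? : Dec A) → T (does a?) → A
T-does⁻ (yes a) _ = a

T-does⁺ : ∀ {a} {A : Set a} (a? : Dec A) → A → T (does a?)
T-does⁺ (yes _) _ = _
T-does⁺ (no ¬a) a = ¬a a

_≟ᴱ_ : ∀ {n} (e e′ : Edge n) → Dec (e ≡ e′)
e ≟ᴱ e′ with joins? e (lo e′) (hi e′)
... | yes p = yes (Joins-unique {e = e} {e′} p (Joins-self e′))
... | no ¬p = no λ { ≡.refl → ¬p (Joins-self e) }

Joins-ends : ∀ {n} {e : Edge n} {a b u w : Fin n} → e Joins a , b → e Joins u , w →
             (u ≡ a × w ≡ b) ⊎ (u ≡ b × w ≡ a)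
Joins-ends (inj₁ (≡.refl , ≡.refl)) (inj₁ (≡.refl , ≡.refl)) = inj₁ (≡.refl , ≡.refl)
Joins-ends (inj₁ (≡.refl , ≡.refl)) (inj₂ (≡.refl , ≡.refl)) = inj₂ (≡.refl , ≡.refl)
Joins-ends (inj₂ (≡.refl , ≡.refl)) (inj₁ (≡.refl , ≡.refl)) = inj₂ (≡.refl , ≡.refl)
Joins-ends (inj₂ (≡.refl , ≡.refl)) (inj₂ (≡.refl , ≡.refl)) = inj₁ (≡.refl , ≡.refl)

-- If the vertices stay mutually reachable after a deletion, all component labels agree, so there is
-- at most one component afterwards. There was at least one before, since an endpoint of the deleted
-- edge carries a label; the number cannot have grown.
robust⇒2-edge-connected : ∀ {n} (H : Subgraph n) → Connected H →
  (∀ e {u w} → u Subset.∈ vertices H → w Subset.∈ vertices H → Reachable (deleteEdge H e) u w) →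
  TwoEdgeConnected H
robust⇒2-edge-connected H connected robust = connected , λ
  { e (e∈H , k , k′ , (label , _ , _) , components′ , k<k′) →
      no-bridge e k k′ (label (lo e) (proj₁ (endpoints H {e} e∈H))) components′ k<k′ }
  where
  no-bridge : ∀ e k k′ → Fin k → HasComponents (deleteEdge H e) k′ → ¬ (k ℕ.< k′)
  no-bridge e (suc k) (suc (suc k′)) _ (label , onto , equiv) _
    with onto zero | onto (suc zero)
  ... | u , u∈H , lu≡0 | w , w∈H , lw≡1
    with () ← ≡.trans (≡.sym lu≡0)
                (≡.trans (Equivalence.from (equiv u∈H w∈H) (robust e u∈H w∈H)) lw≡1)
  no-bridge e (suc k) (suc zero) _ _ (s≤s ())

false⇒¬T : ∀ {b} → b ≡ false → ¬ T b
false⇒¬T ≡.refl ()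

T⇒true : ∀ {b} → T b → b ≡ true
T⇒true {true} _ = ≡.refl

¬T⇒false : ∀ {b} → ¬ T b → b ≡ false
¬T⇒false {true}  ¬t = contradiction _ ¬t
¬T⇒false {false} _  = ≡.refl

∈δ : ∀ {n} {v : Fin n} {e a b} → e Joins a , b → v ≡ a ⊎ v ≡ b → T (δ v e)
∈δ {v = v} {e} (inj₁ (≡.refl , ≡.refl)) (inj₁ ≡.refl) = T-does⁺ ((lo e ≟ v) ⊎-dec (hi e ≟ v)) (inj₁ ≡.refl)
∈δ {v = v} {e} (inj₁ (≡.refl , ≡.refl)) (inj₂ ≡.refl) = T-does⁺ ((lo e ≟ v) ⊎-dec (hi e ≟ v)) (inj₂ ≡.refl)
∈δ {v = v} {e} (inj₂ (≡.refl , ≡.refl)) (inj₁ ≡.refl) = T-does⁺ ((lo e ≟ v) ⊎-dec (hi e ≟ v)) (inj₂ ≡.refl)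
∈δ {v = v} {e} (inj₂ (≡.refl , ≡.refl)) (inj₂ ≡.refl) = T-does⁺ ((lo e ≟ v) ⊎-dec (hi e ≟ v)) (inj₁ ≡.refl)

δ⁻ : ∀ {n} {v : Fin n} {e a b} → e Joins a , b → T (δ v e) → v ≡ a ⊎ v ≡ b
δ⁻ {v = v} {e} p t with T-does⁻ ((lo e ≟ v) ⊎-dec (hi e ≟ v)) t
δ⁻ (inj₁ (≡.refl , ≡.refl)) t | inj₁ ≡.refl = inj₁ ≡.refl
δ⁻ (inj₁ (≡.refl , ≡.refl)) t | inj₂ ≡.refl = inj₂ ≡.refl
δ⁻ (inj₂ (≡.refl , ≡.refl)) t | inj₁ ≡.refl = inj₂ ≡.refl
δ⁻ (inj₂ (≡.refl , ≡.refl)) t | inj₂ ≡.refl = inj₁ ≡.refl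

⁅⁆⁻ : ∀ {n} (e e′ : Edge n) → T (⁅ e ⁆ᴱ e′) → e ≡ e′
⁅⁆⁻ e e′ t with T-does⁻ ((lo e ≟ lo e′) ×-dec (hi e ≟ hi e′)) t
... | ≡.refl , ≡.refl = ≡.refl

⁅⁆⁺ : ∀ {n} (e : Edge n) → T (⁅ e ⁆ᴱ e)
⁅⁆⁺ e = T-does⁺ ((lo e ≟ lo e) ×-dec (hi e ≟ hi e)) (≡.refl , ≡.refl)

∈E[K-] : ∀ {n} {v : Fin n} {e u w} → e Joins u , w → u ≢ v → w ≢ v → T (E[K- v ] e)
∈E[K-] {e = e} p u≢v w≢v =
  ≡.subst (T ∘ not) (≡.sym (¬T⇒false ([ u≢v ∘ ≡.sym , w≢v ∘ ≡.sym ]′ ∘ δ⁻ {e = e} p))) _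

E[K-]⁻ : ∀ {n} {v : Fin n} {e} → T (E[K- v ] e) → ¬ T (δ v e)
E[K-]⁻ {v = v} {e} t with δ v e
... | false = id

∖⁺ : ∀ {n} {G : EdgeSet n} {e e′} → T (G e′) → e′ ≢ e → T ((G ∖ ⁅ e ⁆ᴱ) e′)
∖⁺ {e = e} {e′} t e′≢e = Equivalence.from T-∧
  (t , ≡.subst (T ∘ not) (≡.sym (¬T⇒false (e′≢e ∘ ≡.sym ∘ ⁅⁆⁻ e e′))) _)

∖⁻ : ∀ {n} {G : EdgeSet n} {e e′} → T ((G ∖ ⁅ e ⁆ᴱ) e′) → T (G e′) × e′ ≢ e
∖⁻ {e = e} t with Equivalence.to T-∧ t
... | t₁ , t₂ = t₁ , λ { ≡.refl → false⇒¬T (≡.cong not (T⇒true (⁅⁆⁺ e))) t₂ }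

Joins⇒≢ : ∀ {n} {e : Edge n} {a b} → e Joins a , b → a ≢ b
Joins⇒≢ {e = e} (inj₁ (p , q)) ≡.refl = lo≢hi e (≡.trans p (≡.sym q))
Joins⇒≢ {e = e} (inj₂ (p , q)) ≡.refl = lo≢hi e (≡.trans p (≡.sym q))

-- Deleting the only edge at `u` splits off {u} and leaves the other vertices connected, so one
-- component becomes exactly two and the edge is a bridge.
no-leaf : ∀ {n} (H : Subgraph n) → TwoEdgeConnected H → ∀ {e u w} → e ∈ᴱ edges H → e Joins u , w →
          ¬ (∀ {e′ w′} → e′ ∈ᴱ edges H → e′ Joins u , w′ → e′ ≡ e)
no-leaf {n} H (connected , no-bridge) {e} {u} {w} e∈H e-uw leaf =
  no-bridge e (e∈H , 1 , 2 , one , two , s≤s (s≤s z≤n))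
  where
  u≢w : u ≢ w
  u≢w = Joins⇒≢ {e = e} e-uw

  ends∈H : ∀ {a b} → e Joins a , b → a Subset.∈ vertices H × b Subset.∈ vertices H
  ends∈H (inj₁ (≡.refl , ≡.refl)) = endpoints H {e} e∈H
  ends∈H (inj₂ (≡.refl , ≡.refl)) = let (l , h) = endpoints H {e} e∈H in h , l

  u∈H = proj₁ (ends∈H e-uw)
  w∈H = proj₂ (ends∈H e-uw)

  one : HasComponents H 1
  one = (λ _ _ → zero) , (λ { zero → u , u∈H , ≡.refl }) ,
        λ u∈ w∈ → mk⇔ (λ _ → connected u∈ w∈) (λ _ → ≡.refl)

  H-e = deleteEdge H e

  survives : ∀ {e′} → e′ ∈ᴱ edges H → e′ ≢ e → e′ ∈ᴱ edges H-e
  survives {e′} e′∈H e′≢e = Equivalence.from T-∧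
    (e′∈H , ≡.subst (T ∘ not) (≡.sym (¬T⇒false (e′≢e ∘ ≡.sym ∘ ⁅⁆⁻ e e′))) _)

  misses-u : ∀ {a b} → Adjacent H-e a b → a ≢ u × b ≢ u
  misses-u {a} {b} (e′ , e′∈ , p) = (λ { ≡.refl → is-e (leaf e′∈H p) }) ,
    (λ { ≡.refl → is-e (leaf e′∈H (Joins-sym {e = e′} p)) })
    where
    both = Equivalence.to T-∧ e′∈
    e′∈H = proj₁ both
    is-e : ¬ (e′ ≡ e)
    is-e ≡.refl = false⇒¬T (≡.cong not (T⇒true (⁅⁆⁺ e))) (proj₂ both)

  side : Fin n → Fin 2
  side a = if does (a ≟ u) then zero else suc zero

  side-u : side u ≡ zero
  side-u = ≡.cong (if_then zero else suc zero) (dec-true (u ≟ u) ≡.refl)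

  side-≢u : ∀ {a} → a ≢ u → side a ≡ suc zero
  side-≢u {a} a≢u = ≡.cong (if_then zero else suc zero) (dec-false (a ≟ u) a≢u)

  side-invariant : ∀ {a b} → Reachable H-e a b → side a ≡ side b
  side-invariant ε = ≡.refl
  side-invariant (s ◅ r) with misses-u s
  ... | a≢u , b≢u = ≡.trans (side-≢u a≢u) (≡.trans (≡.sym (side-≢u b≢u)) (side-invariant r))

  -- Contracts `e` onto `w`, turning walks of H into walks of H - e: the step along `e` collapses,
  -- and every other step avoids `u` and is kept.
  retract : Fin n → Fin n
  retract a with a ≟ u
  ... | yes _ = w
  ... | no _  = a

  retract-u : retract u ≡ w
  retract-u with u ≟ u
  ... | yes _  = ≡.refl
  ... | no u≢u = contradiction ≡.refl u≢u

  retract-≢u : ∀ {a} → a ≢ u → retract a ≡ a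
  retract-≢u {a} a≢u with a ≟ u
  ... | yes a≡u = contradiction a≡u a≢u
  ... | no _    = ≡.refl

  retracted : ∀ {a b} → Reachable H a b → Reachable H-e (retract a) (retract b)
  retracted ε = ε
  retracted {a} ((e′ , e′∈H , p) ◅ r) with e′ ≟ᴱ e
  ... | yes ≡.refl = ≡.subst (λ z → Reachable H-e z _) (≡.sym (same (Joins-ends {e = e} e-uw p))) (retracted r)
    where
    same : ∀ {a b} → (a ≡ u × b ≡ w) ⊎ (a ≡ w × b ≡ u) → retract a ≡ retract b
    same (inj₁ (≡.refl , ≡.refl)) = ≡.trans retract-u (≡.sym (retract-≢u (u≢w ∘ ≡.sym)))
    same (inj₂ (≡.refl , ≡.refl)) = ≡.trans (retract-≢u (u≢w ∘ ≡.sym)) (≡.sym retract-u)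
  ... | no e′≢e with step ← (e′ , survives {e′} e′∈H e′≢e , p) with a≢u , b≢u ← misses-u step =
    ≡.subst₂ (Adjacent H-e) (≡.sym (retract-≢u a≢u)) (≡.sym (retract-≢u b≢u)) step ◅ retracted r

  side⇒reachable : ∀ {a b} → a Subset.∈ vertices H → b Subset.∈ vertices H → side a ≡ side b → Reachable H-e a b
  side⇒reachable {a} {b} a∈ b∈ eq = by (a ≟ u) (b ≟ u)
    where
    by : Dec (a ≡ u) → Dec (b ≡ u) → Reachable H-e a b
    by (yes ≡.refl) (yes ≡.refl) = ε
    by (yes ≡.refl) (no b≢u) with () ← ≡.trans (≡.sym side-u) (≡.trans eq (side-≢u b≢u))
    by (no a≢u) (yes ≡.refl) with () ← ≡.trans (≡.sym (side-≢u a≢u)) (≡.trans eq side-u)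
    by (no a≢u) (no b≢u) = ≡.subst₂ (Reachable H-e) (retract-≢u a≢u) (retract-≢u b≢u)
      (retracted (connected a∈ b∈))

  two : HasComponents H-e 2
  two = (λ a _ → side a) ,
        (λ { zero → u , u∈H , side-u ; (suc zero) → w , w∈H , side-≢u (u≢w ∘ ≡.sym) }) ,
        λ a∈ b∈ → mk⇔ (side⇒reachable a∈ b∈) side-invariant

-- Validity of the inequalities by counting degrees

module DegreeCounts where
  open import Data.Nat.Base using (_+_; _*_; _≤_)
  open import Relation.Binary.PropositionalEquality using (cong; cong₂)
  open SemiringSum ℕ.+-*-semiring using (sum; sum-cong-≗; ∑-distrib-+; ∑-comm; *-distribˡ-sum)
  open SumSupport ℕ.+-0-commutativeMonoid using (sum-single)

  sum-mono : ∀ {m} {s t : Fin m → ℕ} → (∀ i → s i ≤ t i) → sum s ≤ sum t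
  sum-mono {zero}  s≤t = z≤n
  sum-mono {suc m} s≤t = ℕ.+-mono-≤ (s≤t zero) (sum-mono (s≤t ∘ suc))

  term≤sum : ∀ {m} (t : Fin m → ℕ) i → t i ≤ sum t
  term≤sum t zero    = ℕ.m≤m+n _ _
  term≤sum t (suc i) = ℕ.≤-trans (term≤sum (t ∘ suc) i) (ℕ.m≤n+m _ _)

  sum-ones : ∀ m → sum {m} (λ _ → 1) ≡ m
  sum-ones zero    = ≡.refl
  sum-ones (suc m) = cong suc (sum-ones m)

  module Degrees {n : ℕ} (g : Edge n → ℕ) where

    entry : Fin n → Fin n → ℕ
    entry i j = upper 0 g i j (i <? j)

    total : ℕ
    total = sum (λ i → sum (λ j → entry i j))

    -- At most one of the two summands is nonzero: this is the symmetric matrix whose upper half is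
    -- `entry`.
    joint : Fin n → Fin n → ℕ
    joint i j = entry i j + entry j i

    deg : Fin n → ℕ
    deg u = sum (joint u)

    entry-edge : ∀ (e : Edge n) → entry (lo e) (hi e) ≡ g e
    entry-edge (mkEdge i j i<j) with i <? j
    ... | yes _  = ≡.refl
    ... | no i≮j = ⊥-elim-irr (i≮j i<j)

    entry-reverse : ∀ (e : Edge n) → entry (hi e) (lo e) ≡ 0
    entry-reverse (mkEdge i j i<j) with j <? i
    ... | yes j<i = ⊥-elim-irr (Fin.<-asym i<j j<i)
    ... | no _    = ≡.refl

    joint-edge : ∀ {e a b} → e Joins a , b → joint a b ≡ g e
    joint-edge {e} (inj₁ (≡.refl , ≡.refl)) =
      ≡.trans (cong₂ _+_ (entry-edge e) (entry-reverse e)) (ℕ.+-identityʳ _)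
    joint-edge {e} (inj₂ (≡.refl , ≡.refl)) = cong₂ _+_ (entry-reverse e) (entry-edge e)

    entry-self : ∀ a → entry a a ≡ 0
    entry-self a with a <? a
    ... | yes a<a = contradiction a<a (λ p → Fin.<-asym p p)
    ... | no _    = ≡.refl

    joint-off : ∀ {a b} → (∀ {e} → e Joins a , b → g e ≡ 0) → joint a b ≡ 0
    joint-off {a} {b} g≡0 with a ≟ b
    ... | yes ≡.refl = cong₂ _+_ (entry-self a) (entry-self a)
    ... | no a≢b with joining a≢b
    ...   | e , p = ≡.trans (joint-edge {e} p) (g≡0 {e} p)

    deg-single : ∀ {e u v} → e Joins u , v → (∀ {e′ w} → e′ Joins u , w → w ≢ v → g e′ ≡ 0) →
                 deg u ≡ g e
    deg-single {e} {u} {v} p g≡0 =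
      ≡.trans (sum-single (joint u) v λ w w≢v → joint-off (λ {e′} q → g≡0 {e′} q w≢v)) (joint-edge {e} p)

    deg≡0⇒ : ∀ {e u w} → deg u ≡ 0 → e Joins u , w → g e ≡ 0
    deg≡0⇒ {e} {u} {w} deg≡0 p = ≡.trans (≡.sym (joint-edge {e} p))
      (ℕ.n≤0⇒n≡0 (≡.subst (joint u w ≤_) deg≡0 (term≤sum (joint u) w)))

    -- Double counting: the edge {i,j} is met with factor `κ i` at i and with factor `κ j` at j.
    -- Exchanging the order of summation moves the lower half of the matrix onto the upper one.
    handshake : ∀ (κ : Fin n → ℕ) →
      sum (λ u → κ u * deg u) ≡ sum (λ i → sum (λ j → (κ i + κ j) * entry i j))
    handshake κ = begin
      sum (λ u → κ u * deg u)
        ≡⟨ sum-cong-≗ (λ u → *-distribˡ-sum (κ u) (joint u)) ⟩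
      sum (λ u → sum (λ w → κ u * joint u w))
        ≡⟨ sum-cong-≗ (λ u → sum-cong-≗ (λ w → ℕ.*-distribˡ-+ (κ u) (entry u w) (entry w u))) ⟩
      sum (λ u → sum (λ w → κ u * entry u w + κ u * entry w u))
        ≡⟨ sum-cong-≗ (λ u → ∑-distrib-+ (λ w → κ u * entry u w) (λ w → κ u * entry w u)) ⟩
      sum (λ u → sum (λ w → κ u * entry u w) + sum (λ w → κ u * entry w u))
        ≡⟨ ∑-distrib-+ (λ u → sum (λ w → κ u * entry u w)) (λ u → sum (λ w → κ u * entry w u)) ⟩
      sum (λ u → sum (λ w → κ u * entry u w)) + sum (λ u → sum (λ w → κ u * entry w u))
        ≡⟨ cong (sum (λ u → sum (λ w → κ u * entry u w)) +_) (∑-comm (λ u w → κ u * entry w u)) ⟩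
      sum (λ i → sum (λ j → κ i * entry i j)) + sum (λ i → sum (λ j → κ j * entry i j))
        ≡⟨ ∑-distrib-+ (λ i → sum (λ j → κ i * entry i j)) (λ i → sum (λ j → κ j * entry i j)) ⟨
      sum (λ i → sum (λ j → κ i * entry i j) + sum (λ j → κ j * entry i j))
        ≡⟨ sum-cong-≗ (λ i → ∑-distrib-+ (λ j → κ i * entry i j) (λ j → κ j * entry i j)) ⟨
      sum (λ i → sum (λ j → κ i * entry i j + κ j * entry i j))
        ≡⟨ sum-cong-≗ (λ i → sum-cong-≗ (λ j → ℕ.*-distribʳ-+ (entry i j) (κ i) (κ j))) ⟨
      sum (λ i → sum (λ j → (κ i + κ j) * entry i j)) ∎
      where open ≡.≡-Reasoning

    handshake-const : ∀ (κ : Fin n → ℕ) c → (∀ e → (κ (lo e) + κ (hi e)) * g e ≡ c * g e) →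
                      sum (λ u → κ u * deg u) ≡ c * total
    handshake-const κ c eq = begin
      sum (λ u → κ u * deg u)
        ≡⟨ handshake κ ⟩
      sum (λ i → sum (λ j → (κ i + κ j) * entry i j))
        ≡⟨ sum-cong-≗ (λ i → sum-cong-≗ (λ j → at i j)) ⟩
      sum (λ i → sum (λ j → c * entry i j))
        ≡⟨ sum-cong-≗ (λ i → *-distribˡ-sum c (λ j → entry i j)) ⟨
      sum (λ i → c * sum (λ j → entry i j))
        ≡⟨ *-distribˡ-sum c (λ i → sum (λ j → entry i j)) ⟨
      c * total ∎
      where
      open ≡.≡-Reasoning
      at : ∀ i j → (κ i + κ j) * entry i j ≡ c * entry i j
      at i j with i <? j
      ... | yes i<j = eq (mkEdge i j i<j)
      ... | no _    = ≡.trans (ℕ.*-zeroʳ (κ i + κ j)) (≡.sym (ℕ.*-zeroʳ c))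

  -- This is where parity acts: between two even numbers the odd slack 1 + 2k is worth only 2k.
  halve-≤ : ∀ a b k → 2 * a ≤ 2 * b + (1 + k * 2) → a ≤ b + k
  halve-≤ a b k 2a≤ = ℕ.≮⇒≥ λ b+k<a → ℕ.<⇒≱ (ℕ.n<1+n (2 * b + (1 + k * 2))) (begin
    suc (2 * b + (1 + k * 2)) ≡⟨ solve 2 (λ b k → con 1 :+ (con 2 :* b :+ (con 1 :+ k :* con 2))
                                           := con 2 :* (con 1 :+ (b :+ k))) ≡.refl b k ⟩
    2 * suc (b + k)           ≤⟨ ℕ.*-monoʳ-≤ 2 b+k<a ⟩
    2 * a                     ≤⟨ 2a≤ ⟩
    2 * b + (1 + k * 2)       ∎)
    where
    open ℕ.≤-Reasoning
    open +-*-Solver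

  module _ {n : ℕ} where

    -- Indicators of a vertex and of its complement, with values in ℕ so that leaving out a vertex
    -- from a sum needs no subtraction.
    ι ν : Fin n → Fin n → ℕ
    ι x u = if does (u ≟ x) then 1 else 0
    ν x u = if does (u ≟ x) then 0 else 1

    ι-self : ∀ x → ι x x ≡ 1
    ι-self x = cong (if_then 1 else 0) (dec-true (x ≟ x) ≡.refl)

    ι-≢ : ∀ {x u} → u ≢ x → ι x u ≡ 0
    ι-≢ {x} {u} u≢x = cong (if_then 1 else 0) (dec-false (u ≟ x) u≢x)

    ν-self : ∀ x → ν x x ≡ 0
    ν-self x = cong (if_then 0 else 1) (dec-true (x ≟ x) ≡.refl)

    ν-≢ : ∀ {x u} → u ≢ x → ν x u ≡ 1
    ν-≢ {x} {u} u≢x = cong (if_then 0 else 1) (dec-false (u ≟ x) u≢x)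

    ι+ν : ∀ x u → ι x u + ν x u ≡ 1
    ι+ν x u with does (u ≟ x)
    ... | true  = ≡.refl
    ... | false = ≡.refl

    sum-ι : ∀ x → sum (ι x) ≡ 1
    sum-ι x = ≡.trans (sum-single (ι x) x (λ _ → ι-≢)) (ι-self x)

  module Count {n : ℕ} (H : Subgraph n) where

    count : EdgeSet n → Edge n → ℕ
    count G e = if G e then (if edges H e then 1 else 0) else 0

    count-∈ : ∀ {G e} → T (G e) → e ∈ᴱ edges H → count G e ≡ 1
    count-∈ {G} {e} e∈G e∈H with true ← G e with true ← edges H e = ≡.refl

    count-∉ : ∀ {G e} → ¬ T (G e) → count G e ≡ 0
    count-∉ {G} {e} e∉G with G e
    ... | true  = contradiction _ e∉G
    ... | false = ≡.refl

    count-absent : ∀ {G e} → ¬ (e ∈ᴱ edges H) → count G e ≡ 0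
    count-absent {G} {e} e∉H with G e | edges H e
    ... | true  | true  = contradiction _ e∉H
    ... | true  | false = ≡.refl
    ... | false | _     = ≡.refl

    count≤1 : ∀ G e → count G e ≤ 1
    count≤1 G e with G e | edges H e
    ... | true  | true  = s≤s z≤n
    ... | true  | false = z≤n
    ... | false | _     = z≤n

    #_ : EdgeSet n → ℕ
    # G = Degrees.total (count G)

    degree : EdgeSet n → Fin n → ℕ
    degree G = Degrees.deg (count G)

    module Around (v : Fin n) where

      S : (Fin n → ℕ) → ℕ
      S X = sum (λ u → ν v u * X u)

      S-mono : ∀ {X Y} → (∀ u → u ≢ v → X u ≤ Y u) → S X ≤ S Y
      S-mono {X} {Y} X≤Y = sum-mono at
        where
        at : ∀ u → ν v u * X u ≤ ν v u * Y u
        at u with u ≟ v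
        ... | yes _  = z≤n
        ... | no u≢v = ℕ.*-monoʳ-≤ 1 (X≤Y u u≢v)

      S-+ : ∀ X Y → S (λ u → X u + Y u) ≡ S X + S Y
      S-+ X Y = ≡.trans (sum-cong-≗ λ u → ℕ.*-distribˡ-+ (ν v u) (X u) (Y u))
                  (∑-distrib-+ (λ u → ν v u * X u) (λ u → ν v u * Y u))

      S-* : ∀ c X → S (λ u → c * X u) ≡ c * S X
      S-* c X = ≡.trans (sum-cong-≗ λ u → exchange (ν v u) (X u)) (≡.sym (*-distribˡ-sum c (λ u → ν v u * X u)))
        where
        open +-*-Solver
        exchange : ∀ a b → a * (c * b) ≡ c * (a * b)
        exchange a b = solve 3 (λ a b c → a :* (c :* b) := c :* (a :* b)) ≡.refl a b c

      S-1 : 1 + S (λ _ → 1) ≡ n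
      S-1 = ≡.trans (cong₂ _+_ (≡.sym (sum-ι v)) (sum-cong-≗ λ u → ℕ.*-identityʳ (ν v u)))
        (≡.trans (≡.sym (∑-distrib-+ (ι v) (ν v))) (≡.trans (sum-cong-≗ (ι+ν v)) (sum-ones n)))

      S-ι : ∀ {x} → x ≢ v → S (ι x) ≡ 1
      S-ι {x} x≢v = ≡.trans
        (sum-single (λ u → ν v u * ι x u) x λ u u≢x → ≡.trans (cong (ν v u *_) (ι-≢ u≢x)) (ℕ.*-zeroʳ (ν v u)))
        (cong₂ _*_ (ν-≢ x≢v) (ι-self x))

      S-ν : ∀ {x} → x ≢ v → 2 + S (ν x) ≡ n
      S-ν {x} x≢v = ≡.trans (cong suc (≡.trans (cong (_+ S (ν x)) (≡.sym (S-ι x≢v)))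
        (≡.trans (≡.sym (S-+ (ι x) (ν x))) (sum-cong-≗ λ u → cong (ν v u *_) (ι+ν x u))))) S-1

      -- An edge at `v` has exactly one end other than `v`.
      S-star : ∀ {A} → (∀ e → T (A e) → T (δ v e)) → S (degree A) ≡ # A
      S-star {A} A⊆δ = ≡.trans (Degrees.handshake-const (count A) (ν v) 1 at) (ℕ.*-identityˡ _)
        where
        at : ∀ e → (ν v (lo e) + ν v (hi e)) * count A e ≡ 1 * count A e
        at e with T? (A e)
        ... | no e∉A = ≡.trans (cong ((ν v (lo e) + ν v (hi e)) *_) (count-∉ {A} e∉A))
                         (≡.trans (ℕ.*-zeroʳ (ν v (lo e) + ν v (hi e))) (cong (1 *_) (≡.sym (count-∉ {A} e∉A))))
        ... | yes e∈A with δ⁻ {e = e} (Joins-self e) (A⊆δ e e∈A)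
        ...   | inj₁ ≡.refl = cong (_* count A e) (cong₂ _+_ (ν-self v) (ν-≢ (lo≢hi e ∘ ≡.sym)))
        ...   | inj₂ ≡.refl = cong (_* count A e) (cong₂ _+_ (ν-≢ (lo≢hi e)) (ν-self v))

      -- An edge off `v` is counted at both of its ends.
      S-rim : ∀ {B} → (∀ e → T (B e) → ¬ T (δ v e)) → S (degree B) ≡ 2 * # B
      S-rim {B} B∩δ≡∅ = Degrees.handshake-const (count B) (ν v) 2 at
        where
        at : ∀ e → (ν v (lo e) + ν v (hi e)) * count B e ≡ 2 * count B e
        at e with T? (B e)
        ... | no e∉B = ≡.trans (cong ((ν v (lo e) + ν v (hi e)) *_) (count-∉ {B} e∉B))
                         (≡.trans (ℕ.*-zeroʳ (ν v (lo e) + ν v (hi e))) (cong (2 *_) (≡.sym (count-∉ {B} e∉B))))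
        ... | yes e∈B = cong (_* count B e) (cong₂ _+_
                (ν-≢ λ lo≡v → B∩δ≡∅ e e∈B (∈δ {e = e} (Joins-self e) (inj₁ (≡.sym lo≡v))))
                (ν-≢ λ hi≡v → B∩δ≡∅ e e∈B (∈δ {e = e} (Joins-self e) (inj₂ (≡.sym hi≡v)))))

      degree-star : ∀ {A e u} → (∀ e → T (A e) → T (δ v e)) → u ≢ v → e Joins u , v → degree A u ≡ count A e
      degree-star {A} A⊆δ u≢v p = Degrees.deg-single (count A) p λ {e′} q w≢v →
        count-∉ {A} λ e′∈A → [ u≢v ∘ ≡.sym , w≢v ∘ ≡.sym ]′ (δ⁻ {e = e′} q (A⊆δ e′ e′∈A))

    -- If no edge of `B` were present at `u`, then `e` would be the only edge of H there. Validity
    -- draws on 2-edge-connectedness only through this lemma.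
    degree-pos : TwoEdgeConnected H → ∀ {B e u w} → e ∈ᴱ edges H → e Joins u , w →
      (∀ {e′ w′} → e′ ∈ᴱ edges H → e′ Joins u , w′ → e′ ≢ e → T (B e′)) → 1 ≤ degree B u
    degree-pos 2ec {B} {e} {u} e∈H p others with degree B u in eq
    ... | suc _ = s≤s z≤n
    ... | zero  = ⊥-elim (no-leaf H 2ec {e} e∈H p (λ {e′} → leaf {e′}))
      where
      leaf : ∀ {e′ w′} → e′ ∈ᴱ edges H → e′ Joins u , w′ → e′ ≡ e
      leaf {e′} e′∈H q with e′ ≟ᴱ e
      ... | yes e′≡e = e′≡e
      ... | no e′≢e with () ← ≡.trans (≡.sym (count-∈ {B} {e′} (others {e′} e′∈H q e′≢e) e′∈H))
                                (Degrees.deg≡0⇒ (count B) {e′} eq q)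

  even-bound : ∀ {n} (H : Subgraph n) → TwoEdgeConnected H → ∀ k → n ≡ 2 + k * 2 → ∀ v →
               let open Count H in # δ v ≤ # E[K- v ] + k
  -- The term 1 is spent once at each of the n - 1 = 1 + 2k vertices other than `v`.
  even-bound {n} H 2ec k n≡ v = halve-≤ (# A) (# B) k (begin
    2 * # A                        ≡⟨ cong (2 *_) (S-star (λ _ → id)) ⟨
    2 * S (degree A)               ≡⟨ S-* 2 (degree A) ⟨
    S (λ u → 2 * degree A u)       ≤⟨ S-mono bound ⟩
    S (λ u → degree B u + 1)       ≡⟨ S-+ (degree B) (λ _ → 1) ⟩
    S (degree B) + S (λ _ → 1)     ≡⟨ cong₂ _+_ (S-rim (λ e → E[K-]⁻ {v = v} {e})) (ℕ.suc-injective (≡.trans S-1 n≡)) ⟩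
    2 * # B + (1 + k * 2)          ∎)
    where
    open Count H
    open Around v
    open ℕ.≤-Reasoning
    A = δ v
    B = E[K- v ]

    bound : ∀ u → u ≢ v → 2 * degree A u ≤ degree B u + 1
    bound u u≢v with joining u≢v
    ... | e , p = ≡.subst (λ d → 2 * d ≤ degree B u + 1) (≡.sym (degree-star {A} {e} (λ _ → id) u≢v p)) by
      where
      by : 2 * count A e ≤ degree B u + 1
      by with T? (edges H e)
      ... | no e∉H = ≡.subst (λ c → 2 * c ≤ degree B u + 1) (≡.sym (count-absent {A} {e} e∉H)) z≤n
      ... | yes e∈H = ℕ.≤-trans (ℕ.*-monoʳ-≤ 2 (count≤1 A e)) (ℕ.+-monoˡ-≤ 1
        (degree-pos 2ec {B} {e} e∈H p λ {e′} _ q e′≢e →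
          ∈E[K-] {v = v} {e′} q u≢v λ { ≡.refl → e′≢e (Joins-unique {e = e′} {e} q p) }))

  -- The edge `h` is not counted in `B`, so when it is present `w₂` may exceed its local bound by 1,
  -- while `w₁` has a unit to spare. Adding `η` on the left at `w₁` and on the right at `w₂` makes
  -- the bound hold vertex by vertex, and `η` cancels in the sum. No constant 1 is granted to `w₁`,
  -- so n - 2 = 1 + 2k of them remain.
  odd-bound : ∀ {n} (H : Subgraph n) → TwoEdgeConnected H → ∀ k → n ≡ 3 + k * 2 → ∀ v {w₁ w₂} (h f : Edge n) →
    w₁ ≢ v → w₂ ≢ v → h Joins w₁ , w₂ → f Joins v , w₁ →
    let open Count H in # (δ v ∖ ⁅ f ⁆ᴱ) ≤ # (E[K- v ] ∖ ⁅ h ⁆ᴱ) + (if edges H f then 1 else 0) + k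
  odd-bound {n} H 2ec k n≡ v {w₁} {w₂} h f w₁≢v w₂≢v h-w₁w₂ f-vw₁ =
    halve-≤ (# A) (# B + φ) k (ℕ.+-cancelʳ-≤ η _ _ (begin
      2 * # A + η
        ≡⟨ cong₂ _+_ (≡.trans (S-* 2 (degree A)) (cong (2 *_) (S-star A⊆δ)))
             (≡.trans (S-* η (ι w₁)) (≡.trans (cong (η *_) (S-ι w₁≢v)) (ℕ.*-identityʳ η))) ⟨
      S (λ u → 2 * degree A u) + S (λ u → η * ι w₁ u)
        ≡⟨ S-+ (λ u → 2 * degree A u) (λ u → η * ι w₁ u) ⟨
      S (λ u → 2 * degree A u + η * ι w₁ u)
        ≤⟨ S-mono bound ⟩
      S (λ u → degree B u + 2 * φ * ι w₁ u + ν w₁ u + η * ι w₂ u)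
        ≡⟨ ≡.trans (S-+ (λ u → degree B u + 2 * φ * ι w₁ u + ν w₁ u) (λ u → η * ι w₂ u))
             (cong (_+ S (λ u → η * ι w₂ u)) (≡.trans (S-+ (λ u → degree B u + 2 * φ * ι w₁ u) (ν w₁))
               (cong (_+ S (ν w₁)) (S-+ (degree B) (λ u → 2 * φ * ι w₁ u))))) ⟩
      S (degree B) + S (λ u → 2 * φ * ι w₁ u) + S (ν w₁) + S (λ u → η * ι w₂ u)
        ≡⟨ cong₂ _+_ (cong₂ _+_ (cong₂ _+_ (S-rim B∩δ≡∅)
             (≡.trans (S-* (2 * φ) (ι w₁)) (≡.trans (cong (2 * φ *_) (S-ι w₁≢v)) (ℕ.*-identityʳ (2 * φ)))))
             (ℕ.suc-injective (ℕ.suc-injective (≡.trans (S-ν w₁≢v) n≡))))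
             (≡.trans (S-* η (ι w₂)) (≡.trans (cong (η *_) (S-ι w₂≢v)) (ℕ.*-identityʳ η))) ⟩
      2 * # B + 2 * φ + (1 + k * 2) + η
        ≡⟨ cong (λ x → x + (1 + k * 2) + η) (ℕ.*-distribˡ-+ 2 (# B) φ) ⟨
      2 * (# B + φ) + (1 + k * 2) + η ∎))
    where
    open Count H
    open Around v
    open ℕ.≤-Reasoning
    A = δ v ∖ ⁅ f ⁆ᴱ
    B = E[K- v ] ∖ ⁅ h ⁆ᴱ

    φ η : ℕ
    φ = if edges H f then 1 else 0
    η = if edges H h then 1 else 0

    w₁≢w₂ : w₁ ≢ w₂
    w₁≢w₂ = Joins⇒≢ {e = h} h-w₁w₂

    A⊆δ : ∀ e → T (A e) → T (δ v e)
    A⊆δ e e∈A = proj₁ (∖⁻ {G = δ v} {f} {e} e∈A)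

    B∩δ≡∅ : ∀ e → T (B e) → ¬ T (δ v e)
    B∩δ≡∅ e e∈B = E[K-]⁻ {v = v} {e} (proj₁ (∖⁻ {G = E[K- v ]} {h} {e} e∈B))

    ∈B : ∀ {e u w} → e Joins u , w → u ≢ v → w ≢ v → e ≢ h → T (B e)
    ∈B {e} p u≢v w≢v e≢h = ∖⁺ {G = E[K- v ]} {h} {e} (∈E[K-] {v = v} {e} p u≢v w≢v) e≢h

    -- The only edge from `v` to `w₁` is `f`, which `A` omits, so the degree in `A` is 0. If `h` is
    -- present, either `f` is too and `2 * φ` pays for it, or `h` has a companion at `w₁`, which
    -- then lies in `B`.
    at-w₁ : 2 * degree A w₁ + η ≤ degree B w₁ + 2 * φ
    at-w₁ = ≡.subst (λ d → 2 * d + η ≤ degree B w₁ + 2 * φ)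
      (≡.sym (≡.trans (degree-star {A} {f} A⊆δ w₁≢v (Joins-sym {e = f} f-vw₁))
        (count-∉ {A} {f} λ f∈A → proj₂ (∖⁻ {G = δ v} {f} {f} f∈A) ≡.refl))) by
      where
      by : η ≤ degree B w₁ + 2 * φ
      by with T? (edges H h) | T? (edges H f)
      ... | no h∉H  | _ = ≡.subst (_≤ degree B w₁ + 2 * φ) (cong (if_then 1 else 0) (≡.sym (¬T⇒false h∉H))) z≤n
      ... | yes h∈H | yes f∈H =
        ≡.subst₂ (λ x y → (if x then 1 else 0) ≤ degree B w₁ + 2 * (if y then 1 else 0))
          (≡.sym (T⇒true h∈H)) (≡.sym (T⇒true f∈H)) (ℕ.≤-trans (s≤s z≤n) (ℕ.m≤n+m 2 (degree B w₁)))
      ... | yes h∈H | no f∉H  =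
        ≡.subst (λ x → (if x then 1 else 0) ≤ degree B w₁ + 2 * φ) (≡.sym (T⇒true h∈H))
          (ℕ.≤-trans (degree-pos 2ec {B} {h} h∈H h-w₁w₂ λ {e′} e′∈H q e′≢h → ∈B {e′} q w₁≢v
            (λ { ≡.refl → f∉H (≡.subst (T ∘ edges H) (Joins-unique {e = e′} {f} q (Joins-sym {e = f} f-vw₁)) e′∈H) })
            e′≢h) (ℕ.m≤m+n (degree B w₁) (2 * φ)))

    at-other : ∀ {u} → u ≢ v → (T (edges H h) → ∀ {w} → ¬ (h Joins u , w)) → 2 * degree A u ≤ degree B u + 1
    at-other {u} u≢v h∌u with joining u≢v
    ... | e , p = ≡.subst (λ d → 2 * d ≤ degree B u + 1) (≡.sym (degree-star {A} {e} A⊆δ u≢v p)) by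
      where
      by : 2 * count A e ≤ degree B u + 1
      by with T? (edges H e)
      ... | no e∉H = ≡.subst (λ c → 2 * c ≤ degree B u + 1) (≡.sym (count-absent {A} {e} e∉H)) z≤n
      ... | yes e∈H = ℕ.≤-trans (ℕ.*-monoʳ-≤ 2 (count≤1 A e)) (ℕ.+-monoˡ-≤ 1
        (degree-pos 2ec {B} {e} e∈H p λ {e′} e′∈H q e′≢e → ∈B {e′} q u≢v
          (λ { ≡.refl → e′≢e (Joins-unique {e = e′} {e} q p) })
          (λ { ≡.refl → h∌u e′∈H q })))

    -- With `h` present the right-hand side is at least 2, which covers the one possible edge to
    -- `v`; without `h` the vertex is an ordinary one.
    at-w₂ : 2 * degree A w₂ ≤ degree B w₂ + (1 + η)
    at-w₂ with T? (edges H h)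
    ... | no h∉H  = ℕ.≤-trans (at-other w₂≢v (λ h∈H → contradiction h∈H h∉H))
                      (ℕ.+-monoʳ-≤ (degree B w₂) (ℕ.m≤m+n 1 η))
    ... | yes h∈H = ≡.subst (λ x → 2 * degree A w₂ ≤ degree B w₂ + (1 + (if x then 1 else 0))) (≡.sym (T⇒true h∈H))
      (ℕ.≤-trans (ℕ.*-monoʳ-≤ 2 degree≤1) (ℕ.m≤n+m 2 (degree B w₂)))
      where
      degree≤1 : degree A w₂ ≤ 1
      degree≤1 with joining w₂≢v
      ... | e , p = ≡.subst (_≤ 1) (≡.sym (degree-star {A} {e} A⊆δ w₂≢v p)) (count≤1 A e)

    bound : ∀ u → u ≢ v →
            2 * degree A u + η * ι w₁ u ≤ degree B u + 2 * φ * ι w₁ u + ν w₁ u + η * ι w₂ u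
    bound u u≢v = by (u ≟ w₁) (u ≟ w₂)
      where
      open +-*-Solver
      Goal : ℕ → ℕ → ℕ → Set
      Goal i j l = 2 * degree A u + η * i ≤ degree B u + 2 * φ * i + j + η * l

      by : Dec (u ≡ w₁) → Dec (u ≡ w₂) → Goal (ι w₁ u) (ν w₁ u) (ι w₂ u)
      by (yes ≡.refl) _
        rewrite ι-self w₁ | ν-self w₁ | ι-≢ w₁≢w₂ =
        ≡.subst₂ _≤_ (cong (2 * degree A w₁ +_) (≡.sym (ℕ.*-identityʳ η)))
          (solve 3 (λ d x y → d :+ x := d :+ x :* con 1 :+ con 0 :+ y :* con 0) ≡.refl (degree B w₁) (2 * φ) η)
          at-w₁
      by (no u≢w₁) (yes ≡.refl)
        rewrite ι-≢ u≢w₁ | ν-≢ u≢w₁ | ι-self w₂ =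
        ≡.subst₂ _≤_ (solve 2 (λ d y → d := d :+ y :* con 0) ≡.refl (2 * degree A w₂) η)
          (solve 3 (λ d x y → d :+ (con 1 :+ y) := d :+ x :* con 0 :+ con 1 :+ y :* con 1) ≡.refl (degree B w₂) (2 * φ) η)
          at-w₂
      by (no u≢w₁) (no u≢w₂)
        rewrite ι-≢ u≢w₁ | ν-≢ u≢w₁ | ι-≢ u≢w₂ =
        ≡.subst₂ _≤_ (solve 2 (λ d y → d := d :+ y :* con 0) ≡.refl (2 * degree A u) η)
          (solve 3 (λ d x y → d :+ con 1 := d :+ x :* con 0 :+ con 1 :+ y :* con 0) ≡.refl (degree B u) (2 * φ) η)
          (at-other u≢v λ _ q → [ u≢w₁ ∘ proj₁ , u≢w₂ ∘ proj₁ ]′ (Joins-ends {e = h} h-w₁w₂ q))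

open DegreeCounts

-- Graphs given by lists of pairs, and ear decompositions

module PairLists (n : ℕ) where

  Pair : Set
  Pair = Fin n × Fin n

  _Joinsᴾ_ : Edge n → Pair → Set
  e Joinsᴾ (a , b) = e Joins a , b

  _On_ : Edge n → List Pair → Set
  e On L = Any (e Joinsᴾ_) L

  _Ends_ : Fin n → Pair → Set
  u Ends (a , b) = (u ≡ a) ⊎ (u ≡ b)

  on? : ∀ e L → Dec (e On L)
  on? e = any? λ (a , b) → joins? e a b

  ends? : ∀ u L → Dec (Any (u Ends_) L)
  ends? u = any? λ (a , b) → (u ≟ a) ⊎-dec (u ≟ b)

  private
    tabulate-∈⁺ : ∀ {f : Fin n → Bool} {u} → T (f u) → u Subset.∈ tabulate f
    tabulate-∈⁺ {f} {u} t with f u in eq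
    ... | true = lookup⇒[]= u (tabulate f) (≡.trans (lookup∘tabulate f u) eq)

    tabulate-∈⁻ : ∀ {f : Fin n → Bool} {u} → u Subset.∈ tabulate f → T (f u)
    tabulate-∈⁻ {f} {u} u∈ = ≡.subst T
      (≡.trans (≡.sym ([]=⇒lookup u∈)) (lookup∘tabulate f u)) _

  -- There are no isolated vertices, and the empty list gives the empty graph, whose incidence
  -- vector is the origin.
  graph : List Pair → Subgraph n
  graph L = record
    { vertices  = tabulate λ u → does (ends? u L)
    ; edges     = λ e → does (on? e L)
    ; endpoints = λ {e} e∈L → let e-on-L = T-does⁻ (on? e L) e∈L in
        tabulate-∈⁺ (T-does⁺ (ends? (lo e) L) (Any.map (λ { (inj₁ (p , _)) → inj₁ p ; (inj₂ (p , _)) → inj₂ p }) e-on-L)) ,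
        tabulate-∈⁺ (T-does⁺ (ends? (hi e) L) (Any.map (λ { (inj₁ (_ , p)) → inj₂ p ; (inj₂ (_ , p)) → inj₁ p }) e-on-L))
    }

  Proper : Pair → Set
  Proper (a , b) = a ≢ b

  -- Comparing through edges makes pairs distinct as unordered pairs, whatever their orientation.
  Different : Pair → Pair → Set
  Different p q = ∀ e → e Joinsᴾ p → ¬ (e Joinsᴾ q)

  Avoids : Fin n → Pair → Set
  Avoids u (a , b) = u ≢ a × u ≢ b

  Avoids⇒Different : ∀ {u p q} → u Ends p → Avoids u q → Different p q
  Avoids⇒Different (inj₁ ≡.refl) (u≢c , u≢d) e ep eq with Joins-ends {e = e} eq ep
  ... | inj₁ (u≡c , _) = u≢c u≡c
  ... | inj₂ (u≡d , _) = u≢d u≡d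
  Avoids⇒Different (inj₂ ≡.refl) (u≢c , u≢d) e ep eq with Joins-ends {e = e} eq ep
  ... | inj₁ (_ , u≡d) = u≢d u≡d
  ... | inj₂ (_ , u≡c) = u≢c u≡c

  Step : List Pair → Edge n → Fin n → Fin n → Set
  Step L e a b = ∃[ e′ ] e′ ≢ e × e′ On L × e′ Joins a , b

  Avoiding : List Pair → Edge n → Fin n → Fin n → Set
  Avoiding L e = Star (Step L e)

  Step-sym : ∀ {L e a b} → Step L e a b → Step L e b a
  Step-sym (e′ , e′≢e , on , p) = e′ , e′≢e , on , Joins-sym {e = e′} p

  reverse : ∀ {L e a b} → Avoiding L e a b → Avoiding L e b a
  reverse {L} {e} = Star.reverse (Step-sym {L} {e})

  weaken : ∀ {L} W {e a b} → Avoiding L e a b → Avoiding (W ++ L) e a b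
  weaken W = Star.map λ { (e′ , e′≢e , on , p) → e′ , e′≢e , Any.++⁺ʳ W on , p }

  -- The edge ranges over all of Kₙ, so that plain connectivity is an instance as well.
  Attached : Fin n → List Pair → Fin n → Set
  Attached v L u = ∀ e → Avoiding L e u v

  attached⇒2-edge-connected : ∀ v L → All Proper L →
    All (λ (a , b) → Attached v L a × Attached v L b) L → TwoEdgeConnected (graph L)
  attached⇒2-edge-connected v L proper attached = robust⇒2-edge-connected (graph L)
    -- A walk avoiding some edge is in particular a walk; a nonempty vertex set supplies an edge to
    -- avoid.
    (λ u∈ w∈ → let e = some-edge u∈ in reach e u∈ w∈ (λ (e′ , _ , on , p) → e′ , T-does⁺ (on? e′ L) on , p))
    (λ e u∈ w∈ → reach e u∈ w∈ λ (e′ , e′≢e , on , p) → e′ , remains e′≢e on , p)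
    where
    ends : ∀ {u} → u Subset.∈ vertices (graph L) → Any (u Ends_) L
    ends {u} u∈ = T-does⁻ (ends? u L) (tabulate-∈⁻ u∈)

    some-edge : ∀ {u} → u Subset.∈ vertices (graph L) → Edge n
    some-edge u∈ = proj₁ (joining (All.lookup proper (proj₁ (proj₂ (find (ends u∈))))))

    to-v : ∀ e {u} → u Subset.∈ vertices (graph L) → Avoiding L e u v
    to-v e u∈ with find (ends u∈)
    ... | _ , p∈L , inj₁ ≡.refl = proj₁ (All.lookup attached p∈L) e
    ... | _ , p∈L , inj₂ ≡.refl = proj₂ (All.lookup attached p∈L) e

    reach : ∀ e {u w} {R : Fin n → Fin n → Set} → u Subset.∈ vertices (graph L) → w Subset.∈ vertices (graph L) →
            (∀ {a b} → Step L e a b → R a b) → Star R u w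
    reach e u∈ w∈ f = Star.map f (to-v e u∈ ◅◅ reverse (to-v e w∈))

    remains : ∀ {e e′} → e′ ≢ e → e′ On L → e′ ∈ᴱ edges (graph L) ∖ ⁅ e ⁆ᴱ
    remains {e} {e′} e′≢e on = Equivalence.from T-∧
      (T-does⁺ (on? e′ L) on , ≡.subst (T ∘ not) (≡.sym (dec-false same? (e′≢e ∘ same))) _)
      where
      same? = (lo e ≟ lo e′) ×-dec (hi e ≟ hi e′)
      same : lo e ≡ lo e′ × hi e ≡ hi e′ → e′ ≡ e
      same (≡.refl , ≡.refl) = ≡.refl

  walk : Fin n → List (Fin n) → Fin n → List Pair
  walk x []       y = (x , y) ∷ []
  walk x (p ∷ ps) y = (x , p) ∷ walk p ps y

  walk-avoids : ∀ {u} x ps y → u ≢ x → All (u ≢_) ps → u ≢ y → All (Avoids u) (walk x ps y)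
  walk-avoids x []       y u≢x []           u≢y = (u≢x , u≢y) ∷ []
  walk-avoids x (p ∷ ps) y u≢x (u≢p ∷ u∉ps) u≢y = (u≢x , u≢p) ∷ walk-avoids p ps y u≢p u∉ps u≢y

  -- Applied from the first new vertex of an ear onwards, this gives each of its pairs an end
  -- outside the old graph, which tells it apart from all old pairs.
  walk-touches : ∀ x ps y → All (λ p → ∃[ u ] u ∈ x ∷ ps × u Ends p) (walk x ps y)
  walk-touches x []       y = (x , here ≡.refl , inj₁ ≡.refl) ∷ []
  walk-touches x (p ∷ ps) y = (x , here ≡.refl , inj₁ ≡.refl) ∷
    All.map (λ (u , u∈ , end) → u , there u∈ , end) (walk-touches p ps y)

  walk-ends : ∀ x ps y → All (λ (a , b) → a ∈ x ∷ y ∷ ps × b ∈ x ∷ y ∷ ps) (walk x ps y)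
  walk-ends x []       y = (here ≡.refl , there (here ≡.refl)) ∷ []
  walk-ends x (p ∷ ps) y = (here ≡.refl , there (there (here ≡.refl))) ∷
    All.map (λ (a∈ , b∈) → lift a∈ , lift b∈) (walk-ends p ps y)
    where
    lift : ∀ {a} → a ∈ p ∷ y ∷ ps → a ∈ x ∷ y ∷ p ∷ ps
    lift (here a≡p)          = there (there (here a≡p))
    lift (there (here a≡y))  = there (here a≡y)
    lift (there (there a∈ps)) = there (there (there a∈ps))

  walk-proper : ∀ x ps y → Unique (x ∷ ps) → All (_≢ y) ps → x ≢ y ⊎ ps ≢ [] → All Proper (walk x ps y)
  walk-proper x []       y _ _ (inj₁ x≢y) = x≢y ∷ []
  walk-proper x []       y _ _ (inj₂ ≢[]) = contradiction ≡.refl ≢[]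
  walk-proper x (p ∷ ps) y ((x≢p ∷ _) ∷ unique) (p≢y ∷ ps≢y) _ =
    x≢p ∷ walk-proper p ps y unique ps≢y (inj₁ p≢y)

  -- The first pair differs from the second because of `x`, and from all later ones because of `p`.
  -- The last hypothesis rules out running back and forth along a single edge when the walk is
  -- closed.
  walk-simple : ∀ x p ps y → Unique (x ∷ p ∷ ps) → All (_≢ y) (p ∷ ps) → x ≢ y ⊎ ps ≢ [] →
                AllPairs Different (walk x (p ∷ ps) y)
  walk-simple x p [] y ((x≢p ∷ []) ∷ _) _ (inj₁ x≢y) =
    (Avoids⇒Different (inj₁ ≡.refl) (x≢p , x≢y) ∷ []) ∷ [] ∷ []
  walk-simple x p [] y _ _ (inj₂ ≢[]) = contradiction ≡.refl ≢[]
  walk-simple x p (q ∷ ps) y ((x≢p ∷ x≢q ∷ _) ∷ unique@((p≢q ∷ p∉ps) ∷ _)) (p≢y ∷ ps≢y) _ =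
    (Avoids⇒Different (inj₁ ≡.refl) (x≢p , x≢q) ∷
     All.map (Avoids⇒Different (inj₂ ≡.refl)) (walk-avoids q ps y p≢q p∉ps p≢y)) ∷
    walk-simple p q ps y unique ps≢y (inj₁ p≢y)

  -- Deleting an edge e cuts a simple walk at most once, so each of its inner
  -- vertices stays joined to one of the two ends.
  module _ {L : List Pair} (e : Edge n) where
    private
      R : Fin n → Fin n → Set
      R = Avoiding L e

    intact-walk : ∀ x ps y → All Proper (walk x ps y) → ¬ (e On walk x ps y) →
                  (∀ {e′} → e′ On walk x ps y → e′ On L) → All (λ p → R p y) (x ∷ ps)
    intact-step : ∀ {x p} → x ≢ p → ¬ (e Joins x , p) → (∀ {e′} → e′ Joins x , p → e′ On L) → R x p
    intact-step x≢p ¬p on with joining x≢p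
    ... | e′ , p = (e′ , (λ { ≡.refl → ¬p p }) , on {e′} p , p) ◅ ε

    intact-walk x []       y (x≢y ∷ []) e∉ sub = intact-step x≢y (e∉ ∘ here) (λ {e′} → sub {e′} ∘ here) ∷ []
    intact-walk x (p ∷ ps) y (x≢p ∷ proper) e∉ sub
      with rest@(pRy ∷ _) ← intact-walk p ps y proper (e∉ ∘ there) (λ {e′} → sub {e′} ∘ there) =
      (intact-step x≢p (e∉ ∘ here) (λ {e′} → sub {e′} ∘ here) ◅◅ pRy) ∷ rest

    cut-walk : ∀ x ps y → All Proper (walk x ps y) → AllPairs Different (walk x ps y) →
               (∀ {e′} → e′ On walk x ps y → e′ On L) → All (λ p → R p x ⊎ R p y) ps
    cut-walk x []       y _ _ _ = []
    cut-walk x (p ∷ ps) y (x≢p ∷ proper) (different ∷ simple) sub with joins? e x p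
    ... | yes e-xp = All.map inj₂ (intact-walk p ps y proper
            (λ e∈ → let (_ , q∈ , e-q) = find e∈ in All.lookup different q∈ e e-xp e-q)
            (λ {e′} → sub {e′} ∘ there))
    ... | no ¬e-xp = inj₁ pRx ∷
            All.map [ (λ r → inj₁ (r ◅◅ pRx)) , inj₂ ]′ (cut-walk p ps y proper simple (λ {e′} → sub {e′} ∘ there))
      where
      pRx = reverse (intact-step x≢p ¬e-xp (λ {e′} → sub {e′} ∘ here))

  -- Graphs built from the vertex v by attaching ears, with the list of their
  -- vertices other than v.
  data Ears (v : Fin n) : List (Fin n) → List Pair → Set where
    []  : Ears v [] []
    ear : ∀ {us L} x p ps y → x ∈ v ∷ us → y ∈ v ∷ us → x ≢ y ⊎ ps ≢ [] →
          Ears v us L → Ears v ((p ∷ ps) ++ us) (walk x (p ∷ ps) y ++ L)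

  unique-++⁻ : ∀ (xs : List (Fin n)) {ys} → Unique (xs ++ ys) → Unique xs × Unique ys × All (λ x → All (x ≢_) ys) xs
  unique-++⁻ []       u        = [] , u , []
  unique-++⁻ (x ∷ xs) (x∉ ∷ u) with unique-++⁻ xs u
  ... | uxs , uys , disjoint = All.++⁻ˡ xs x∉ ∷ uxs , uys , All.++⁻ʳ xs x∉ ∷ disjoint

  record Solid (v : Fin n) (us : List (Fin n)) (L : List Pair) : Set where
    field
      proper   : All Proper L
      simple   : AllPairs Different L
      ends     : All (λ (a , b) → a ∈ v ∷ us × b ∈ v ∷ us) L
      attached : All (Attached v L) us

  open Solid

  solid⇒2-edge-connected : ∀ {v us L} → Solid v us L → TwoEdgeConnected (graph L)
  solid⇒2-edge-connected {v} {us} {L} S = attached⇒2-edge-connected v L (proper S)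
    (All.map (λ (a∈ , b∈) → All.lookup attached₀ a∈ , All.lookup attached₀ b∈) (ends S))
    where
    attached₀ : All (Attached v L) (v ∷ us)
    attached₀ = (λ _ → ε) ∷ attached S

  -- After any deletion an inner vertex of the new ear still reaches `x` or `y`, and these reach `v`
  -- inside the old graph. The field `ends` is carried along to see that the inner vertices are new
  -- to the old pairs.
  ears⇒solid : ∀ {v us L} → Unique (v ∷ us) → Ears v us L → Solid v us L
  ears⇒solid _ [] = record { proper = [] ; simple = [] ; ends = [] ; attached = [] }
  ears⇒solid {v} (v∉ ∷ unique) (ear {us} {L} x p ps y x∈ y∈ x≢y⊎long E)
    with unique-++⁻ (p ∷ ps) unique
  ... | unique-ps , unique-us , disjoint = record
    { proper   = All.++⁺ W-proper (proper S)
    ; simple   = AllPairs.++⁺ W-simple (simple S) (All.map W≢L (walk-touches′))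
    ; ends     = All.++⁺
        (All.map (λ (a∈ , b∈) → W-end a∈ , W-end b∈) (walk-ends x (p ∷ ps) y))
        (All.map (λ (a∈ , b∈) → L-end a∈ , L-end b∈) (ends S))
    ; attached = All.++⁺ W-attached (All.map (λ a e → weaken W (a e)) (attached S))
    }
    where
    W = walk x (p ∷ ps) y
    S = ears⇒solid (All.++⁻ʳ (p ∷ ps) v∉ ∷ unique-us) E

    ps∉old : All (λ q → All (q ≢_) (v ∷ us)) (p ∷ ps)
    ps∉old = All.zipWith (λ (v≢q , q∉us) → (v≢q ∘ ≡.sym) ∷ q∉us) (All.++⁻ˡ (p ∷ ps) v∉ , disjoint)

    ps≢ : ∀ {z} → z ∈ v ∷ us → All (_≢ z) (p ∷ ps)
    ps≢ z∈ = All.map (λ q∉ → All.lookup q∉ z∈) ps∉old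

    unique-x∷ps : Unique (x ∷ p ∷ ps)
    unique-x∷ps = All.map (_∘ ≡.sym) (ps≢ x∈) ∷ unique-ps

    W-proper : All Proper W
    W-proper = walk-proper x (p ∷ ps) y unique-x∷ps (ps≢ y∈) (inj₂ λ ())

    W-simple : AllPairs Different W
    W-simple = walk-simple x p ps y unique-x∷ps (ps≢ y∈) x≢y⊎long

    walk-touches′ : All (λ r → ∃[ u ] u ∈ p ∷ ps × u Ends r) W
    walk-touches′ = (p , here ≡.refl , inj₂ ≡.refl) ∷ walk-touches p ps y

    W≢L : ∀ {r} → ∃[ u ] u ∈ p ∷ ps × u Ends r → All (Different r) L
    W≢L (u , u∈ , end) = All.map
      (λ (a∈ , b∈) → Avoids⇒Different end (All.lookup u∉ a∈ , All.lookup u∉ b∈)) (ends S)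
      where u∉ = All.lookup ps∉old u∈

    L-end : ∀ {a} → a ∈ v ∷ us → a ∈ v ∷ p ∷ ps ++ us
    L-end (here a≡v) = here a≡v
    L-end (there a∈) = there (∈-++⁺ʳ (p ∷ ps) a∈)

    W-end : ∀ {a} → a ∈ x ∷ y ∷ p ∷ ps → a ∈ v ∷ p ∷ ps ++ us
    W-end (here ≡.refl)         = L-end x∈
    W-end (there (here ≡.refl)) = L-end y∈
    W-end (there (there a∈))    = there (∈-++⁺ˡ a∈)

    old-attached : ∀ {z} → z ∈ v ∷ us → Attached v (W ++ L) z
    old-attached (here ≡.refl) e = ε
    old-attached (there z∈)    e = weaken W (All.lookup (attached S) z∈ e)

    W-attached : All (Attached v (W ++ L)) (p ∷ ps)
    W-attached = All.tabulate λ q∈ e →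
      [ _◅◅ old-attached x∈ e , _◅◅ old-attached y∈ e ]′
        (All.lookup (cut-walk e x (p ∷ ps) y W-proper W-simple Any.++⁺ˡ) q∈)

Unique-resp-↭ : ∀ {a} {A : Set a} {xs ys : List A} → xs ↭ ys → Unique xs → Unique ys
Unique-resp-↭ p = PermSetoid.Unique-resp-↭ (≡.setoid _) (↭⇒↭ₛ p)

-- The points of the even case

module Flowers (n : ℕ) (v : Fin n) where
  open PairLists n

  flatten : List Pair → List (Fin n)
  flatten []             = []
  flatten ((a , b) ∷ ps) = a ∷ b ∷ flatten ps

  triangle : Fin n → Fin n → List Pair
  triangle a b = walk v (a ∷ b ∷ []) v

  triangles : List Pair → List Pair
  triangles []             = []
  triangles ((a , b) ∷ ps) = triangle a b ++ triangles ps

  -- K₄ without the edge ac: two triangles through `v` that share the spoke from `v` to `b`.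
  diamond : Fin n → Fin n → Fin n → List Pair → List Pair
  diamond a b c ps = walk v (c ∷ []) b ++ triangle a b ++ triangles ps

  -- The matchings of x ∷ flatten ps that miss exactly one vertex, one for each
  -- missed vertex.
  near : Fin n → List Pair → List (Fin n × List Pair)
  near x []             = (x , []) ∷ []
  near x ((c , d) ∷ ps) =
    (c , (d , x) ∷ ps) ∷ (d , (c , x) ∷ ps) ∷ map (λ (i , M) → i , (c , d) ∷ M) (near x ps)

  -- Adding a and b to `v` and m + 1 old vertices brings 2(m + 1) + 3 new edges, and as many graphs:
  -- for each old i the triangles a i and b i, completed by a matching of the old vertices that
  -- misses i, and three diamonds with shared spoke at a, at b and at x.
  family : Fin n → List Pair → List (List Pair)
  family x []             = [] ∷ []
  family x ((a , b) ∷ ps) =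
    map (triangle a b ++_) (family x ps) ++
    map (λ (i , M) → triangle a i ++ triangles M) (near x ps) ++
    map (λ (i , M) → triangle b i ++ triangles M) (near x ps) ++
    diamond b a x ps ∷ diamond a b x ps ∷ diamond a x b ps ∷ []

  length-near : ∀ x ps → length (near x ps) ≡ suc (length (flatten ps))
  length-near x []       = ≡.refl
  length-near x (p ∷ ps) = ≡.cong (2 ℕ.+_) (≡.trans (length-map _ (near x ps)) (length-near x ps))

  length-family : ∀ x ps → length (family x ps) ≡ edgeCount (2 ℕ.+ length (flatten ps))
  length-family x []             = ≡.refl
  length-family x ((a , b) ∷ ps) = begin
    length (A ++ B ++ C ++ D)
      ≡⟨ ≡.trans (length-++ A) (≡.cong (length A ℕ.+_) (≡.trans (length-++ B) (≡.cong (length B ℕ.+_) (length-++ C)))) ⟩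
    length A ℕ.+ (length B ℕ.+ (length C ℕ.+ 3))
      ≡⟨ ≡.cong₂ ℕ._+_ (≡.trans (length-map _ (family x ps)) (length-family x ps))
           (≡.cong₂ (λ b c → b ℕ.+ (c ℕ.+ 3)) (≡.trans (length-map _ (near x ps)) (length-near x ps))
                                               (≡.trans (length-map _ (near x ps)) (length-near x ps))) ⟩
    N ℕ.+ (suc m ℕ.+ (suc m ℕ.+ 3))
      ≡⟨ solve 2 (λ N m → N :+ (con 1 :+ m :+ (con 1 :+ m :+ con 3)) := con 3 :+ m :+ (con 2 :+ m :+ N)) ≡.refl N m ⟩
    3 ℕ.+ m ℕ.+ (2 ℕ.+ m ℕ.+ N) ∎
    where
    open ≡.≡-Reasoning
    open +-*-Solver
    m = length (flatten ps)
    N = edgeCount (2 ℕ.+ m)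
    A = map (triangle a b ++_) (family x ps)
    B = map (λ (i , M) → triangle a i ++ triangles M) (near x ps)
    C = map (λ (i , M) → triangle b i ++ triangles M) (near x ps)
    D = diamond b a x ps ∷ diamond a b x ps ∷ diamond a x b ps ∷ []

  near-↭ : ∀ x ps → All (λ (i , M) → i ∷ flatten M ↭ x ∷ flatten ps) (near x ps)
  near-↭ x []             = ↭-refl ∷ []
  near-↭ x ((c , d) ∷ ps) =
    ↭-trans (prep c (swap d x ↭-refl)) (swap c x ↭-refl) ∷
    ↭-trans (prep d (swap c x ↭-refl)) (↭-trans (swap d x ↭-refl) (prep x (swap d c ↭-refl))) ∷
    All.map⁺ (All.map (λ {(i , M)} p → begin
      i ∷ c ∷ d ∷ flatten M  ↭⟨ swap i c ↭-refl ⟩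
      c ∷ i ∷ d ∷ flatten M  ↭⟨ prep c (swap i d ↭-refl) ⟩
      c ∷ d ∷ i ∷ flatten M  ↭⟨ prep c (prep d p) ⟩
      c ∷ d ∷ x ∷ flatten ps ↭⟨ prep c (swap d x ↭-refl) ⟩
      c ∷ x ∷ d ∷ flatten ps ↭⟨ swap c x ↭-refl ⟩
      x ∷ c ∷ d ∷ flatten ps ∎) (near-↭ x ps))
    where open Perm.PermutationReasoning

  near-length : ∀ x ps → All (λ (i , M) → length M ≡ length ps) (near x ps)
  near-length x []       = ≡.refl ∷ []
  near-length x (p ∷ ps) = ≡.refl ∷ ≡.refl ∷ All.map⁺ (All.map (≡.cong suc) (near-length x ps))

  near-complete : ∀ x ps {i} → i ∈ x ∷ flatten ps → ∃[ M ] (i , M) ∈ near x ps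
  near-complete x []             (here ≡.refl)                 = [] , here ≡.refl
  near-complete x ((c , d) ∷ ps) (here ≡.refl) with near-complete x ps (here ≡.refl)
  ... | M , M∈ = (c , d) ∷ M , there (there (∈-map⁺ _ M∈))
  near-complete x ((c , d) ∷ ps) (there (here ≡.refl))         = (d , x) ∷ ps , here ≡.refl
  near-complete x ((c , d) ∷ ps) (there (there (here ≡.refl))) = (c , x) ∷ ps , there (here ≡.refl)
  near-complete x ((c , d) ∷ ps) (there (there (there i∈))) with near-complete x ps (there i∈)
  ... | M , M∈ = (c , d) ∷ M , there (there (∈-map⁺ _ M∈))

  -- `rest` holds the vertices left uncovered; through the permutation the distinctness of `vs`
  -- passes to `us`.
  Flower : List (Fin n) → List Pair → Set
  Flower vs L = ∃[ us ] ∃[ rest ] Ears v us L × us ++ rest ↭ vs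

  triangle-ears : ∀ {us L} a b → Ears v us L → Ears v (a ∷ b ∷ us) (triangle a b ++ L)
  triangle-ears a b = ear v a (b ∷ []) v (here ≡.refl) (here ≡.refl) (inj₂ λ ())

  triangles-ears : ∀ ps → Ears v (flatten ps) (triangles ps)
  triangles-ears []             = []
  triangles-ears ((a , b) ∷ ps) = triangle-ears a b (triangles-ears ps)

  diamond-ears : ∀ {a b c} ps → v ≢ b → Ears v (c ∷ a ∷ b ∷ flatten ps) (diamond a b c ps)
  diamond-ears {a} {b} {c} ps v≢b = ear v c [] b (here ≡.refl) (there (there (here ≡.refl)))
    (inj₁ v≢b) (triangle-ears a b (triangles-ears ps))

  flower : ∀ {us vs L} rest → Ears v us L → us ++ rest ↭ vs → Flower vs L
  flower rest E p = _ , rest , E , p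

  spanning : ∀ {us vs L} → Ears v us L → us ↭ vs → Flower vs L
  spanning E p = flower [] E (↭-trans (↭-++-identityʳ _) p)

  swap₂ : ∀ a b x {us : List (Fin n)} → a ∷ b ∷ x ∷ us ↭ x ∷ a ∷ b ∷ us
  swap₂ a b x = ↭-trans (prep a (swap b x ↭-refl)) (swap a x ↭-refl)

  family-flowers : ∀ x ps → All (v ≢_) (x ∷ flatten ps) → All (Flower (x ∷ flatten ps)) (family x ps)
  family-flowers x []             _                      = flower (x ∷ []) [] ↭-refl ∷ []
  family-flowers x ((a , b) ∷ ps) (v≢x ∷ v≢a ∷ v≢b ∷ v∉) =
    All.++⁺ (All.map⁺ (All.map (λ (us , rest , E , p) →
      flower rest (triangle-ears a b E) (↭-trans (prep a (prep b p)) (swap₂ a b x)))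
      (family-flowers x ps (v≢x ∷ v∉)))) $
    All.++⁺ (All.map⁺ (All.map (λ {(i , M)} p → flower (b ∷ []) (triangle-ears a i (triangles-ears M))
      (↭-trans (prep a (↭-trans (shift b (i ∷ flatten M) []) (prep b (↭-trans (↭-++-identityʳ _) p)))) (swap₂ a b x)))
      (near-↭ x ps))) $
    All.++⁺ (All.map⁺ (All.map (λ {(i , M)} p → flower (a ∷ []) (triangle-ears b i (triangles-ears M))
      (↭-trans (shift a (b ∷ i ∷ flatten M) []) (↭-trans (prep a (prep b (↭-trans (↭-++-identityʳ _) p))) (swap₂ a b x))))
      (near-↭ x ps))) $
    spanning (diamond-ears ps v≢a) (prep x (swap b a ↭-refl)) ∷
    spanning (diamond-ears ps v≢b) ↭-refl ∷
    spanning (diamond-ears ps v≢x) (↭-trans (swap b a ↭-refl) (swap₂ a b x)) ∷ []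

  -- Edge weights that are constant on the family

  module Weights {c ℓ₁ ℓ₂} (F : OrderedField c ℓ₁ ℓ₂)
    (w : Fin n → Fin n → OrderedField.Carrier F)
    (w-sym : ∀ a b → OrderedField._≈_ F (w a b) (w b a))
    where
    open OrderedFieldProperties F
    open SetoidReasoning setoid

    weight : List Pair → Carrier
    weight []             = 0#
    weight ((a , b) ∷ L) = w a b + weight L

    weight-++ : ∀ L M → weight (L ++ M) ≈ weight L + weight M
    weight-++ []             M = sym (+-identityˡ _)
    weight-++ ((a , b) ∷ L) M = trans (+-congˡ (weight-++ L M)) (sym (+-assoc _ _ _))

    Δ : Fin n → Fin n → Carrier
    Δ a b = weight (triangle a b)

    Δ-eq : ∀ a b → Δ a b ≈ (w v a + w v b) + w a b
    Δ-eq a b = begin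
      w v a + (w a b + (w b v + 0#)) ≈⟨ +-congˡ (+-congˡ (trans (+-identityʳ _) (w-sym b v))) ⟩
      w v a + (w a b + w v b)        ≈⟨ +-congˡ (+-comm _ _) ⟩
      w v a + (w v b + w a b)        ≈⟨ +-assoc _ _ _ ⟨
      w v a + w v b + w a b          ∎

    Δ-sym : ∀ a b → Δ a b ≈ Δ b a
    Δ-sym a b = trans (Δ-eq a b) (trans (+-cong (+-comm _ _) (w-sym a b)) (sym (Δ-eq b a)))

    -- The shared spoke belongs to both triangles; it is added on the left so that nothing need be
    -- subtracted on the right.
    weight-diamond : ∀ a b c ps → w v b + weight (diamond a b c ps) ≈ Δ c b + weight (triangle a b ++ triangles ps)
    weight-diamond a b c ps = begin
      w v b + (w v c + (w c b + W)) ≈⟨ +-congˡ (+-assoc _ _ _) ⟨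
      w v b + (w v c + w c b + W)   ≈⟨ +-assoc _ _ _ ⟨
      w v b + (w v c + w c b) + W   ≈⟨ +-congʳ (+-assoc _ _ _) ⟨
      w v b + w v c + w c b + W     ≈⟨ +-congʳ (+-congʳ (+-comm _ _)) ⟩
      w v c + w v b + w c b + W     ≈⟨ +-congʳ (Δ-eq c b) ⟨
      Δ c b + W                     ∎
      where W = weight (triangle a b ++ triangles ps)

    -- This is σ times the even normal: with spokes σ, a triangle weighs σ exactly when its rim edge
    -- weighs -σ. Triangles are used because they are the building blocks of the graphs.
    record Uniform (σ : Carrier) (vs : List (Fin n)) : Set ℓ₁ where
      field
        spokes : ∀ {i} → i ∈ vs → w v i ≈ σ
        rims   : ∀ {i j} → i ∈ vs → j ∈ vs → i ≢ j → Δ i j ≈ σ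

    open Uniform

    uniform-triangles : ∀ {σ vs} ps → Uniform σ vs → Unique (flatten ps) → All (_∈ vs) (flatten ps) →
                        weight (triangles ps) ≈ length ps · σ
    uniform-triangles []             U _ _ = refl
    uniform-triangles ((a , b) ∷ ps) U ((a≢b ∷ _) ∷ (_ ∷ unique)) (a∈ ∷ b∈ ∷ ps∈) = trans
      (weight-++ (triangle a b) (triangles ps))
      (+-cong (rims U a∈ b∈ a≢b) (uniform-triangles ps U unique ps∈))

    uniform-near : ∀ {σ x ps} → Uniform σ (x ∷ flatten ps) → Unique (x ∷ flatten ps) →
                   All (λ (_ , M) → weight (triangles M) ≈ length ps · σ) (near x ps)
    uniform-near {σ} {x} {ps} U unique = All.zipWith
      (λ {(i , M)} (p , lengths) → trans
        (uniform-triangles M U (AllPairs.tail (Unique-resp-↭ (↭-sym p) unique))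
          (All.tail (All-resp-↭ (↭-sym p) (All.tabulate id))))
        (reflexive (≡.cong (_· σ) lengths)))
      (near-↭ x ps , near-length x ps)

    -- A weight on the edges of the complete graph on v , x and flatten ps is
    -- constant on the family only if it is a multiple of the facet normal.
    family-rigid : ∀ x ps γ → Unique (x ∷ flatten ps) → All (λ G → weight G ≈ γ) (family x ps) →
                   ∃[ σ ] γ ≈ length ps · σ × Uniform σ (x ∷ flatten ps)
    -- The only member is the empty graph, which forces γ = 0; the one edge from `v` to `x` is free
    -- and defines σ.
    family-rigid x [] γ _ (0≈γ ∷ []) = w v x , sym 0≈γ , record
      { spokes = λ { (here ≡.refl) → refl }
      ; rims   = λ { (here ≡.refl) (here ≡.refl) x≢x → contradiction ≡.refl x≢x }
      }
    family-rigid x ((a , b) ∷ ps) γ ((_ ∷ _ ∷ x∉) ∷ (_ ∷ _) ∷ (_ ∷ unique)) constant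
      with All.++⁻ (map (triangle a b ++_) (family x ps)) constant
    ... | A , constant₁ with All.++⁻ (map _ (near x ps)) constant₁
    ... | B , constant₂ with All.++⁻ (map _ (near x ps)) constant₂
    ... | C , da ∷ db ∷ dx ∷ []
      -- The members of the first block share the triangle a b; without it they form the smaller
      -- family, with value reduced by `Δ a b`. This is why γ has to be arbitrary.
      with family-rigid x ps (γ - Δ a b) (x∉ ∷ unique)
             (All.map (λ {G} eq → +-solve (trans (sym (weight-++ (triangle a b) G)) eq)) (All.map⁻ A))
    ... | σ , γ-τ≈kσ , U = σ , sym γ-eq , record { spokes = spokes′ ∘ split ; rims = λ i∈ j∈ → rims′ (split i∈) (split j∈) }
      where
      k = length ps
      τ = Δ a b
      vs = x ∷ flatten ps

      τ+kσ≈γ : τ + k · σ ≈ γ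
      τ+kσ≈γ = begin
        τ + k · σ   ≈⟨ +-congˡ γ-τ≈kσ ⟨
        τ + (γ - τ) ≈⟨ +-comm _ _ ⟩
        γ - τ + τ   ≈⟨ +-assoc _ _ _ ⟩
        γ + (- τ + τ) ≈⟨ +-congˡ (-‿inverseˡ τ) ⟩
        γ + 0#      ≈⟨ +-identityʳ γ ⟩
        γ           ∎

      -- Some matching misses i; its triangles weigh kσ by induction, so the triangle e i must make
      -- up the difference to γ, just as the triangle a b does.
      through : ∀ e → All (λ (i , M) → weight (triangle e i ++ triangles M) ≈ γ) (near x ps) →
                ∀ {i} → i ∈ vs → Δ e i ≈ τ
      through e hyp {i} i∈ with near-complete x ps i∈
      ... | M , M∈ = +-cancelʳ (k · σ) _ _ (begin
        Δ e i + k · σ                        ≈⟨ +-congˡ (All.lookup (uniform-near U (x∉ ∷ unique)) M∈) ⟨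
        Δ e i + weight (triangles M)         ≈⟨ weight-++ (triangle e i) (triangles M) ⟨
        weight (triangle e i ++ triangles M) ≈⟨ All.lookup hyp M∈ ⟩
        γ                                    ≈⟨ τ+kσ≈γ ⟨
        τ + k · σ                            ∎)

      Δ-a : ∀ {i} → i ∈ vs → Δ a i ≈ τ
      Δ-a = through a (All.map⁻ B)

      Δ-b : ∀ {i} → i ∈ vs → Δ b i ≈ τ
      Δ-b = through b (All.map⁻ C)

      -- Two triangles of weight τ and the rest kσ exceed γ = τ + kσ by τ, and the excess is the
      -- shared spoke.
      centre : ∀ d e f → Δ d e ≈ τ → Δ f e ≈ τ → weight (diamond d e f ps) ≈ γ → w v e ≈ τ
      centre d e f Δde Δfe eq = +-cancelʳ γ _ _ (begin
        w v e + γ                                 ≈⟨ +-congˡ eq ⟨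
        w v e + weight (diamond d e f ps)         ≈⟨ weight-diamond d e f ps ⟩
        Δ f e + weight (triangle d e ++ triangles ps)
          ≈⟨ +-cong Δfe (weight-++ (triangle d e) (triangles ps)) ⟩
        τ + (Δ d e + weight (triangles ps))
          ≈⟨ +-congˡ (+-cong Δde (uniform-triangles ps U unique (All.tabulate there))) ⟩
        τ + (τ + k · σ)                           ≈⟨ +-congˡ τ+kσ≈γ ⟩
        τ + γ                                     ∎)

      x∈ : x ∈ vs
      x∈ = here ≡.refl

      -- The spoke at x is evaluated twice: σ by induction, τ by the diamond centred at x. This ties
      -- the new block to the old ones.
      τ≈σ : τ ≈ σ
      τ≈σ = trans (sym (centre a x b (Δ-a x∈) (Δ-b x∈) dx)) (spokes U x∈)

      γ-eq : σ + k · σ ≈ γ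
      γ-eq = trans (+-congʳ (sym τ≈σ)) τ+kσ≈γ

      data Split (i : Fin n) : Set where
        is-a : i ≡ a → Split i
        is-b : i ≡ b → Split i
        old  : i ∈ vs → Split i

      split : ∀ {i} → i ∈ x ∷ a ∷ b ∷ flatten ps → Split i
      split (here i≡x)                 = old (here i≡x)
      split (there (here i≡a))         = is-a i≡a
      split (there (there (here i≡b))) = is-b i≡b
      split (there (there (there i∈))) = old (there i∈)

      spokes′ : ∀ {i} → Split i → w v i ≈ σ
      spokes′ (is-a ≡.refl) = trans (centre b a x (Δ-sym b a) (trans (Δ-sym x a) (Δ-a x∈)) da) τ≈σ
      spokes′ (is-b ≡.refl) = trans (centre a b x refl (trans (Δ-sym x b) (Δ-b x∈)) db) τ≈σ
      spokes′ (old i∈)      = spokes U i∈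

      rims′ : ∀ {i j} → Split i → Split j → i ≢ j → Δ i j ≈ σ
      rims′ (is-a ≡.refl) (is-a ≡.refl) a≢a = contradiction ≡.refl a≢a
      rims′ (is-a ≡.refl) (is-b ≡.refl) _   = τ≈σ
      rims′ (is-a ≡.refl) (old j∈)      _   = trans (Δ-a j∈) τ≈σ
      rims′ (is-b ≡.refl) (is-a ≡.refl) _   = trans (Δ-sym b a) τ≈σ
      rims′ (is-b ≡.refl) (is-b ≡.refl) b≢b = contradiction ≡.refl b≢b
      rims′ (is-b ≡.refl) (old j∈)      _   = trans (Δ-b j∈) τ≈σ
      rims′ (old i∈)      (is-a ≡.refl) _   = trans (Δ-sym _ a) (trans (Δ-a i∈) τ≈σ)
      rims′ (old i∈)      (is-b ≡.refl) _   = trans (Δ-sym _ b) (trans (Δ-b i∈) τ≈σ)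
      rims′ (old i∈)      (old j∈)      i≢j = rims U i∈ j∈ i≢j

    -- The converse of `family-rigid`, which for σ = 1 yields tightness. A diamond weighs 2σ - σ, no
    -- more than the single triangle it extends.
    family-uniform : ∀ {σ} x ps → Unique (x ∷ flatten ps) → Uniform σ (x ∷ flatten ps) →
                     All (λ G → weight G ≈ length ps · σ) (family x ps)
    family-uniform x [] _ _ = refl ∷ []
    family-uniform {σ} x ((a , b) ∷ ps)
      unique′@((x≢a ∷ x≢b ∷ x∉) ∷ (a≢b ∷ a∉) ∷ (b∉ ∷ unique)) U′ =
      All.++⁺ (All.map⁺ (All.map (λ {G} eq → trans (weight-++ (triangle a b) G)
        (+-cong (rims U′ (there (here ≡.refl)) (there (there (here ≡.refl))) a≢b) eq))
        (family-uniform x ps (x∉ ∷ unique) U))) $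
      All.++⁺ (All.map⁺ (through a (there (here ≡.refl)) ((x≢a ∘ ≡.sym) ∷ a∉))) $
      All.++⁺ (All.map⁺ (through b (there (there (here ≡.refl))) ((x≢b ∘ ≡.sym) ∷ b∉))) $
      centre b a x (there (there (here ≡.refl))) (there (here ≡.refl)) (here ≡.refl) (a≢b ∘ ≡.sym) x≢a ∷
      centre a b x (there (here ≡.refl)) (there (there (here ≡.refl))) (here ≡.refl) a≢b x≢b ∷
      centre a x b (there (here ≡.refl)) (here ≡.refl) (there (there (here ≡.refl))) (x≢a ∘ ≡.sym) (x≢b ∘ ≡.sym) ∷ []
      where
      vs = x ∷ a ∷ b ∷ flatten ps
      k = length ps

      old : ∀ {i} → i ∈ x ∷ flatten ps → i ∈ vs
      old (here i≡x) = here i≡x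
      old (there i∈) = there (there (there i∈))

      U : Uniform σ (x ∷ flatten ps)
      U = record { spokes = spokes U′ ∘ old ; rims = λ i∈ j∈ → rims U′ (old i∈) (old j∈) }

      through : ∀ e → e ∈ vs → All (e ≢_) (x ∷ flatten ps) →
                All (λ (i , M) → weight (triangle e i ++ triangles M) ≈ suc k · σ) (near x ps)
      through e e∈ e∉ = All.zipWith
        (λ {(i , M)} (p , eq) → trans (weight-++ (triangle e i) (triangles M))
          (+-cong (rims U′ e∈ (old (Any-resp-↭ p (here ≡.refl))) (All.lookup e∉ (Any-resp-↭ p (here ≡.refl)))) eq))
        (near-↭ x ps , uniform-near U (x∉ ∷ unique))

      centre : ∀ d e f → d ∈ vs → e ∈ vs → f ∈ vs → d ≢ e → f ≢ e → weight (diamond d e f ps) ≈ suc k · σ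
      centre d e f d∈ e∈ f∈ d≢e f≢e = +-cancelˡ σ _ _ (begin
        σ + weight (diamond d e f ps)             ≈⟨ +-congʳ (spokes U′ e∈) ⟨
        w v e + weight (diamond d e f ps)         ≈⟨ weight-diamond d e f ps ⟩
        Δ f e + weight (triangle d e ++ triangles ps)
          ≈⟨ +-cong (rims U′ f∈ e∈ f≢e) (weight-++ (triangle d e) (triangles ps)) ⟩
        σ + (Δ d e + weight (triangles ps))
          ≈⟨ +-congˡ (+-cong (rims U′ d∈ e∈ d≢e) (uniform-triangles ps U unique (All.tabulate there))) ⟩
        σ + (σ + k · σ)                           ∎)

-- The points of the odd case

module OddFlowers (n : ℕ) (v u : Fin n) where
  open PairLists n
  open Flowers n v

  -- In these graphs u is adjacent to x but not to v.
  square : Fin n → Fin n → List Pair → List Pair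
  square x c rest = walk v (x ∷ u ∷ c ∷ []) v ++ triangles rest

  -- The sides of the K₂,₃ are {v,u} and {x,c,d}; it arises from a square by one more path from `v`
  -- to `u`.
  theta : Fin n → Fin n → Fin n → List Pair → List Pair
  theta x c d rest = walk v (d ∷ []) u ++ square x c rest

  picks : List Pair → List (Pair × List Pair)
  picks []       = []
  picks (p ∷ ps) = (p , ps) ∷ map (λ (q , rest) → q , p ∷ rest) (picks ps)

  -- The graphs of family x (p ∷ ps) miss u.
  oddFamily : Fin n → Pair → List Pair → List (List Pair)
  oddFamily x p@(c₀ , d₀) ps =
    family x (p ∷ ps) ++
    map (λ ((c , _) , rest) → square x c rest) (picks (p ∷ ps)) ++
    map (λ ((_ , d) , rest) → square x d rest) (picks (p ∷ ps)) ++
    (triangle u x ++ triangles (p ∷ ps)) ∷ theta x c₀ d₀ ps ∷ []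

  length-picks : ∀ ps → length (picks ps) ≡ length ps
  length-picks []       = ≡.refl
  length-picks (p ∷ ps) = ≡.cong suc (≡.trans (length-map _ (picks ps)) (length-picks ps))

  length-flatten : ∀ ps → length (flatten ps) ≡ length ps ℕ.+ length ps
  length-flatten []       = ≡.refl
  length-flatten (p ∷ ps) = ≡.cong suc (≡.trans (≡.cong suc (length-flatten ps))
    (≡.sym (ℕ.+-suc (length ps) (length ps))))

  -- Beyond the even family of Kₙ - u there are as many graphs as edges at `u`: a square for each
  -- paired vertex, and the triangle u x and the theta graph for the edges to `v` and `x`.
  length-oddFamily : ∀ x p ps →
    length (oddFamily x p ps) ≡ edgeCount (3 ℕ.+ length (flatten (p ∷ ps)))
  length-oddFamily x p ps = begin
    length (family x (p ∷ ps) ++ A ++ B ++ C)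
      ≡⟨ ≡.trans (length-++ (family x (p ∷ ps))) (≡.cong (length (family x (p ∷ ps)) ℕ.+_)
           (≡.trans (length-++ A) (≡.cong (length A ℕ.+_) (length-++ B)))) ⟩
    length (family x (p ∷ ps)) ℕ.+ (length A ℕ.+ (length B ℕ.+ 2))
      ≡⟨ ≡.cong₂ ℕ._+_ (length-family x (p ∷ ps))
           (≡.cong₂ (λ a b → a ℕ.+ (b ℕ.+ 2)) (≡.trans (length-map _ (picks (p ∷ ps))) (length-picks (p ∷ ps)))
                                               (≡.trans (length-map _ (picks (p ∷ ps))) (length-picks (p ∷ ps)))) ⟩
    N ℕ.+ (k ℕ.+ (k ℕ.+ 2))
      ≡⟨ solve 2 (λ N k → N :+ (k :+ (k :+ con 2)) := con 2 :+ (k :+ k) :+ N) ≡.refl N k ⟩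
    2 ℕ.+ (k ℕ.+ k) ℕ.+ N
      ≡⟨ ≡.cong (λ m → 2 ℕ.+ m ℕ.+ N) (length-flatten (p ∷ ps)) ⟨
    2 ℕ.+ length (flatten (p ∷ ps)) ℕ.+ N ∎
    where
    open ≡.≡-Reasoning
    open +-*-Solver
    k = length (p ∷ ps)
    N = edgeCount (2 ℕ.+ length (flatten (p ∷ ps)))
    A = map (λ ((c , _) , rest) → square x c rest) (picks (p ∷ ps))
    B = map (λ ((_ , d) , rest) → square x d rest) (picks (p ∷ ps))
    C = (triangle u x ++ triangles (p ∷ ps)) ∷ theta x (proj₁ p) (proj₂ p) ps ∷ []

  picks-↭ : ∀ ps → All (λ ((c , d) , rest) → c ∷ d ∷ flatten rest ↭ flatten ps) (picks ps)
  picks-↭ []             = []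
  picks-↭ ((a , b) ∷ ps) = ↭-refl ∷ All.map⁺ (All.map (λ {((c , d) , rest)} p → begin
    c ∷ d ∷ a ∷ b ∷ flatten rest ↭⟨ swap₂ c d a ⟩
    a ∷ c ∷ d ∷ b ∷ flatten rest ↭⟨ prep a (swap₂ c d b) ⟩
    a ∷ b ∷ c ∷ d ∷ flatten rest ↭⟨ prep a (prep b p) ⟩
    a ∷ b ∷ flatten ps           ∎) (picks-↭ ps))
    where open Perm.PermutationReasoning

  picks-length : ∀ ps → All (λ (_ , rest) → suc (length rest) ≡ length ps) (picks ps)
  picks-length []       = []
  picks-length (p ∷ ps) = ≡.refl ∷ All.map⁺ (All.map (≡.cong suc) (picks-length ps))

  picks-complete : ∀ ps {i} → i ∈ flatten ps → ∃[ j ] ∃[ rest ]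
    (((i , j) , rest) ∈ picks ps ⊎ ((j , i) , rest) ∈ picks ps)
  picks-complete ((a , b) ∷ ps) (here ≡.refl)         = b , ps , inj₁ (here ≡.refl)
  picks-complete ((a , b) ∷ ps) (there (here ≡.refl)) = a , ps , inj₂ (here ≡.refl)
  picks-complete ((a , b) ∷ ps) (there (there i∈)) with picks-complete ps i∈
  ... | j , rest , inj₁ p = j , (a , b) ∷ rest , inj₁ (there (∈-map⁺ _ p))
  ... | j , rest , inj₂ p = j , (a , b) ∷ rest , inj₂ (there (∈-map⁺ _ p))

  square-ears : ∀ x c rest → Ears v (x ∷ u ∷ c ∷ flatten rest) (square x c rest)
  square-ears x c rest = ear v x (u ∷ c ∷ []) v (here ≡.refl) (here ≡.refl) (inj₂ λ ()) (triangles-ears rest)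

  theta-ears : ∀ x c d rest → v ≢ u → Ears v (d ∷ x ∷ u ∷ c ∷ flatten rest) (theta x c d rest)
  theta-ears x c d rest v≢u = ear v d [] u (here ≡.refl) (there (there (here ≡.refl))) (inj₁ v≢u)
    (square-ears x c rest)

  oddFamily-flowers : ∀ x p ps → All (v ≢_) (u ∷ x ∷ flatten (p ∷ ps)) →
                      All (Flower (u ∷ x ∷ flatten (p ∷ ps))) (oddFamily x p ps)
  oddFamily-flowers x p@(c₀ , d₀) ps (v≢u ∷ v∉) =
    All.++⁺ (All.map (λ (us , rest , E , q) →
      flower (u ∷ rest) E (↭-trans (shift u us rest) (prep u q))) (family-flowers x (p ∷ ps) v∉)) $
    All.++⁺ (All.map⁺ (All.map (λ {((c , d) , rest)} q → flower (d ∷ []) (square-ears x c rest)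
      (↭-trans (swap x u ↭-refl) (prep u (prep x (↭-trans
        (prep c (++-comm (flatten rest) (d ∷ []))) q))))) (picks-↭ (p ∷ ps)))) $
    All.++⁺ (All.map⁺ (All.map (λ {((c , d) , rest)} q → flower (c ∷ []) (square-ears x d rest)
      (↭-trans (swap x u ↭-refl) (prep u (prep x (↭-trans
        (++-comm (d ∷ flatten rest) (c ∷ [])) q))))) (picks-↭ (p ∷ ps)))) $
    spanning (triangle-ears u x (triangles-ears (p ∷ ps))) ↭-refl ∷
    spanning (theta-ears x c₀ d₀ ps v≢u) (begin
      d₀ ∷ x ∷ u ∷ c₀ ∷ flatten ps ↭⟨ swap₂ d₀ x u ⟩
      u ∷ d₀ ∷ x ∷ c₀ ∷ flatten ps ↭⟨ prep u (swap d₀ x ↭-refl) ⟩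
      u ∷ x ∷ d₀ ∷ c₀ ∷ flatten ps ↭⟨ prep u (prep x (swap d₀ c₀ ↭-refl)) ⟩
      u ∷ x ∷ c₀ ∷ d₀ ∷ flatten ps ∎) ∷ []
    where open Perm.PermutationReasoning

  module OddWeights {c ℓ₁ ℓ₂} (F : OrderedField c ℓ₁ ℓ₂)
    (w : Fin n → Fin n → OrderedField.Carrier F)
    (w-sym : ∀ a b → OrderedField._≈_ F (w a b) (w b a))
    where
    open OrderedFieldProperties F
    open Weights F w w-sym
    open Uniform
    open SetoidReasoning setoid

    weight-square : ∀ x c rest →
      weight (square x c rest) ≈ (w v x + w v c) + (w u x + w u c) + weight (triangles rest)
    weight-square x c rest = begin
      w v x + (w x u + (w u c + (w c v + W)))
        ≈⟨ +-congˡ (+-cong (w-sym x u) (+-congˡ (+-congʳ (w-sym c v)))) ⟩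
      w v x + (w u x + (w u c + (w v c + W)))
        ≈⟨ solve 5 (λ a b c d e → a ⊕ (b ⊕ (c ⊕ (d ⊕ e))) ⊜ ((a ⊕ d) ⊕ (b ⊕ c)) ⊕ e) refl
             (w v x) (w u x) (w u c) (w v c) W ⟩
      (w v x + w v c) + (w u x + w u c) + W ∎
      where
      W = weight (triangles rest)
      open CommutativeMonoidSolver +-commutativeMonoid

    weight-theta : ∀ x c d rest → weight (theta x c d rest) ≈ (w v d + w u d) + weight (square x c rest)
    weight-theta x c d rest = trans (sym (+-assoc _ _ _)) (+-congʳ (+-congˡ (w-sym d u)))

    -- The separate σ stands for the picked pair, whose triangle gives way to a square.
    uniform-rest : ∀ {σ x} ps → Unique (flatten ps) → Uniform σ (x ∷ flatten ps) →
      All (λ (_ , rest) → σ + weight (triangles rest) ≈ length ps · σ) (picks ps)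
    uniform-rest {σ} ps unique U = All.zipWith
      (λ { {(c , d) , rest} (q , len) → trans
        (+-congˡ (uniform-triangles rest U
          (AllPairs.tail (AllPairs.tail (Unique-resp-↭ (↭-sym q) unique)))
          (All.tail (All.tail (All-resp-↭ (↭-sym q) (All.tabulate there))))))
        (reflexive (≡.cong (_· σ) len)) })
      (picks-↭ ps , picks-length ps)

    record Vanishing (vs : List (Fin n)) : Set ℓ₁ where
      field
        uniform : Uniform 0# vs
        vu≈0    : w v u ≈ 0#
        ui≈0    : ∀ {i} → i ∈ vs → w u i ≈ 0#

    -- On the graphs missing `u` the weights are uniform with a positive multiple of σ equal to 0,
    -- so they vanish there. The squares then give `w u x + w u i ≈ 0`. The theta graph adds two
    -- edges to a square and isolates `w u d₀`; hence `w u x` and all other `w u i` vanish, and the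
    -- triangle u x leaves `w v u`.
    oddFamily-trivial : ∀ x p ps → Unique (x ∷ flatten (p ∷ ps)) →
      All (λ G → weight G ≈ 0#) (oddFamily x p ps) → Vanishing (x ∷ flatten (p ∷ ps))
    oddFamily-trivial x p@(c₀ , d₀) ps unique vanish
      with All.++⁻ (family x (p ∷ ps)) vanish
    ... | A , vanish₁ with All.++⁻ (map _ (picks (p ∷ ps))) vanish₁
    ... | B , vanish₂ with All.++⁻ (map _ (picks (p ∷ ps))) vanish₂
    ... | C , tri≈0 ∷ theta≈0 ∷ []
      with family-rigid x (p ∷ ps) 0# unique A
    ... | σ , 0≈kσ , U = record { uniform = U₀ ; vu≈0 = vu≈0 ; ui≈0 = ui≈0 }
      where
      σ≈0 : σ ≈ 0#
      σ≈0 = *-cancelˡ-0 (fromℕ[1+k]#0 (length ps)) (trans (fromℕ-* (suc (length ps)) σ) (sym 0≈kσ))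

      vs = x ∷ flatten (p ∷ ps)

      U₀ : Uniform 0# vs
      U₀ = record { spokes = λ i∈ → trans (spokes U i∈) σ≈0 ; rims = λ i∈ j∈ i≢j → trans (rims U i∈ j∈ i≢j) σ≈0 }

      0+ : ∀ {y z} → y ≈ 0# → y + z ≈ z
      0+ y≈0 = trans (+-congʳ y≈0) (+-identityˡ _)

      +0 : ∀ {y z} → z ≈ 0# → y + z ≈ y
      +0 z≈0 = trans (+-congˡ z≈0) (+-identityʳ _)

      rest≈0 : ∀ {q rest} → (q , rest) ∈ picks (p ∷ ps) → weight (triangles rest) ≈ 0#
      rest≈0 q∈ = trans (sym (+-identityˡ _)) (trans
        (All.lookup (uniform-rest (p ∷ ps) (AllPairs.tail unique) U₀) q∈) (·-zero (suc (length ps)) refl))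

      x∈ : x ∈ vs
      x∈ = here ≡.refl

      square≈ : ∀ {q rest} i → i ∈ vs → (q , rest) ∈ picks (p ∷ ps) →
                weight (square x i rest) ≈ w u x + w u i
      square≈ {_} {rest} i i∈ q∈ = trans (weight-square x i rest) (trans (+0 (rest≈0 q∈))
        (0+ (trans (0+ (spokes U₀ x∈)) (spokes U₀ i∈))))

      c₀∈ = there (here ≡.refl)
      d₀∈ = there (there (here ≡.refl))

      ux+ui≈0 : ∀ {i} → i ∈ flatten (p ∷ ps) → w u x + w u i ≈ 0#
      ux+ui≈0 {i} i∈ with picks-complete (p ∷ ps) i∈
      ... | j , rest , inj₁ q∈ = trans (sym (square≈ i (there i∈) q∈)) (All.lookup (All.map⁻ B) q∈)
      ... | j , rest , inj₂ q∈ = trans (sym (square≈ i (there i∈) q∈)) (All.lookup (All.map⁻ C) q∈)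

      ud₀≈0 : w u d₀ ≈ 0#
      ud₀≈0 = begin
        w u d₀                                    ≈⟨ 0+ (spokes U₀ d₀∈) ⟨
        w v d₀ + w u d₀                           ≈⟨ +0 (trans (square≈ c₀ c₀∈ (here ≡.refl)) (ux+ui≈0 (here ≡.refl))) ⟨
        w v d₀ + w u d₀ + weight (square x c₀ ps) ≈⟨ weight-theta x c₀ d₀ ps ⟨
        weight (theta x c₀ d₀ ps)                 ≈⟨ theta≈0 ⟩
        0#                                        ∎

      ux≈0 : w u x ≈ 0#
      ux≈0 = trans (sym (+0 ud₀≈0)) (ux+ui≈0 (there (here ≡.refl)))

      ui≈0 : ∀ {i} → i ∈ vs → w u i ≈ 0#
      ui≈0 (here ≡.refl) = ux≈0
      ui≈0 (there i∈)    = trans (sym (0+ ux≈0)) (ux+ui≈0 i∈)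

      vu≈0 : w v u ≈ 0#
      vu≈0 = begin
        w v u                                       ≈⟨ +0 (spokes U₀ x∈) ⟨
        w v u + w v x                               ≈⟨ +0 ux≈0 ⟨
        w v u + w v x + w u x                       ≈⟨ Δ-eq u x ⟨
        Δ u x                                       ≈⟨ +0 (trans
          (uniform-triangles (p ∷ ps) U₀ (AllPairs.tail unique) (All.tabulate there))
          (·-zero (suc (length ps)) refl)) ⟨
        Δ u x + weight (triangles (p ∷ ps))         ≈⟨ weight-++ (triangle u x) (triangles (p ∷ ps)) ⟨
        weight (triangle u x ++ triangles (p ∷ ps)) ≈⟨ tri≈0 ⟩
        0#                                          ∎

    -- The hypotheses describe σ times the odd normal with f = vu and h = ux. A square weighs 2σ + 0
    -- - σ, the same as a triangle, while the triangle u x and the two edges added in the theta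
    -- graph weigh 0.
    oddFamily-constant : ∀ x p ps {σ} → Unique (x ∷ flatten (p ∷ ps)) → Uniform σ (x ∷ flatten (p ∷ ps)) →
      w v u ≈ - σ → w u x ≈ 0# → (∀ {i} → i ∈ flatten (p ∷ ps) → w u i ≈ - σ) →
      All (λ G → weight G ≈ length (p ∷ ps) · σ) (oddFamily x p ps)
    oddFamily-constant x p@(c₀ , d₀) ps {σ} unique U vu≈-σ ux≈0 ui≈-σ =
      All.++⁺ (family-uniform x (p ∷ ps) unique U) $
      All.++⁺ (All.map⁺ (All.zipWith (λ { {(c , d) , rest} (q , eq) →
        trans (square≈ c rest (Any-resp-↭ q (here ≡.refl))) eq }) (picks-↭ (p ∷ ps) , rests))) $
      All.++⁺ (All.map⁺ (All.zipWith (λ { {(c , d) , rest} (q , eq) →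
        trans (square≈ d rest (Any-resp-↭ q (there (here ≡.refl)))) eq }) (picks-↭ (p ∷ ps) , rests))) $
      (begin
        weight (triangle u x ++ triangles (p ∷ ps))
          ≈⟨ weight-++ (triangle u x) (triangles (p ∷ ps)) ⟩
        Δ u x + weight (triangles (p ∷ ps))
          ≈⟨ +-cong Δux≈0 (uniform-triangles (p ∷ ps) U (AllPairs.tail unique) (All.tabulate there)) ⟩
        0# + length (p ∷ ps) · σ
          ≈⟨ +-identityˡ _ ⟩
        length (p ∷ ps) · σ ∎) ∷
      (begin
        weight (theta x c₀ d₀ ps)                      ≈⟨ weight-theta x c₀ d₀ ps ⟩
        w v d₀ + w u d₀ + weight (square x c₀ ps)
          ≈⟨ +-cong (trans (+-cong (spokes U (there (there (here ≡.refl)))) (ui≈-σ (there (here ≡.refl)))) (-‿inverseʳ σ))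
               (trans (square≈ c₀ ps (here ≡.refl)) (All.head rests)) ⟩
        0# + length (p ∷ ps) · σ                       ≈⟨ +-identityˡ _ ⟩
        length (p ∷ ps) · σ                            ∎) ∷ []
      where
      rests = uniform-rest (p ∷ ps) (AllPairs.tail unique) U

      Δux≈0 : Δ u x ≈ 0#
      Δux≈0 = trans (Δ-eq u x) (trans (+-cong (+-cong vu≈-σ (spokes U (here ≡.refl))) ux≈0)
        (trans (+-identityʳ _) (-‿inverseˡ σ)))

      square≈ : ∀ i rest → i ∈ flatten (p ∷ ps) →
                weight (square x i rest) ≈ σ + weight (triangles rest)
      square≈ i rest i∈ = trans (weight-square x i rest) (+-congʳ (begin
        (w v x + w v i) + (w u x + w u i)
          ≈⟨ +-cong (+-cong (spokes U (here ≡.refl)) (spokes U (there i∈)))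
               (trans (+-cong ux≈0 (ui≈-σ i∈)) (+-identityˡ _)) ⟩
        σ + σ - σ   ≈⟨ +-assoc σ σ (- σ) ⟩
        σ + (σ - σ) ≈⟨ +-congˡ (-‿inverseʳ σ) ⟩
        σ + 0#      ≈⟨ +-identityʳ σ ⟩
        σ           ∎))

-- From lists of pairs to points of the polytope

extend-to-allFin : ∀ {n} (zs : List (Fin n)) → Unique zs → ∃[ ys ] zs ++ ys ↭ allFin n
extend-to-allFin []       _             = _ , ↭-refl
extend-to-allFin (z ∷ zs) (z∉ ∷ unique) with extend-to-allFin zs unique
... | ys , p with ∈-++⁻ zs (∈-resp-↭ (↭-sym p) (∈-allFin z))
...   | inj₁ z∈ = contradiction ≡.refl (All.lookup z∉ z∈)
...   | inj₂ z∈ with ∈-∃++ z∈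
...     | as , bs , ≡.refl = as ++ bs , (begin
  z ∷ zs ++ as ++ bs   ↭⟨ shift z zs (as ++ bs) ⟨
  zs ++ z ∷ as ++ bs   ↭⟨ ++⁺ˡ zs (shift z as bs) ⟨
  zs ++ as ++ z ∷ bs   ↭⟨ p ⟩
  allFin _             ∎)
  where open Perm.PermutationReasoning

module _ (n : ℕ) (v : Fin n) where
  open PairLists n
  open Flowers n v

  pair-up : ∀ k (ys : List (Fin n)) → length ys ≡ k ℕ.* 2 → ∃[ ps ] ys ≡ flatten ps × length ps ≡ k
  pair-up zero    []           _  = [] , ≡.refl , ≡.refl
  pair-up (suc k) (a ∷ b ∷ ys) eq with pair-up k ys (ℕ.suc-injective (ℕ.suc-injective eq))
  ... | ps , ≡.refl , ≡.refl = (a , b) ∷ ps , ≡.refl , ≡.refl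

module Assembly {c ℓ₁ ℓ₂} (F : OrderedField c ℓ₁ ℓ₂) (n : ℕ) where
  open OrderedFieldProperties F
  open LinearForms F (Edge n)
  open IsLinear
  open EdgeForms F n
  open Polytope F
  open PairLists n
  open SetoidReasoning setoid

  fromBool : Bool → Carrier
  fromBool b = if b then 1# else 0#

  -- Written as a sum so that a linear form is evaluated pair by pair. A repeated pair would count
  -- twice, so this is an incidence vector only for simple lists.
  point : List Pair → Edge n → Carrier
  point []            e = 0#
  point ((a , b) ∷ L) e = ind a b e + point L e

  point-χ : ∀ {L} → AllPairs Different L → ∀ e → point L e ≈ χ (graph L) e
  point-χ {[]}          []                   e = refl
  point-χ {(a , b) ∷ L} (different ∷ simple) e = by (joins? e a b)
    where
    off : ∀ {M} → ¬ (e On M) → point M e ≈ 0#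
    off {[]}          _  = refl
    off {(a , b) ∷ M} e∉ = trans (+-cong (ind-off {e = e} (e∉ ∘ here)) (off (e∉ ∘ there))) (+-identityˡ 0#)

    by : Dec (e Joins a , b) → ind a b e + point L e ≈ χ (graph ((a , b) ∷ L)) e
    by (yes p) = begin
      ind a b e + point L e
        ≈⟨ +-cong (ind-on {e = e} p) (off λ e∈ → All.lookupWith (λ d q → d e p q) different e∈) ⟩
      1# + 0#
        ≈⟨ +-identityʳ 1# ⟩
      1#
        ≡⟨ ≡.cong fromBool (dec-true (on? e ((a , b) ∷ L)) (here p)) ⟨
      χ (graph ((a , b) ∷ L)) e ∎
    by (no ¬p) = begin
      ind a b e + point L e  ≈⟨ +-cong (ind-off {e = e} ¬p) (point-χ simple e) ⟩
      0# + χ (graph L) e     ≈⟨ +-identityˡ _ ⟩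
      χ (graph L) e          ≡⟨ ≡.cong fromBool (same (on? e L)) ⟩
      χ (graph ((a , b) ∷ L)) e ∎
      where
      same : Dec (e On L) → does (on? e L) ≡ does (on? e ((a , b) ∷ L))
      same (yes e∈) = ≡.trans (dec-true (on? e L) e∈) (≡.sym (dec-true (on? e ((a , b) ∷ L)) (there e∈)))
      same (no e∉)  = ≡.trans (dec-false (on? e L) e∉) (≡.sym (dec-false (on? e ((a , b) ∷ L))
                        λ { (here p) → ¬p p ; (there e∈) → e∉ e∈ }))

  Vertex : (Edge n → Carrier) → Set ℓ₁
  Vertex y = ∃[ H ] (TwoEdgeConnected H × (∀ e → y e ≈ χ H e))

  ears-vertex : ∀ {v us L} → Unique (v ∷ us) → Ears v us L → Vertex (point L)
  ears-vertex {L = L} unique E = graph L , solid⇒2-edge-connected S , point-χ (Solid.simple S)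
    where S = ears⇒solid unique E

  fromℕ-sum : ∀ {m} (t : Fin m → ℕ) → fromℕ (SemiringSum.sum ℕ.+-*-semiring t) ≈ sum (λ i → fromℕ (t i))
  fromℕ-sum {zero}  t = refl
  fromℕ-sum {suc m} t = trans (·-homo-+ 1# (t zero) _) (+-congˡ (fromℕ-sum (t ∘ suc)))

  χ⟨⟩ : ∀ H G → χ H ⟨ G ⟩ ≈ fromℕ (Count.#_ H G)
  χ⟨⟩ H G = begin
    χ H ⟨ G ⟩
      ≡⟨ ⟨⟩-upper (χ H) G ⟩
    sum (λ i → sum (λ j → upper 0# (restrict G (χ H)) i j (i <? j)))
      ≈⟨ sum-cong-≋ (λ i → sum-cong-≋ (λ j → at i j)) ⟩
    sum (λ i → sum (λ j → fromℕ (entry i j)))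
      ≈⟨ sum-cong-≋ (λ i → fromℕ-sum (entry i)) ⟨
    sum (λ i → fromℕ (SemiringSum.sum ℕ.+-*-semiring (entry i)))
      ≈⟨ fromℕ-sum (λ i → SemiringSum.sum ℕ.+-*-semiring (entry i)) ⟨
    fromℕ (Count.#_ H G) ∎
    where
    open Degrees (Count.count H G) using (entry)

    at : ∀ i j → upper 0# (restrict G (χ H)) i j (i <? j) ≈ fromℕ (entry i j)
    at i j with i <? j
    ... | no _ = refl
    ... | yes i<j with G (mkEdge i j i<j) | edges H (mkEdge i j i<j)
    ...   | true  | true  = sym (+-identityʳ 1#)
    ...   | true  | false = refl
    ...   | false | _     = refl

  module _ {f} (f-linear : IsLinear f) where

    -- Translates a linear form into edge weights, both for the facet form and for an unknown form
    -- `dot κ`.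
    weight-of : Fin n → Fin n → Carrier
    weight-of a b = f (ind a b)

    weight-of-sym : ∀ a b → weight-of a b ≈ weight-of b a
    weight-of-sym a b = cong f-linear (ind-sym a b)

    point-weight : ∀ v L → f (point L) ≈ Flowers.Weights.weight n v F weight-of weight-of-sym L
    point-weight v []            = 0-homo f-linear
    point-weight v ((a , b) ∷ L) = trans (+-homo f-linear (ind a b) (point L)) (+-congˡ (point-weight v L))

  family-facet : ∀ v {vs fam f β} → Unique (v ∷ vs) → All (Flowers.Flower n v vs) fam →
    length fam ≡ edgeCount n → IsLinear f → β # 0# → (∀ x → Vertex x → f x ≤ β) →
    All (λ G → f (point G) ≈ β) fam →
    (∀ κ → All (λ G → dot κ (point G) ≈ 0#) fam → ∀ e → κ e ≈ 0#) →
    DefinesFacet (TECSP n) f β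
  family-facet v {vs} {fam} unique flowers len f-linear β#0 valid tight trivial =
    Facet.definesFacet (enumᴱ n) (indexᴱ n) (enum-indexᴱ n) (index-enumᴱ n) f-linear β#0 valid
      -- The origin comes from the empty ear decomposition.
      (ears-vertex {v} ([] ∷ []) [])
      (λ i → point (member i))
      (λ i → flower-vertex (All.lookup flowers (∈-lookup (at i))))
      (λ i → All.lookup tight (∈-lookup (at i)))
      (λ κ eqs → trivial κ (All.tabulate λ {G} G∈ →
        ≡.subst (λ G → dot κ (point G) ≈ 0#) (found G∈) (eqs (Fin.cast len (Any.index G∈)))))
    where
    at : Fin (edgeCount n) → Fin (length fam)
    at = Fin.cast (≡.sym len)

    member : Fin (edgeCount n) → List Pair
    member i = lookup fam (at i)

    found : ∀ {G} (G∈ : G ∈ fam) → member (Fin.cast len (Any.index G∈)) ≡ G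
    found G∈ = ≡.trans (≡.cong (lookup fam) (cast-involutive (≡.sym len) len (Any.index G∈)))
                 (≡.sym (lookup-index G∈))

    flower-vertex : ∀ {L} → Flowers.Flower n v vs L → Vertex (point L)
    flower-vertex (us , rest , E , p) =
      ears-vertex (proj₁ (unique-++⁻ (v ∷ us) (Unique-resp-↭ (prep v (↭-sym p)) unique))) E

-- The two facets

module Facets {c ℓ₁ ℓ₂} (F : OrderedField c ℓ₁ ℓ₂) (n : ℕ) (v : Fin n) where
  open OrderedFieldProperties F
  open LinearForms F (Edge n)
  open IsLinear
  open EdgeForms F n
  open Polytope F
  open PairLists n
  open Flowers n v
  open Assembly F n
  open SetoidReasoning setoid

  difference-≤ : ∀ a b k → a ℕ.≤ b ℕ.+ k → fromℕ a - fromℕ b ≤ fromℕ k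
  difference-≤ a b k a≤b+k with ℕ.m≤n⇒∃[o]m+o≡n a≤b+k
  ... | d , a+d≡b+k = +-nonneg⇒≤ (fromℕ-nonneg d) (begin
    fromℕ a - fromℕ b + fromℕ d     ≈⟨ trans (+-assoc _ _ _) (trans (+-congˡ (+-comm _ _)) (sym (+-assoc _ _ _))) ⟩
    fromℕ a + fromℕ d - fromℕ b     ≈⟨ +-congʳ (trans (sym (·-homo-+ 1# a d))
                                         (trans (reflexive (≡.cong fromℕ a+d≡b+k)) (·-homo-+ 1# b k))) ⟩
    fromℕ b + fromℕ k - fromℕ b     ≈⟨ +-solve refl ⟨
    fromℕ k                         ∎)

  difference-linear : ∀ {f g} → IsLinear f → IsLinear g → IsLinear (λ x → f x - g x)
  difference-linear f g = +-linear f (neg-linear g)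

  x-y-z : ∀ x y z → (x - y) - z ≈ x - (y + z)
  x-y-z x y z = trans (+-assoc x (- y) (- z)) (+-congˡ (-‿+-comm y z))

  module Trivial (κ : Edge n → Carrier) where
    private
      w = weight-of (dot-linear κ)

    everywhere : ∀ {vs : List (Fin n)} → (∀ u → u ∈ v ∷ vs) → (∀ {i} → i ∈ vs → w v i ≈ 0#) →
                 (∀ {i j} → i ∈ vs → j ∈ vs → i ≢ j → w i j ≈ 0#) → ∀ e → κ e ≈ 0#
    everywhere {vs} covers spokes rims e = trans (sym (dot-ind κ (Joins-self e)))
      (by (covers (lo e)) (covers (hi e)) (lo≢hi e))
      where
      by : ∀ {a b} → a ∈ v ∷ vs → b ∈ v ∷ vs → a ≢ b → w a b ≈ 0#
      by (here ≡.refl) (here ≡.refl) v≢v = contradiction ≡.refl v≢v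
      by (here ≡.refl) (there b∈)    _   = spokes b∈
      by (there a∈)    (here ≡.refl) _   = trans (weight-of-sym (dot-linear κ) _ v) (spokes a∈)
      by (there a∈)    (there b∈)    a≢b = rims a∈ b∈ a≢b

  uniform-rims : ∀ {f} (f-linear : IsLinear f) {vs} →
    let open Weights F (weight-of f-linear) (weight-of-sym f-linear) in
    Uniform 0# vs → ∀ {i j} → i ∈ vs → j ∈ vs → i ≢ j → weight-of f-linear i j ≈ 0#
  uniform-rims f-linear U {i} {j} i∈ j∈ i≢j = begin
    w i j                       ≈⟨ +-identityˡ _ ⟨
    0# + w i j                  ≈⟨ +-congʳ (trans (+-cong (spokes U i∈) (spokes U j∈)) (+-identityˡ 0#)) ⟨
    w v i + w v j + w i j       ≈⟨ Δ-eq i j ⟨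
    Δ i j                       ≈⟨ rims U i∈ j∈ i≢j ⟩
    0#                          ∎
    where
    w = weight-of f-linear
    open Weights F w (weight-of-sym f-linear)
    open Uniform

  uniform-1 : ∀ {f} (f-linear : IsLinear f) {vs} →
    (∀ {i} → i ∈ vs → f (ind v i) ≈ 1#) →
    (∀ {i j} → i ∈ vs → j ∈ vs → i ≢ j → f (ind i j) ≈ - 1#) →
    Weights.Uniform F (weight-of f-linear) (weight-of-sym f-linear) 1# vs
  uniform-1 f-linear spoke rim = record
    { spokes = spoke
    ; rims   = λ {i} {j} i∈ j∈ i≢j → begin
        Δ i j                                 ≈⟨ Δ-eq i j ⟩
        w v i + w v j + w i j                 ≈⟨ +-cong (+-cong (spoke i∈) (spoke j∈)) (rim i∈ j∈ i≢j) ⟩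
        1# + 1# - 1#                          ≈⟨ trans (+-assoc _ _ _) (trans (+-congˡ (-‿inverseʳ 1#)) (+-identityʳ 1#)) ⟩
        1#                                    ∎
    }
    where
    w = weight-of f-linear
    open Weights F w (weight-of-sym f-linear)

  scaled-zero : ∀ k {σ} → 0# ≈ suc k · σ → σ ≈ 0#
  scaled-zero k {σ} 0≈kσ = *-cancelˡ-0 (fromℕ[1+k]#0 k) (trans (fromℕ-* (suc k) σ) (sym 0≈kσ))

  -0≈ : ∀ {x y} → y ≈ 0# → x - y ≈ x
  -0≈ {x} y≈0 = trans (+-congˡ (-‿cong y≈0)) (x-0≈x x)

  ⟨⟩-in : ∀ G {e a b} → e Joins a , b → T (G e) → ind a b ⟨ G ⟩ ≈ 1#
  ⟨⟩-in G {e} p e∈G = trans (⟨⟩-ind G {e} p) (reflexive (≡.cong fromBool (T⇒true e∈G)))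

  ⟨⟩-out : ∀ G {e a b} → e Joins a , b → ¬ T (G e) → ind a b ⟨ G ⟩ ≈ 0#
  ⟨⟩-out G {e} p e∉G = trans (⟨⟩-ind G {e} p) (reflexive (≡.cong fromBool (¬T⇒false e∉G)))

  even-facet : ∀ k → n ≡ 2 ℕ.+ suc k ℕ.* 2 →
    DefinesFacet (TECSP n) (λ x → x ⟨ δ v ⟩ - x ⟨ E[K- v ] ⟩) (fromℕ (suc k))
  even-facet k n≡ with extend-to-allFin (v ∷ []) ([] ∷ [])
  ... | []      , p with () ← ≡.trans (↭-length p) (≡.trans (length-tabulate id) n≡)
  -- The number of vertices other than `v` is odd: `x` is the one left over, the others are paired.
  ... | x ∷ ys , p with pair-up n v (suc k) ys
        (ℕ.suc-injective (ℕ.suc-injective (≡.trans (↭-length p) (≡.trans (length-tabulate id) n≡))))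
  ... | ps , ≡.refl , len-ps = family-facet v unique
      (family-flowers x ps (AllPairs.head unique)) length≡ f-linear (fromℕ[1+k]#0 k) valid tight trivial
    where
    vs = x ∷ flatten ps

    f = λ (x : Edge n → Carrier) → x ⟨ δ v ⟩ - x ⟨ E[K- v ] ⟩

    f-linear : IsLinear f
    f-linear = difference-linear (⟨⟩-linear (δ v)) (⟨⟩-linear E[K- v ])

    unique : Unique (v ∷ vs)
    unique = Unique-resp-↭ (↭-sym p) (allFin⁺ n)

    v≢ : ∀ {i} → i ∈ vs → v ≢ i
    v≢ = All.lookup (AllPairs.head unique)

    covers : ∀ u → u ∈ v ∷ vs
    covers u = ∈-resp-↭ (↭-sym p) (∈-allFin u)

    length≡ : length (family x ps) ≡ edgeCount n
    length≡ = ≡.trans (length-family x ps) (≡.cong edgeCount {y = n} (≡.trans (↭-length p) (length-tabulate id)))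

    valid : ∀ y → Vertex y → f y ≤ fromℕ (suc k)
    valid y (H , 2ec , y≈χ) fromℕk<fy = difference-≤ _ _ (suc k) (even-bound H 2ec (suc k) n≡ v)
      (<-respʳ-≈ (trans (cong f-linear y≈χ) (+-cong (χ⟨⟩ H (δ v)) (-‿cong (χ⟨⟩ H E[K- v ])))) fromℕk<fy)

    spoke : ∀ {i} → i ∈ vs → f (ind v i) ≈ 1#
    spoke {i} i∈ with joining (v≢ i∈)
    ... | e , q = trans (-0≈ (⟨⟩-out E[K- v ] {e} q λ t → E[K-]⁻ {v = v} {e} t (∈δ {e = e} q (inj₁ ≡.refl))))
                    (⟨⟩-in (δ v) {e} q (∈δ {e = e} q (inj₁ ≡.refl)))

    rim : ∀ {i j} → i ∈ vs → j ∈ vs → i ≢ j → f (ind i j) ≈ - 1#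
    rim {i} {j} i∈ j∈ i≢j with joining i≢j
    ... | e , q = trans (+-cong (⟨⟩-out (δ v) {e} q ([ v≢ i∈ , v≢ j∈ ]′ ∘ δ⁻ {e = e} q))
                    (-‿cong (⟨⟩-in E[K- v ] {e} q (∈E[K-] {v = v} {e} q (v≢ i∈ ∘ ≡.sym) (v≢ j∈ ∘ ≡.sym)))))
                    (+-identityˡ _)

    tight : All (λ G → f (point G) ≈ fromℕ (suc k)) (family x ps)
    tight = All.map (λ {G} eq → trans (point-weight f-linear v G)
                      (trans eq (reflexive (≡.cong fromℕ len-ps))))
      (Weights.family-uniform F (weight-of f-linear) (weight-of-sym f-linear) x ps
        (AllPairs.tail unique) (uniform-1 f-linear spoke rim))

    trivial : ∀ κ → All (λ G → dot κ (point G) ≈ 0#) (family x ps) → ∀ e → κ e ≈ 0#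
    trivial κ vanish with Weights.family-rigid F (weight-of (dot-linear κ)) (weight-of-sym (dot-linear κ)) x ps 0#
      (AllPairs.tail unique) (All.map (λ {G} eq → trans (sym (point-weight (dot-linear κ) v G)) eq) vanish)
    ... | σ , 0≈kσ , U = Trivial.everywhere κ covers (spokes U₀) (uniform-rims (dot-linear κ) U₀)
      where
      open Weights F (weight-of (dot-linear κ)) (weight-of-sym (dot-linear κ))
      open Uniform
      σ≈0 = scaled-zero k (trans 0≈kσ (reflexive (≡.cong (_· σ) len-ps)))
      U₀ : Uniform 0# vs
      U₀ = record { spokes = λ i∈ → trans (spokes U i∈) σ≈0 ; rims = λ i∈ j∈ i≢j → trans (rims U i∈ j∈ i≢j) σ≈0 }

  -- Here `u` is w₁ and `x` is w₂. The enumeration of the vertices is made to start with v, u, x, so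
  -- that the vertex left unpaired by the even family of Kₙ - u is the other end of `h`.
  odd-facet : ∀ k → n ≡ 3 ℕ.+ suc k ℕ.* 2 → ∀ {u x} (h f : Edge n) → u ≢ v → x ≢ v →
    h Joins u , x → f Joins v , u →
    DefinesFacet (TECSP n)
      (λ y → (y ⟨ δ v ∖ ⁅ f ⁆ᴱ ⟩ - y ⟨ E[K- v ] ∖ ⁅ h ⁆ᴱ ⟩) - y f)
      (fromℕ (suc k))
  odd-facet k n≡ {u} {x} h f u≢v x≢v h-ux f-vu
    with extend-to-allFin (v ∷ u ∷ x ∷ [])
           (((u≢v ∘ ≡.sym) ∷ (x≢v ∘ ≡.sym) ∷ []) ∷ (Joins⇒≢ {e = h} h-ux ∷ []) ∷ [] ∷ [])
  ... | ys , perm with pair-up n v (suc k) ys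
        (ℕ.suc-injective (ℕ.suc-injective (ℕ.suc-injective (≡.trans (↭-length perm) (≡.trans (length-tabulate id) n≡)))))
  ... | p ∷ ps , ≡.refl , len-ps = family-facet v unique
      (oddFamily-flowers x p ps (AllPairs.head unique)) length≡ g-linear (fromℕ[1+k]#0 k) valid tight trivial
    where
    open OddFlowers n v u
    vs = x ∷ flatten (p ∷ ps)
    A = δ v ∖ ⁅ f ⁆ᴱ
    B = E[K- v ] ∖ ⁅ h ⁆ᴱ

    g = λ (y : Edge n → Carrier) → (y ⟨ A ⟩ - y ⟨ B ⟩) - y f

    g-linear : IsLinear g
    g-linear = difference-linear (difference-linear (⟨⟩-linear A) (⟨⟩-linear B)) (coordinate-linear f)

    unique : Unique (v ∷ u ∷ vs)
    unique = Unique-resp-↭ (↭-sym perm) (allFin⁺ n)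

    unique-vs : Unique vs
    unique-vs = AllPairs.tail (AllPairs.tail unique)

    v≢ : ∀ {i} → i ∈ u ∷ vs → v ≢ i
    v≢ = All.lookup (AllPairs.head unique)

    u≢ : ∀ {i} → i ∈ vs → u ≢ i
    u≢ = All.lookup (AllPairs.head (AllPairs.tail unique))

    covers : ∀ i → i ∈ v ∷ u ∷ vs
    covers i = ∈-resp-↭ (↭-sym perm) (∈-allFin i)

    length≡ : length (oddFamily x p ps) ≡ edgeCount n
    length≡ = ≡.trans (length-oddFamily x p ps) (≡.cong edgeCount {y = n} (≡.trans (↭-length perm) (length-tabulate id)))

    valid : ∀ y → Vertex y → g y ≤ fromℕ (suc k)
    valid y (H , 2ec , y≈χ) fromℕk<gy =
      difference-≤ a (b ℕ.+ φ) (suc k) (odd-bound H 2ec (suc k) n≡ v h f u≢v x≢v h-ux f-vu)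
        (<-respʳ-≈ (trans (cong g-linear y≈χ) (begin
          (χ H ⟨ A ⟩ - χ H ⟨ B ⟩) - χ H f ≈⟨ x-y-z _ _ _ ⟩
          χ H ⟨ A ⟩ - (χ H ⟨ B ⟩ + χ H f)
            ≈⟨ +-cong (χ⟨⟩ H A) (-‿cong (+-cong (χ⟨⟩ H B) χf)) ⟩
          fromℕ a - (fromℕ b + fromℕ φ)   ≈⟨ +-congˡ (-‿cong (·-homo-+ 1# b φ)) ⟨
          fromℕ a - fromℕ (b ℕ.+ φ)       ∎)) fromℕk<gy)
      where
      a = Count.#_ H A
      b = Count.#_ H B
      φ : ℕ
      φ = if edges H f then 1 else 0
      χf : χ H f ≈ fromℕ φ
      χf with edges H f
      ... | true  = sym (+-identityʳ 1#)
      ... | false = refl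

    ind-f : ∀ {i j} → (i ≢ u × j ≢ u) ⊎ (i ≢ v × j ≢ v) → ind i j f ≈ 0#
    ind-f avoid = ind-off {e = f} λ q → avoids avoid (Joins-ends {e = f} q f-vu)
      where
      avoids : ∀ {i j} → (i ≢ u × j ≢ u) ⊎ (i ≢ v × j ≢ v) → ¬ ((v ≡ i × u ≡ j) ⊎ (v ≡ j × u ≡ i))
      avoids (inj₁ (_ , j≢u)) (inj₁ (_ , ≡.refl)) = j≢u ≡.refl
      avoids (inj₁ (i≢u , _)) (inj₂ (_ , ≡.refl)) = i≢u ≡.refl
      avoids (inj₂ (i≢v , _)) (inj₁ (≡.refl , _)) = i≢v ≡.refl
      avoids (inj₂ (_ , j≢v)) (inj₂ (≡.refl , _)) = j≢v ≡.refl

    ∈A : ∀ {e j} → e Joins v , j → e ≢ f → T (A e)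
    ∈A {e} q e≢f = ∖⁺ {G = δ v} {f} {e} (∈δ {e = e} q (inj₁ ≡.refl)) e≢f

    ∉A : ∀ {e i j} → e Joins i , j → v ≢ i → v ≢ j → ¬ T (A e)
    ∉A {e} q v≢i v≢j t = [ v≢i , v≢j ]′ (δ⁻ {e = e} q (proj₁ (∖⁻ {G = δ v} {f} {e} t)))

    ∉B : ∀ {e j} → e Joins v , j → ¬ T (B e)
    ∉B {e} q t = E[K-]⁻ {v = v} {e} (proj₁ (∖⁻ {G = E[K- v ]} {h} {e} t)) (∈δ {e = e} q (inj₁ ≡.refl))

    ∈B : ∀ {e i j} → e Joins i , j → v ≢ i → v ≢ j → e ≢ h → T (B e)
    ∈B {e} q v≢i v≢j e≢h =
      ∖⁺ {G = E[K- v ]} {h} {e} (∈E[K-] {v = v} {e} q (v≢i ∘ ≡.sym) (v≢j ∘ ≡.sym)) e≢h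

    spoke : ∀ {i} → i ∈ vs → g (ind v i) ≈ 1#
    spoke {i} i∈ with joining (v≢ (there i∈))
    ... | e , q = trans (-0≈ (ind-f (inj₁ (u≢v ∘ ≡.sym , u≢ i∈ ∘ ≡.sym))))
      (trans (-0≈ (⟨⟩-out B {e} q (∉B {e} q)))
        (⟨⟩-in A {e} q (∈A {e} q λ { ≡.refl → not-f (Joins-ends {e = e} f-vu q) })))
      where
      not-f : ¬ ((v ≡ v × i ≡ u) ⊎ (v ≡ u × i ≡ v))
      not-f (inj₁ (_ , i≡u)) = u≢ i∈ (≡.sym i≡u)
      not-f (inj₂ (v≡u , _)) = u≢v (≡.sym v≡u)

    rim-value : ∀ {i j} → v ≢ i → v ≢ j → i ≢ j → ¬ (h Joins i , j) → g (ind i j) ≈ - 1#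
    rim-value {i} {j} v≢i v≢j i≢j h∌ij with joining i≢j
    ... | e , q = trans (-0≈ (ind-f (inj₂ (v≢i ∘ ≡.sym , v≢j ∘ ≡.sym))))
      (trans (+-cong (⟨⟩-out A {e} q (∉A {e} q v≢i v≢j))
        (-‿cong (⟨⟩-in B {e} q (∈B {e} q v≢i v≢j λ { ≡.refl → h∌ij q })))) (+-identityˡ _))

    rim : ∀ {i j} → i ∈ vs → j ∈ vs → i ≢ j → g (ind i j) ≈ - 1#
    rim {i} {j} i∈ j∈ i≢j = rim-value (v≢ (there i∈)) (v≢ (there j∈)) i≢j λ q →
      not-h (Joins-ends {e = h} h-ux q)
      where
      not-h : ¬ ((i ≡ u × j ≡ x) ⊎ (i ≡ x × j ≡ u))
      not-h (inj₁ (i≡u , _)) = u≢ i∈ (≡.sym i≡u)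
      not-h (inj₂ (_ , j≡u)) = u≢ j∈ (≡.sym j≡u)

    gvu : g (ind v u) ≈ - 1#
    gvu = trans (+-cong (trans (-0≈ (⟨⟩-out B {f} f-vu (∉B {f} f-vu)))
      (⟨⟩-out A {f} f-vu λ t → proj₂ (∖⁻ {G = δ v} {f} {f} t) ≡.refl)) (-‿cong (ind-on {e = f} f-vu)))
      (+-identityˡ _)

    gux : g (ind u x) ≈ 0#
    gux = trans (-0≈ (ind-f (inj₂ (u≢v , x≢v))))
      (trans (-0≈ (⟨⟩-out B {h} h-ux λ t → proj₂ (∖⁻ {G = E[K- v ]} {h} {h} t) ≡.refl))
        (⟨⟩-out A {h} h-ux (∉A {h} h-ux (u≢v ∘ ≡.sym) (x≢v ∘ ≡.sym))))

    gui : ∀ {i} → i ∈ flatten (p ∷ ps) → g (ind u i) ≈ - 1#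
    gui {i} i∈ = rim-value (u≢v ∘ ≡.sym) (v≢ (there (there i∈))) (u≢ (there i∈)) λ q →
      not-h (Joins-ends {e = h} h-ux q)
      where
      not-h : ¬ ((u ≡ u × i ≡ x) ⊎ (u ≡ x × i ≡ u))
      not-h (inj₁ (_ , i≡x)) = All.lookup (AllPairs.head unique-vs) i∈ (≡.sym i≡x)
      not-h (inj₂ (u≡x , _)) = u≢ (here ≡.refl) u≡x

    tight : All (λ G → g (point G) ≈ fromℕ (suc k)) (oddFamily x p ps)
    tight = All.map (λ {G} eq → trans (point-weight g-linear v G)
                      (trans eq (reflexive (≡.cong fromℕ len-ps))))
      (OddWeights.oddFamily-constant F (weight-of g-linear) (weight-of-sym g-linear) x p ps
        unique-vs (uniform-1 g-linear spoke rim) gvu gux gui)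

    trivial : ∀ κ → All (λ G → dot κ (point G) ≈ 0#) (oddFamily x p ps) → ∀ e → κ e ≈ 0#
    trivial κ vanish = Trivial.everywhere κ covers spokes′ rims′
      where
      w = weight-of (dot-linear κ)
      w-sym = weight-of-sym (dot-linear κ)
      open OddWeights F w w-sym
      open Vanishing (oddFamily-trivial x p ps unique-vs
        (All.map (λ {G} eq → trans (sym (point-weight (dot-linear κ) v G)) eq) vanish))

      spokes′ : ∀ {i} → i ∈ u ∷ vs → w v i ≈ 0#
      spokes′ (here ≡.refl) = vu≈0
      spokes′ (there i∈)    = Weights.Uniform.spokes uniform i∈

      rims′ : ∀ {i j} → i ∈ u ∷ vs → j ∈ u ∷ vs → i ≢ j → w i j ≈ 0#
      rims′ (here ≡.refl) (here ≡.refl) u≢u = contradiction ≡.refl u≢u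
      rims′ (here ≡.refl) (there j∈)    _   = ui≈0 j∈
      rims′ (there i∈)    (here ≡.refl) _   = trans (w-sym _ u) (ui≈0 i∈)
      rims′ (there i∈)    (there j∈)    i≢j = uniform-rims (dot-linear κ) uniform i∈ j∈ i≢j

-- The shape `suc k` records that n ≥ 4 makes the right-hand side positive, hence apart from 0; in
-- the odd case n is then at least 5.
evenly : ∀ {n} → 2 ∣ n → 4 ℕ.≤ n → ∃[ k ] n ≡ 2 ℕ.+ suc k ℕ.* 2
evenly (divides zero          ≡.refl) ()
evenly (divides (suc zero)    ≡.refl) (s≤s (s≤s ()))
evenly (divides (suc (suc k)) ≡.refl) _ = k , ≡.refl

oddly : ∀ {n} → ¬ (2 ∣ n) → 4 ℕ.≤ n → ∃[ k ] n ≡ 3 ℕ.+ suc k ℕ.* 2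
oddly {n} 2∤n 4≤n with n ℕ.% 2 | m%n<n n 2 | n ℕ./ 2 | m≡m%n+[m/n]*n n 2
... | zero        | _             | q           | n≡q2 = contradiction (divides q n≡q2) 2∤n
... | suc zero    | _             | suc (suc k) | n≡   = k , n≡
... | suc zero    | _             | suc zero    | ≡.refl with s≤s (s≤s (s≤s ())) ← 4≤n
... | suc zero    | _             | zero        | ≡.refl with s≤s () ← 4≤n
... | suc (suc _) | s≤s (s≤s ()) | _           | _

open import Data.Nat.Base using (ℕ; _≤_; _∸_; _/_)

mainTheorem11 : ∀ {c ℓ₁ ℓ₂} (ℝ : RealField c ℓ₁ ℓ₂) (n : ℕ) → 4 ≤ n →
    let open RealField ℝ
        open Polytope orderedField
    in
    (2 ∣ n → ∀ (v : Fin n) →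
       DefinesFacet (TECSP n)
         (λ x → x ⟨ δ v ⟩ - x ⟨ E[K- v ] ⟩)
         (fromℕ ((n ∸ 2) / 2)))
    ×
    (¬ (2 ∣ n) → ∀ (v w₁ w₂ : Fin n) (h f : Edge n) →
       h ∈ᴱ E[K- v ] → h Joins w₁ , w₂ → f Joins v , w₁ →
       DefinesFacet (TECSP n)
         (λ x → (x ⟨ δ v ∖ ⁅ f ⁆ᴱ ⟩ - x ⟨ E[K- v ] ∖ ⁅ h ⁆ᴱ ⟩) - x f)
         (fromℕ ((n ∸ 3) / 2)))
mainTheorem11 ℝ n 4≤n = even , odd
  where
  open RealField ℝ using (orderedField; fromℕ; _-_)
  open Polytope orderedField

  evenForm : Fin n → (Edge n → RealField.Carrier ℝ) → RealField.Carrier ℝ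
  evenForm v x = x ⟨ δ v ⟩ - x ⟨ E[K- v ] ⟩

  oddForm : Fin n → Edge n → Edge n → (Edge n → RealField.Carrier ℝ) → RealField.Carrier ℝ
  oddForm v h f x = (x ⟨ δ v ∖ ⁅ f ⁆ᴱ ⟩ - x ⟨ E[K- v ] ∖ ⁅ h ⁆ᴱ ⟩) - x f

  even : 2 ∣ n → ∀ v → DefinesFacet (TECSP n) (evenForm v) (fromℕ ((n ∸ 2) / 2))
  even 2∣n v with evenly 2∣n 4≤n
  ... | k , ≡.refl = ≡.subst (λ m → DefinesFacet (TECSP n) (evenForm v) (fromℕ m))
    (≡.sym (m*n/n≡m (suc k) 2)) (Facets.even-facet orderedField n v k ≡.refl)

  odd : ¬ (2 ∣ n) → ∀ v w₁ w₂ h f → h ∈ᴱ E[K- v ] → h Joins w₁ , w₂ → f Joins v , w₁ →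
        DefinesFacet (TECSP n) (oddForm v h f) (fromℕ ((n ∸ 3) / 2))
  odd 2∤n v w₁ w₂ h f h∌v h-w₁w₂ f-vw₁ with oddly 2∤n 4≤n
  ... | k , ≡.refl = ≡.subst (λ m → DefinesFacet (TECSP n) (oddForm v h f) (fromℕ m))
    (≡.sym (m*n/n≡m (suc k) 2))
    (Facets.odd-facet orderedField n v k ≡.refl h f
      (λ { ≡.refl → E[K-]⁻ {v = v} {h} h∌v (∈δ {e = h} h-w₁w₂ (inj₁ ≡.refl)) })
      (λ { ≡.refl → E[K-]⁻ {v = v} {h} h∌v (∈δ {e = h} h-w₁w₂ (inj₂ ≡.refl)) })
      h-w₁w₂ f-vw₁)
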